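{- Let $a,b,n$ be integers with $b\geq a\geq 1$ and $n\geq 3a+b-1$ such that $a\cdot n$ is even, and let $G$ be a graph of order $n$. If $\rho(G)>\rho(H_{n,a})$, where $H_{n,a}=K_{a-1}\nabla(K_{1}\cup K_{n-a})$, then $G$ contains an $[a,b]$-factor.
   Context: All graphs are finite, simple and undirected (not necessarily connected). The order of a graph is its number of vertices. For a graph $G$ with adjacency matrix $A(G)$, the spectral radius $\rho(G)$ is the largest eigenvalue of $A(G)$. $K_m$ is the complete graph on $m$ vertices ($K_0$ is the graph with no vertices, so $H_{n,1}=K_1\cup K_{n-1}$), $\cup$ denotes the disjoint union of graphs, and $G_1\nabla G_2$ denotes the join, obtained from the disjoint union of $G_1$ and $G_2$ by adding all edges between $V(G_1)$ and $V(G_2)$. An $[a,b]$-factor of a graph $G$ is a spanning subgraph $H$ of $G$ such that $a\leq d_H(v)\leq b$ for each $v\in V(G)$, where $d_H(v)$ is the degree of $v$ in $H$. -}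

module Defs where

open import Algebra.Bundles using (RawSemiring)
import Algebra.Definitions.RawSemiring as RawSemiringDefinitions
open import Data.Bool.Base using (Bool; true; false; not; if_then_else_)
open import Data.Fin.Base using (Fin; splitAt)
open import Data.Fin.Properties using (_≟_)
open import Data.Fin.Subset using () renaming (∣_∣ to card)
open import Data.Nat.Base as ℕ using (ℕ)
import Data.Nat.Properties as ℕ
open import Data.Product.Base using (Σ; ∃; _×_; _,_)
open import Data.Rational.Base as ℚ using (ℚ; 0ℚ; 1ℚ; ½; Positive; 1/_; ∣_∣)
import Data.Rational.Properties as ℚ
open import Data.Rational.Solver using (module +-*-Solver)
open import Data.Sum.Base using (_⊎_; inj₁; inj₂)
open import Data.Vec.Base using (tabulate)
open import Data.Vec.Functional using (Vector)
open import Level using (0ℓ)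
open import Relation.Binary.PropositionalEquality
open import Relation.Nullary.Decidable using (yes; no; ⌊_⌋)
open import Relation.Nullary.Negation using (¬_; contradiction)

------------------------------------------------------------------------
-- Real numbers, as Cauchy sequences of rationals with a modulus of
-- convergence.  Equality of reals is _≈_, not _≡_.

IsCauchy : (ℕ → ℚ) → Set
IsCauchy x = ∀ ε → .{{Positive ε}} →
  ∃ λ N → ∀ m n → N ℕ.≤ m → N ℕ.≤ n → ∣ x m ℚ.- x n ∣ ℚ.< ε

private

  half-pos : ∀ ε → .{{Positive ε}} → Positive (½ ℚ.* ε)
  half-pos ε = ℚ.pos*pos⇒pos ½ ε

  halves : ∀ ε → ½ ℚ.* ε ℚ.+ ½ ℚ.* ε ≡ ε
  halves ε = trans (sym (ℚ.*-distribʳ-+ ε ½ ½)) (ℚ.*-identityˡ ε)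

  const-cauchy : ∀ q → IsCauchy (λ _ → q)
  const-cauchy q ε = 0 , λ _ _ _ _ →
    subst (λ d → ∣ d ∣ ℚ.< ε) (sym (ℚ.+-inverseʳ q)) (ℚ.positive⁻¹ ε)

  +-cauchy : ∀ x y → IsCauchy x → IsCauchy y → IsCauchy (λ n → x n ℚ.+ y n)
  +-cauchy x y cx cy ε
    with M , p ← cx (½ ℚ.* ε) {{half-pos ε}}
       | N , q ← cy (½ ℚ.* ε) {{half-pos ε}}
    = M ℕ.⊔ N , λ m n hm hn → let open ℚ.≤-Reasoning in begin-strict
      ∣ (x m ℚ.+ y m) ℚ.- (x n ℚ.+ y n) ∣
        ≡⟨ cong ∣_∣ (rearrange (x m) (y m) (x n) (y n)) ⟩
      ∣ (x m ℚ.- x n) ℚ.+ (y m ℚ.- y n) ∣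
        ≤⟨ ℚ.∣p+q∣≤∣p∣+∣q∣ (x m ℚ.- x n) (y m ℚ.- y n) ⟩
      ∣ x m ℚ.- x n ∣ ℚ.+ ∣ y m ℚ.- y n ∣
        <⟨ ℚ.+-mono-< (p m n (ℕ.m⊔n≤o⇒m≤o M N hm) (ℕ.m⊔n≤o⇒m≤o M N hn))
                      (q m n (ℕ.m⊔n≤o⇒n≤o M N hm) (ℕ.m⊔n≤o⇒n≤o M N hn)) ⟩
      ½ ℚ.* ε ℚ.+ ½ ℚ.* ε
        ≡⟨ halves ε ⟩
      ε ∎
    where
    open +-*-Solver
    rearrange : ∀ a b c d →
      (a ℚ.+ b) ℚ.- (c ℚ.+ d) ≡ (a ℚ.- c) ℚ.+ (b ℚ.- d)
    rearrange = solve 4 (λ a b c d →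
      (a :+ b) :- (c :+ d) := (a :- c) :+ (b :- d)) refl

  eventuallyBounded : ∀ {x} → IsCauchy x →
    Σ ℚ λ B → Positive B × ∃ λ N → ∀ n → N ℕ.≤ n → ∣ x n ∣ ℚ.< B
  eventuallyBounded {x} cx with N , p ← cx 1ℚ
    = 1ℚ ℚ.+ ∣ x N ∣
    , ℚ.pos+nonNeg⇒pos 1ℚ ∣ x N ∣ {{ℚ.∣-∣-nonNeg (x N)}}
    , N , λ n hn → let open ℚ.≤-Reasoning in begin-strict
      ∣ x n ∣
        ≡⟨ cong ∣_∣ (rearrange (x n) (x N)) ⟩
      ∣ (x n ℚ.- x N) ℚ.+ x N ∣
        ≤⟨ ℚ.∣p+q∣≤∣p∣+∣q∣ (x n ℚ.- x N) (x N) ⟩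
      ∣ x n ℚ.- x N ∣ ℚ.+ ∣ x N ∣
        <⟨ ℚ.+-monoˡ-< ∣ x N ∣ (p n N hn ℕ.≤-refl) ⟩
      1ℚ ℚ.+ ∣ x N ∣ ∎
    where
    open +-*-Solver
    rearrange : ∀ a b → a ≡ (a ℚ.- b) ℚ.+ b
    rearrange = solve 2 (λ a b → a := (a :- b) :+ b) refl

  scaleDown : ∀ B → Positive B → ∀ ε → .{{Positive ε}} →
    Σ ℚ λ δ → Positive δ × B ℚ.* δ ≡ ε
  scaleDown B posB ε =
    r ℚ.* ε , ℚ.pos*pos⇒pos r {{ℚ.1/pos⇒pos B {{posB}}}} ε , (begin
      B ℚ.* (r ℚ.* ε)  ≡⟨ ℚ.*-assoc B r ε ⟨
      B ℚ.* r ℚ.* ε    ≡⟨ cong (ℚ._* ε) (ℚ.*-inverseʳ B) ⟩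
      1ℚ ℚ.* ε         ≡⟨ ℚ.*-identityˡ ε ⟩
      ε                ∎)
    where
    open ≡-Reasoning
    instance B≢0 = ℚ.pos⇒nonZero B {{posB}}
    r = 1/ B

  ∣p*q∣<B*δ : ∀ p q {B δ} → Positive B → ∣ p ∣ ℚ.< B → ∣ q ∣ ℚ.< δ →
    ∣ p ℚ.* q ∣ ℚ.< B ℚ.* δ
  ∣p*q∣<B*δ p q {B} {δ} posB p<B q<δ = begin-strict
    ∣ p ℚ.* q ∣        ≡⟨ ℚ.∣p*q∣≡∣p∣*∣q∣ p q ⟩
    ∣ p ∣ ℚ.* ∣ q ∣    ≤⟨ ℚ.*-monoʳ-≤-nonNeg ∣ q ∣ {{ℚ.∣-∣-nonNeg q}} (ℚ.<⇒≤ p<B) ⟩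
    B ℚ.* ∣ q ∣        <⟨ ℚ.*-monoʳ-<-pos B {{posB}} q<δ ⟩
    B ℚ.* δ            ∎
    where open ℚ.≤-Reasoning

  product-close : ∀ a b c d {B C δ γ ε} → Positive B → Positive C →
    B ℚ.* δ ≡ ½ ℚ.* ε → C ℚ.* γ ≡ ½ ℚ.* ε →
    ∣ a ∣ ℚ.< B → ∣ d ∣ ℚ.< C → ∣ b ℚ.- d ∣ ℚ.< δ → ∣ a ℚ.- c ∣ ℚ.< γ →
    ∣ a ℚ.* b ℚ.- c ℚ.* d ∣ ℚ.< ε
  product-close a b c d {B} {C} {δ} {γ} {ε} posB posC Bδ≡ Cγ≡ a<B d<C bd ac =
    begin-strict
      ∣ a ℚ.* b ℚ.- c ℚ.* d ∣
        ≡⟨ cong ∣_∣ (rearrange a b c d) ⟩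
      ∣ a ℚ.* (b ℚ.- d) ℚ.+ d ℚ.* (a ℚ.- c) ∣
        ≤⟨ ℚ.∣p+q∣≤∣p∣+∣q∣ (a ℚ.* (b ℚ.- d)) (d ℚ.* (a ℚ.- c)) ⟩
      ∣ a ℚ.* (b ℚ.- d) ∣ ℚ.+ ∣ d ℚ.* (a ℚ.- c) ∣
        <⟨ ℚ.+-mono-< (∣p*q∣<B*δ a (b ℚ.- d) posB a<B bd)
                      (∣p*q∣<B*δ d (a ℚ.- c) posC d<C ac) ⟩
      B ℚ.* δ ℚ.+ C ℚ.* γ
        ≡⟨ cong₂ ℚ._+_ Bδ≡ Cγ≡ ⟩
      ½ ℚ.* ε ℚ.+ ½ ℚ.* ε
        ≡⟨ halves ε ⟩
      ε ∎
    where
    open ℚ.≤-Reasoning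
    open +-*-Solver
    rearrange : ∀ a b c d →
      a ℚ.* b ℚ.- c ℚ.* d ≡ a ℚ.* (b ℚ.- d) ℚ.+ d ℚ.* (a ℚ.- c)
    rearrange = solve 4 (λ a b c d →
      a :* b :- c :* d := a :* (b :- d) :+ d :* (a :- c)) refl

  *-cauchy : ∀ x y → IsCauchy x → IsCauchy y → IsCauchy (λ n → x n ℚ.* y n)
  *-cauchy x y cx cy ε =
    let B , posB , M₁ , x<B = eventuallyBounded cx
        C , posC , N₁ , y<C = eventuallyBounded cy
        δ , posδ , Bδ≡ = scaleDown B posB (½ ℚ.* ε) {{half-pos ε}}
        γ , posγ , Cγ≡ = scaleDown C posC (½ ℚ.* ε) {{half-pos ε}}
        M₂ , p = cx γ {{posγ}}
        N₂ , q = cy δ {{posδ}}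
        l₁ : ∀ {k} → (M₁ ℕ.⊔ N₁) ℕ.⊔ (M₂ ℕ.⊔ N₂) ℕ.≤ k → M₁ ℕ.⊔ N₁ ℕ.≤ k
        l₁ = ℕ.m⊔n≤o⇒m≤o (M₁ ℕ.⊔ N₁) (M₂ ℕ.⊔ N₂)
        l₂ : ∀ {k} → (M₁ ℕ.⊔ N₁) ℕ.⊔ (M₂ ℕ.⊔ N₂) ℕ.≤ k → M₂ ℕ.⊔ N₂ ℕ.≤ k
        l₂ = ℕ.m⊔n≤o⇒n≤o (M₁ ℕ.⊔ N₁) (M₂ ℕ.⊔ N₂)
    in (M₁ ℕ.⊔ N₁) ℕ.⊔ (M₂ ℕ.⊔ N₂) , λ m n hm hn →
      product-close (x m) (y m) (x n) (y n) posB posC Bδ≡ Cγ≡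
        (x<B m (ℕ.m⊔n≤o⇒m≤o M₁ N₁ (l₁ hm)))
        (y<C n (ℕ.m⊔n≤o⇒n≤o M₁ N₁ (l₁ hn)))
        (q m n (ℕ.m⊔n≤o⇒n≤o M₂ N₂ (l₂ hm)) (ℕ.m⊔n≤o⇒n≤o M₂ N₂ (l₂ hn)))
        (p m n (ℕ.m⊔n≤o⇒m≤o M₂ N₂ (l₂ hm)) (ℕ.m⊔n≤o⇒m≤o M₂ N₂ (l₂ hn)))

record ℝ : Set where
  constructor mkℝ
  field
    seq    : ℕ → ℚ
    cauchy : IsCauchy seq

open ℝ public

infix  4 _≈_ _<_ _≤_ _>_
infixl 6 _+_
infixl 7 _*_

fromℚ : ℚ → ℝ
fromℚ q = mkℝ (λ _ → q) (const-cauchy q)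

0ℝ 1ℝ : ℝ
0ℝ = fromℚ 0ℚ
1ℝ = fromℚ 1ℚ

_+_ _*_ : ℝ → ℝ → ℝ
x + y = mkℝ (λ n → seq x n ℚ.+ seq y n) (+-cauchy (seq x) (seq y) (cauchy x) (cauchy y))
x * y = mkℝ (λ n → seq x n ℚ.* seq y n) (*-cauchy (seq x) (seq y) (cauchy x) (cauchy y))

_≈_ _<_ _≤_ _>_ : ℝ → ℝ → Set
x ≈ y = ∀ ε → .{{Positive ε}} →
  ∃ λ N → ∀ n → N ℕ.≤ n → ∣ seq x n ℚ.- seq y n ∣ ℚ.< ε
x < y = Σ ℚ λ ε → Positive ε ×
  ∃ λ N → ∀ n → N ℕ.≤ n → seq x n ℚ.+ ε ℚ.≤ seq y n
x ≤ y = ¬ (y < x)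
x > y = y < x

ℝ-rawSemiring : RawSemiring 0ℓ 0ℓ
ℝ-rawSemiring = record
  { Carrier = ℝ ; _≈_ = _≈_ ; _+_ = _+_ ; _*_ = _*_ ; 0# = 0ℝ ; 1# = 1ℝ }

open RawSemiringDefinitions ℝ-rawSemiring public using (sum)

------------------------------------------------------------------------
-- Eigenvalues of real square matrices

Matrix : ℕ → Set
Matrix n = Fin n → Fin n → ℝ

_·_ : ∀ {n} → Matrix n → Vector ℝ n → Vector ℝ n
(A · x) i = sum (λ j → A i j * x j)

IsEigenvalue : ∀ {n} → Matrix n → ℝ → Set
IsEigenvalue A μ = ∃ λ x →
  ¬ (∀ i → x i ≈ 0ℝ) × (∀ i → (A · x) i ≈ μ * x i)

IsLargestEigenvalue : ∀ {n} → Matrix n → ℝ → Set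
IsLargestEigenvalue A ρ =
  IsEigenvalue A ρ × (∀ μ → IsEigenvalue A μ → μ ≤ ρ)

------------------------------------------------------------------------
-- Finite simple graphs of order n, with vertex set Fin n

record Graph (n : ℕ) : Set where
  field
    adj     : Fin n → Fin n → Bool
    symm    : ∀ u v → adj u v ≡ adj v u
    irrefl  : ∀ v → adj v v ≡ false

open Graph public

adjacencyMatrix : ∀ {n} → Graph n → Matrix n
adjacencyMatrix G u v = if adj G u v then 1ℝ else 0ℝ

-- A real symmetric matrix has only real eigenvalues, so the eigenvalues
-- of the adjacency matrix may be taken in ℝ; for n ≥ 1 exactly one ρ
-- (up to _≈_) satisfies this predicate.
IsSpectralRadius : ∀ {n} → Graph n → ℝ → Set
IsSpectralRadius G ρ = IsLargestEigenvalue (adjacencyMatrix G) ρ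

degree : ∀ {n} → Graph n → Fin n → ℕ
degree G v = card (tabulate (adj G v))

IsSpanningSubgraph : ∀ {n} → Graph n → Graph n → Set
IsSpanningSubgraph H G = ∀ u v → adj H u v ≡ true → adj G u v ≡ true

HasFactor : ∀ {n} → ℕ → ℕ → Graph n → Set
HasFactor a b G = ∃ λ H → IsSpanningSubgraph H G ×
  (∀ v → a ℕ.≤ degree H v × degree H v ℕ.≤ b)

K : ∀ m → Graph m
K m = record
  { adj    = λ u v → not ⌊ u ≟ v ⌋
  ; symm   = complete-symm
  ; irrefl = complete-irrefl
  }
  where
  complete-symm : ∀ u v → not ⌊ u ≟ v ⌋ ≡ not ⌊ v ≟ u ⌋
  complete-symm u v with u ≟ v | v ≟ u
  ... | yes _   | yes _   = refl
  ... | no _    | no _    = refl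
  ... | yes u≡v | no v≢u  = contradiction (sym u≡v) v≢u
  ... | no u≢v  | yes v≡u = contradiction (sym v≡u) u≢v

  complete-irrefl : ∀ v → not ⌊ v ≟ v ⌋ ≡ false
  complete-irrefl v with v ≟ v
  ... | yes _   = refl
  ... | no v≢v  = contradiction refl v≢v

-- G and H side by side, where c says whether the vertices of G are
-- adjacent to those of H.
module Juxtapose (c : Bool) {m n} (G : Graph m) (H : Graph n) where

  adj′ : Fin m ⊎ Fin n → Fin m ⊎ Fin n → Bool
  adj′ (inj₁ u) (inj₁ v) = adj G u v
  adj′ (inj₁ _) (inj₂ _) = c
  adj′ (inj₂ _) (inj₁ _) = c
  adj′ (inj₂ u) (inj₂ v) = adj H u v

  symm′ : ∀ u v → adj′ u v ≡ adj′ v u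
  symm′ (inj₁ u) (inj₁ v) = symm G u v
  symm′ (inj₁ _) (inj₂ _) = refl
  symm′ (inj₂ _) (inj₁ _) = refl
  symm′ (inj₂ u) (inj₂ v) = symm H u v

  irrefl′ : ∀ v → adj′ v v ≡ false
  irrefl′ (inj₁ v) = irrefl G v
  irrefl′ (inj₂ v) = irrefl H v

  graph : Graph (m ℕ.+ n)
  graph = record
    { adj    = λ u v → adj′ (splitAt m u) (splitAt m v)
    ; symm   = λ u v → symm′ (splitAt m u) (splitAt m v)
    ; irrefl = λ v → irrefl′ (splitAt m v)
    }

infixr 5 _∪_ _∇_

_∪_ _∇_ : ∀ {m n} → Graph m → Graph n → Graph (m ℕ.+ n)
_∪_ = Juxtapose.graph false
_∇_ = Juxtapose.graph true

-- This graph has order n whenever 1 ≤ a ≤ n.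
H⟨_,_⟩ : ∀ n a → Graph ((a ℕ.∸ 1) ℕ.+ (1 ℕ.+ (n ℕ.∸ a)))
H⟨ n , a ⟩ = K (a ℕ.∸ 1) ∇ (K 1 ∪ K (n ℕ.∸ a))

{-# OPTIONS --safe #-}

-- Write F for the complement of G, f v = n - 1 - d v for its degrees, and D for
-- the largest of them, attained at w.
--
-- Spectral part.  If z > 0 and A z ≤ t z entrywise, then no eigenvalue of A
-- exceeds t (Collatz–Wielandt).  With z built from the Perron vector of
-- H⟨ n , a ⟩, where t is an upper bound for its Perron root obtained by
-- bisection, this shows that G has minimum degree at least a.  With z = d + D
-- and t = n - 2 it shows 2 |E(F)| ≤ n - 2 + D.
--
-- Combinatorial part.  As n ≥ 4 a - 1, it suffices to find an a-factor.  The
-- bound on |E(F)| gives d u + d v ≥ n + 2 a - 3 for all distinct u and v other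
-- than w.  Start from a star with a edges at w and enlarge it, keeping all
-- degrees at most a.  If u and v have degree less than a, either an edge of G
-- joins one of them to some deficient vertex, or some edge x y can be replaced
-- by u x and v y; otherwise counting the edges at the neighbours of u
-- contradicts the degree bound.

module Submission where

import Algebra.Properties.Semiring.Mult as SemiringMult
import Algebra.Properties.Semiring.Sum as SemiringSum
open import Algebra.Bundles using (CommutativeRing)
open import Data.Bool.Base using (Bool; true; false; not; _∧_; _∨_)
open import Data.Bool.Properties using (∨-comm; ∧-comm; ∨-identityʳ) renaming (_≟_ to _≟ᵇ_)
open import Data.Fin.Base using (Fin; zero; suc; splitAt; _↑ʳ_)
open import Data.Fin.Properties using (_≟_; any?; splitAt-↑ʳ)
open import Data.Fin.Subset using () renaming (∣_∣ to card)
import Data.Integer.Base as ℤ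
import Data.Integer.Properties as ℤ
open import Data.Nat.Base using (ℕ; zero; suc; _+_; _*_; _∸_; _≤_; _<_; _≥_; z≤n; s≤s)
open import Data.Nat.Divisibility using (_∣_; divides)
import Data.Nat.Properties as ℕ
open import Data.Nat.Solver using (module +-*-Solver)
open import Data.Product.Base using (∃; _×_; _,_; proj₁; proj₂; map₂)
open import Data.Rational.Base as ℚ using (ℚ; 0ℚ; 1ℚ; ½; Positive; 1/_; ∣_∣)
import Data.Rational.Properties as ℚ
import Data.Rational.Solver as ℚ
import Data.Rational.Unnormalised.Base as ℚᵘ
import Data.Rational.Unnormalised.Properties as ℚᵘ
open import Data.Sum.Base using (_⊎_; inj₁; inj₂; map₁)
open import Data.Vec.Base using (tabulate)
open import Function.Base using (_∘_)
open import Relation.Binary.PropositionalEquality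
open import Relation.Nullary.Decidable using (Dec; yes; no; does; _×-dec_; ¬?; dec-true; dec-false)
open import Relation.Nullary.Negation using (¬_; contradiction)
open import Defs using
  ( ℝ; mkℝ; seq; cauchy; IsCauchy; fromℚ; 0ℝ; 1ℝ; _≈_; _>_
  ; _·_; IsEigenvalue; adjacencyMatrix; IsSpectralRadius
  ; Graph; adj; symm; irrefl; degree; IsSpanningSubgraph; HasFactor
  ; K; _∪_; _∇_; module Juxtapose; H⟨_,_⟩
  )
import Defs as ℝ

open SemiringSum ℕ.+-*-semiring
  using (sum; sum-cong-≗; ∑-distrib-+; ∑-comm; *-distribˡ-sum; *-distribʳ-sum)

-- For a ≥ 2 the Perron root of `H⟨ n , a ⟩` is irrational: it is a zero of a monic integer cubic
-- strictly between n - 2 and n - 1. The order of the Cauchy reals is undecidable, so no sign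
-- argument can be run at the root itself. It is run at the rational upper ends of the bisection
-- intervals, where the cubic is nonnegative; this sign suffices for the comparison with G. The
-- limit of the upper ends is an eigenvalue of `H⟨ n , a ⟩`, hence at most ρ(H), so some upper end
-- already lies below ρ(G). For a = 1 the core is empty and the weights degenerate; the degree bound
-- then comes from counting nonedges.
--
-- The bound on nonedges tolerates one vertex with very few neighbours, and degree sums involving it
-- may be small. This is why w is saturated from the outset and kept so: it is then never one of the
-- deficient vertices to which the degree bound is applied. A second obstacle is a single deficient
-- vertex. As every round adds one edge and a n is even, such a vertex lacks at least 2, and one
-- unit can be passed to another vertex first.

-- The common shape of the linear arithmetic below: x ≤ y is a nonnegative combination of
-- hypotheses, and the two equations, mostly left to the ring solver, exhibit the summand `c` shared
-- by both sides.
≤-cancel : ∀ c {x y A B} → x ≤ y → x ≡ c + A → y ≡ c + B → A ≤ B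
≤-cancel c x≤y refl refl = ℕ.+-cancelˡ-≤ c _ _ x≤y

-- Indicators and sums of natural numbers

χ : Bool → ℕ
χ true  = 1
χ false = 0

χ≤1 : ∀ b → χ b ≤ 1
χ≤1 true  = ℕ.≤-refl
χ≤1 false = z≤n

δ : ∀ {n} → Fin n → Fin n → ℕ
δ u v = χ (does (u ≟ v))

δ-refl : ∀ {n} (u : Fin n) → δ u u ≡ 1
δ-refl u = cong χ (dec-true (u ≟ u) refl)

δ-≢ : ∀ {n} {u v : Fin n} → u ≢ v → δ u v ≡ 0
δ-≢ {u = u} {v} u≢v = cong χ (dec-false (u ≟ v) u≢v)

sum-mono : ∀ {n} {f g : Fin n → ℕ} → (∀ i → f i ≤ g i) → sum f ≤ sum g
sum-mono {zero}  f≤g = z≤n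
sum-mono {suc n} f≤g = ℕ.+-mono-≤ (f≤g zero) (sum-mono (f≤g ∘ suc))

sum-0 : ∀ n → sum {n} (λ _ → 0) ≡ 0
sum-0 zero    = refl
sum-0 (suc n) = sum-0 n

sum-const : ∀ n c → sum {n} (λ _ → c) ≡ c * n
sum-const zero    c = sym (ℕ.*-zeroʳ c)
sum-const (suc n) c = trans (cong (c +_) (sum-const n c)) (sym (ℕ.*-suc c n))

sum-δ : ∀ {n} (u : Fin n) (f : Fin n → ℕ) → sum (λ v → δ u v * f v) ≡ f u
sum-δ {suc n} zero f = begin
  f zero + 0 + sum {n} (λ _ → 0)  ≡⟨ cong (f zero + 0 +_) (sum-0 n) ⟩
  f zero + 0 + 0                  ≡⟨ ℕ.+-identityʳ _ ⟩
  f zero + 0                      ≡⟨ ℕ.+-identityʳ _ ⟩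
  f zero                          ∎
  where open ≡-Reasoning
sum-δ {suc n} (suc u) f = sum-δ u (f ∘ suc)

sum-δ₁ : ∀ {n} (u : Fin n) → sum (δ u) ≡ 1
sum-δ₁ u = trans (sum-cong-≗ (λ v → sym (ℕ.*-identityʳ (δ u v)))) (sum-δ u (λ _ → 1))

≤-sum : ∀ {n} (f : Fin n → ℕ) i → f i ≤ sum f
≤-sum f zero    = ℕ.m≤m+n (f zero) _
≤-sum f (suc i) = ℕ.≤-trans (≤-sum (f ∘ suc) i) (ℕ.m≤n+m _ (f zero))

sum-<⇒∃< : ∀ {n} (f g : Fin n → ℕ) → sum f < sum g → ∃ λ i → f i < g i
sum-<⇒∃< f g f<g with any? (λ i → f i ℕ.<? g i)
... | yes p = p
... | no ¬p = contradiction (sum-mono (λ i → ℕ.≮⇒≥ (λ q → ¬p (i , q)))) (ℕ.<⇒≱ f<g)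

card-tabulate : ∀ {n} (p : Fin n → Bool) → card (tabulate p) ≡ sum (χ ∘ p)
card-tabulate {zero}  p = refl
card-tabulate {suc n} p with p zero
... | true  = cong suc (card-tabulate (p ∘ suc))
... | false = card-tabulate (p ∘ suc)

deg : ∀ {n} → Graph n → Fin n → ℕ
deg G v = sum (χ ∘ adj G v)

degree≡deg : ∀ {n} (G : Graph n) v → degree G v ≡ deg G v
degree≡deg G v = card-tabulate (adj G v)

-- Insertion and removal of edges

joins : ∀ {n} → Fin n → Fin n → Fin n → Fin n → Bool
joins u v p q = does (u ≟ p) ∧ does (v ≟ q) ∨ does (v ≟ p) ∧ does (u ≟ q)

joins-symm : ∀ {n} (u v p q : Fin n) → joins u v p q ≡ joins u v q p
joins-symm u v p q = trans
  (∨-comm (does (u ≟ p) ∧ does (v ≟ q)) (does (v ≟ p) ∧ does (u ≟ q)))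
  (cong₂ _∨_ (∧-comm (does (v ≟ p)) (does (u ≟ q))) (∧-comm (does (u ≟ p)) (does (v ≟ q))))

joins-adj : ∀ {n} (G : Graph n) {u v p q} → joins u v p q ≡ true → adj G p q ≡ adj G u v
joins-adj G {u} {v} {p} {q} j with u ≟ p | v ≟ q | v ≟ p | u ≟ q
... | yes refl | yes refl | _        | _        = refl
... | yes _    | no _     | yes refl | yes refl = symm G _ _
... | no _     | _        | yes refl | yes refl = symm G _ _

joins-irrefl : ∀ {n} {u v : Fin n} → u ≢ v → ∀ p → joins u v p p ≡ false
joins-irrefl {u = u} {v} u≢v p with u ≟ p | v ≟ p
... | yes refl | yes refl = contradiction refl u≢v
... | yes _    | no _     = refl
... | no _     | yes _    = refl
... | no _     | no _     = refl

χ-joins : ∀ {n} {u v : Fin n} → u ≢ v → ∀ p q →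
  χ (joins u v p q) ≡ δ u p * δ v q + δ v p * δ u q
χ-joins {u = u} {v} u≢v p q with u ≟ p | v ≟ p
... | yes refl | yes refl = contradiction refl u≢v
... | yes _    | no _ with does (v ≟ q)
...   | true  = refl
...   | false = refl
χ-joins {u = u} u≢v p q | no _ | yes _ with does (u ≟ q)
...   | true  = refl
...   | false = refl
χ-joins u≢v p q | no _     | no _ = refl

sum-joins : ∀ {n} {u v : Fin n} → u ≢ v → ∀ p →
  sum (χ ∘ joins u v p) ≡ δ u p + δ v p
sum-joins {u = u} {v} u≢v p = begin
  sum (χ ∘ joins u v p)
    ≡⟨ sum-cong-≗ (χ-joins u≢v p) ⟩
  sum (λ q → δ u p * δ v q + δ v p * δ u q)
    ≡⟨ ∑-distrib-+ (λ q → δ u p * δ v q) (λ q → δ v p * δ u q) ⟩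
  sum (λ q → δ u p * δ v q) + sum (λ q → δ v p * δ u q)
    ≡⟨ cong₂ _+_ (scale (δ u p) v) (scale (δ v p) u) ⟩
  δ u p + δ v p ∎
  where
  open ≡-Reasoning
  scale : ∀ c w → sum (λ q → c * δ w q) ≡ c
  scale c w = trans (sym (*-distribˡ-sum c (δ w)))
    (trans (cong (c *_) (sum-δ₁ w)) (ℕ.*-identityʳ c))

addEdge : ∀ {n} → Graph n → (u v : Fin n) → u ≢ v → Graph n
addEdge H u v u≢v = record
  { adj    = λ p q → adj H p q ∨ joins u v p q
  ; symm   = λ p q → cong₂ _∨_ (symm H p q) (joins-symm u v p q)
  ; irrefl = λ p → cong₂ _∨_ (irrefl H p) (joins-irrefl u≢v p)
  }

removeEdge : ∀ {n} → Graph n → (u v : Fin n) → Graph n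
removeEdge H u v = record
  { adj    = λ p q → adj H p q ∧ not (joins u v p q)
  ; symm   = λ p q → cong₂ _∧_ (symm H p q) (cong not (joins-symm u v p q))
  ; irrefl = λ p → cong (_∧ not (joins u v p p)) (irrefl H p)
  }

deg-addEdge : ∀ {n} (H : Graph n) {u v} (u≢v : u ≢ v) → adj H u v ≡ false →
  ∀ p → deg (addEdge H u v u≢v) p ≡ deg H p + (δ u p + δ v p)
deg-addEdge H {u} {v} u≢v uv∉H p = begin
  sum (λ q → χ (adj H p q ∨ joins u v p q))
    ≡⟨ sum-cong-≗ (λ q → χ-∨ (adj H p q) (joins u v p q)
         (λ j → trans (joins-adj H j) uv∉H)) ⟩
  sum (λ q → χ (adj H p q) + χ (joins u v p q))
    ≡⟨ ∑-distrib-+ (χ ∘ adj H p) (χ ∘ joins u v p) ⟩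
  deg H p + sum (χ ∘ joins u v p)
    ≡⟨ cong (deg H p +_) (sum-joins u≢v p) ⟩
  deg H p + (δ u p + δ v p) ∎
  where
  open ≡-Reasoning
  χ-∨ : ∀ a j → (j ≡ true → a ≡ false) → χ (a ∨ j) ≡ χ a + χ j
  χ-∨ false j     _ = refl
  χ-∨ true  false _ = refl
  χ-∨ true  true  h with () ← h refl

deg-removeEdge : ∀ {n} (H : Graph n) {u v} → adj H u v ≡ true →
  ∀ p → deg (removeEdge H u v) p + (δ u p + δ v p) ≡ deg H p
deg-removeEdge H {u} {v} uv∈H p = begin
  deg (removeEdge H u v) p + (δ u p + δ v p)
    ≡⟨ cong (deg (removeEdge H u v) p +_) (sum-joins u≢v p) ⟨
  deg (removeEdge H u v) p + sum (χ ∘ joins u v p)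
    ≡⟨ ∑-distrib-+ (χ ∘ adj (removeEdge H u v) p) (χ ∘ joins u v p) ⟨
  sum (λ q → χ (adj H p q ∧ not (joins u v p q)) + χ (joins u v p q))
    ≡⟨ sum-cong-≗ (λ q → χ-∧not (adj H p q) (joins u v p q)
         (λ j → trans (joins-adj H j) uv∈H)) ⟩
  deg H p ∎
  where
  open ≡-Reasoning
  u≢v : u ≢ v
  u≢v refl with () ← trans (sym (irrefl H u)) uv∈H
  χ-∧not : ∀ a j → (j ≡ true → a ≡ true) → χ (a ∧ not j) + χ j ≡ χ a
  χ-∧not false false _ = refl
  χ-∧not false true  h with () ← h refl
  χ-∧not true  false _ = refl
  χ-∧not true  true  _ = refl

addEdge-⊆ : ∀ {n} {G H : Graph n} {u v} (u≢v : u ≢ v) → IsSpanningSubgraph H G →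
  adj G u v ≡ true → IsSpanningSubgraph (addEdge H u v u≢v) G
addEdge-⊆ {G = G} {H} {u} {v} u≢v H⊆G uv∈G p q pq with adj H p q in eq
... | true  = H⊆G p q eq
... | false = trans (joins-adj G pq) uv∈G

removeEdge-⊆ : ∀ {n} {G H : Graph n} u v → IsSpanningSubgraph H G →
  IsSpanningSubgraph (removeEdge H u v) G
removeEdge-⊆ {H = H} u v H⊆G p q pq with adj H p q in eq
... | true = H⊆G p q eq

-- Augmenting a subgraph with bounded degrees

gap : ∀ {n} → Graph n → Graph n → Fin n → Fin n → Bool
gap G H u x = adj G u x ∧ not (adj H u x)

gap-G : ∀ {n} (G H : Graph n) {u x} → gap G H u x ≡ true → adj G u x ≡ true
gap-G G H {u} {x} g with adj G u x
... | true = refl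

gap-H : ∀ {n} (G H : Graph n) {u x} → gap G H u x ≡ true → adj H u x ≡ false
gap-H G H {u} {x} g with adj G u x | adj H u x
... | true | false = refl

gap-≢ : ∀ {n} (G H : Graph n) {u x} → gap G H u x ≡ true → u ≢ x
gap-≢ G H g refl with () ← trans (sym (irrefl G _)) (gap-G G H g)

deg-gap : ∀ {n} {G H : Graph n} → IsSpanningSubgraph H G →
  ∀ u → sum (χ ∘ gap G H u) + deg H u ≡ deg G u
deg-gap {G = G} {H} H⊆G u = trans
  (sym (∑-distrib-+ (χ ∘ gap G H u) (χ ∘ adj H u)))
  (sum-cong-≗ (λ x → pointwise (adj G u x) (adj H u x) (H⊆G u x)))
  where
  pointwise : ∀ g h → (h ≡ true → g ≡ true) → χ (g ∧ not h) + χ h ≡ χ g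
  pointwise true  true  _ = refl
  pointwise true  false _ = refl
  pointwise false true  h with () ← h refl
  pointwise false false _ = refl

-- Adding the edge uv and switching along an edge xy have the same effect on degrees. Recording only
-- this effect lets both kinds of growth be treated alike afterwards.
record Grown {n} (G H : Graph n) (u v : Fin n) : Set where
  constructor grown
  field
    graph    : Graph n
    subgraph : IsSpanningSubgraph graph G
    degrees  : ∀ p → deg graph p ≡ deg H p + (δ u p + δ v p)

growByEdge : ∀ {n} {G H : Graph n} → IsSpanningSubgraph H G →
  ∀ {u v} → gap G H u v ≡ true → Grown G H u v
growByEdge {G = G} {H} H⊆G g = grown
  (addEdge H _ _ (gap-≢ G H g))
  (addEdge-⊆ {G = G} {H} (gap-≢ G H g) H⊆G (gap-G G H g))
  (deg-addEdge H (gap-≢ G H g) (gap-H G H g))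

growBySwitch : ∀ {n} {G H : Graph n} → IsSpanningSubgraph H G →
  ∀ {u v x y} → u ≢ v → adj H x y ≡ true →
  gap G H u x ≡ true → gap G H v y ≡ true → Grown G H u v
growBySwitch {G = G} {H} H⊆G {u} {v} {x} {y} u≢v xy ux vy = grown
  (addEdge H₂ v y v≢y)
  (addEdge-⊆ {G = G} {H₂} v≢y
    (addEdge-⊆ {G = G} {H₁} u≢x (removeEdge-⊆ {G = G} {H} x y H⊆G) (gap-G G H ux))
    (gap-G G H vy))
  degrees
  where
  u≢x = gap-≢ G H ux
  v≢y = gap-≢ G H vy
  H₁ = removeEdge H x y
  H₂ = addEdge H₁ u x u≢x

  ux∉H₁ : adj H₁ u x ≡ false
  ux∉H₁ rewrite gap-H G H ux = refl

  -- The new edges could coincide only if x = v and y = u, but then xy, an edge of H, would be the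
  -- nonedge ux.
  vy-new : joins u x v y ≡ false
  vy-new with u ≟ v | x ≟ y | x ≟ v | u ≟ y
  ... | yes u≡v | _ | _        | _        = contradiction u≡v u≢v
  ... | no _    | _ | no _     | _        = refl
  ... | no _    | _ | yes _    | no _     = refl
  ... | no _    | _ | yes refl | yes refl
    with () ← trans (sym (gap-H G H ux)) (trans (symm H u v) xy)

  vy∉H₂ : adj H₂ v y ≡ false
  vy∉H₂ rewrite gap-H G H vy = vy-new

  degrees : ∀ p → deg (addEdge H₂ v y v≢y) p ≡ deg H p + (δ u p + δ v p)
  degrees p = begin
    deg (addEdge H₂ v y v≢y) p
      ≡⟨ deg-addEdge H₂ v≢y vy∉H₂ p ⟩
    deg H₂ p + (δ v p + δ y p)
      ≡⟨ cong (_+ (δ v p + δ y p)) (deg-addEdge H₁ u≢x ux∉H₁ p) ⟩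
    deg H₁ p + (δ u p + δ x p) + (δ v p + δ y p)
      ≡⟨ solve 5 (λ d u v x y → d :+ (u :+ x) :+ (v :+ y) := d :+ (x :+ y) :+ (u :+ v))
           refl (deg H₁ p) (δ u p) (δ v p) (δ x p) (δ y p) ⟩
    deg H₁ p + (δ x p + δ y p) + (δ u p + δ v p)
      ≡⟨ cong (_+ (δ u p + δ v p)) (deg-removeEdge H xy p) ⟩
    deg H p + (δ u p + δ v p) ∎
    where
    open ≡-Reasoning
    open +-*-Solver

-- Let X and Y be the gap neighbourhoods of u and v.  All of X is saturated,
-- and its edges avoid Y and u, so a |X| + a |Y| + a + 1 ≤ a n, the last 1
-- being the deficiency of v.
stuck⇒sparse : ∀ {n a} {G H : Graph n} {u v} → u ≢ v →
  (∀ p → deg H p ≤ a) → deg H u < a → deg H v < a →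
  (∀ t → gap G H u t ≡ true → a ≤ deg H t) →
  (∀ t → gap G H v t ≡ true → a ≤ deg H t) →
  (∀ x y → adj H x y ≡ true → gap G H u x ≡ true → gap G H v y ≢ true) →
  sum (χ ∘ gap G H u) + sum (χ ∘ gap G H v) + 1 < n
stuck⇒sparse {n} {a} {G} {H} {u} {v} u≢v d≤a u<a v<a sat-u sat-v noSwitch =
  ℕ.*-cancelˡ-< a _ n (begin-strict
    a * (X + Y + 1)
      <⟨ ℕ.n<1+n _ ⟩
    suc (a * (X + Y + 1))
      ≡⟨ solve 3 (λ a x y → con 1 :+ a :* (x :+ y :+ con 1)
                         := x :* a :+ (y :* a :+ (a :+ con 1))) refl a X Y ⟩
    X * a + (Y * a + (a + 1))
      ≡⟨ cong₂ _+_ sum-c (cong₂ _+_ (sym (*-distribʳ-sum a (χ ∘ gap G H v)))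
           (cong₂ _+_ (sum-δ u (λ _ → a)) (sum-δ₁ v))) ⟨
    sum c + (sum (λ y → χ (gap G H v y) * a) + (sum (λ y → δ u y * a) + sum (δ v)))
      ≡⟨ cong (λ s → sum c + (sum (λ y → χ (gap G H v y) * a) + s))
           (∑-distrib-+ (λ y → δ u y * a) (δ v)) ⟨
    sum c + (sum (λ y → χ (gap G H v y) * a) + sum (λ y → δ u y * a + δ v y))
      ≡⟨ cong (sum c +_) (∑-distrib-+ (λ y → χ (gap G H v y) * a) (λ y → δ u y * a + δ v y)) ⟨
    sum c + sum (λ y → χ (gap G H v y) * a + (δ u y * a + δ v y))
      ≡⟨ ∑-distrib-+ c (λ y → χ (gap G H v y) * a + (δ u y * a + δ v y)) ⟨
    sum (λ y → c y + (χ (gap G H v y) * a + (δ u y * a + δ v y)))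
      ≤⟨ sum-mono pointwise ⟩
    sum {n} (λ _ → a)
      ≡⟨ sum-const n a ⟩
    a * n ∎)
  where
  open ℕ.≤-Reasoning
  open +-*-Solver
  X = sum (χ ∘ gap G H u)
  Y = sum (χ ∘ gap G H v)

  c : Fin n → ℕ
  c y = sum (λ x → χ (gap G H u x) * χ (adj H x y))

  saturated : ∀ x → χ (gap G H u x) * deg H x ≡ χ (gap G H u x) * a
  saturated x with gap G H u x in g
  ... | true  = cong (_+ 0) (ℕ.≤-antisym (d≤a x) (sat-u x g))
  ... | false = refl

  sum-c : sum c ≡ X * a
  sum-c = begin-equality
    sum c
      ≡⟨ ∑-comm (λ y x → χ (gap G H u x) * χ (adj H x y)) ⟩
    sum (λ x → sum (λ y → χ (gap G H u x) * χ (adj H x y)))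
      ≡⟨ sum-cong-≗ (λ x → sym (*-distribˡ-sum (χ (gap G H u x)) (χ ∘ adj H x))) ⟩
    sum (λ x → χ (gap G H u x) * deg H x)
      ≡⟨ sum-cong-≗ saturated ⟩
    sum (λ x → χ (gap G H u x) * a)
      ≡⟨ *-distribʳ-sum a (χ ∘ gap G H u) ⟨
    X * a ∎

  c≤deg : ∀ y → c y ≤ deg H y
  c≤deg y = sum-mono (λ x → begin
    χ (gap G H u x) * χ (adj H x y)  ≤⟨ ℕ.*-monoˡ-≤ (χ (adj H x y)) (χ≤1 (gap G H u x)) ⟩
    χ (adj H x y) + 0                ≡⟨ ℕ.+-identityʳ _ ⟩
    χ (adj H x y)                    ≡⟨ cong χ (symm H x y) ⟩
    χ (adj H y x)                    ∎)

  c≡0 : ∀ y → (∀ x → adj H x y ≡ true → gap G H u x ≢ true) → c y ≡ 0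
  c≡0 y h = trans (sum-cong-≗ vanish) (sum-0 n)
    where
    vanish : ∀ x → χ (gap G H u x) * χ (adj H x y) ≡ 0
    vanish x with gap G H u x in g | adj H x y in e
    ... | false | _     = refl
    ... | true  | false = refl
    ... | true  | true  = contradiction g (h x e)

  gap-v-deficient : ∀ t → deg H t < a → gap G H v t ≡ false
  gap-v-deficient t t<a with gap G H v t in g
  ... | false = refl
  ... | true  = contradiction (sat-v t g) (ℕ.<⇒≱ t<a)

  pointwise : ∀ y → c y + (χ (gap G H v y) * a + (δ u y * a + δ v y)) ≤ a
  pointwise y with u ≟ y | v ≟ y
  ... | yes refl | yes refl = contradiction refl u≢v
  ... | yes refl | no _
    rewrite gap-v-deficient u u<a
          | c≡0 u (λ x xu g → contradiction
              (trans (sym (gap-H G H g)) (trans (symm H u x) xu)) (λ ()))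
    = ℕ.≤-reflexive (trans (ℕ.+-identityʳ (a + 0)) (ℕ.+-identityʳ a))
  ... | no _ | yes refl
    rewrite gap-v-deficient v v<a
    = begin
      c v + 1      ≡⟨ ℕ.+-comm (c v) 1 ⟩
      suc (c v)    ≤⟨ s≤s (c≤deg v) ⟩
      suc (deg H v) ≤⟨ v<a ⟩
      a            ∎
  ... | no _ | no _ with gap G H v y in g
  ...   | false = ℕ.≤-trans (ℕ.≤-reflexive (ℕ.+-identityʳ (c y))) (ℕ.≤-trans (c≤deg y) (d≤a y))
  ...   | true  rewrite c≡0 y (λ x xy gx → noSwitch x y xy gx g)
    = ℕ.≤-reflexive (trans (ℕ.+-identityʳ (a + 0)) (ℕ.+-identityʳ a))

-- When all three searches fail, the gap neighbourhoods satisfy X + Y ≤ n - 2 by `stuck⇒sparse`. But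
-- u and v have degree at most a - 1 in H, so the density hypothesis gives X + Y ≥ (n + 2 a - 3) - 2
-- (a - 1) = n - 1.
augment : ∀ {n a} {G H : Graph n} → IsSpanningSubgraph H G →
  (∀ p → deg H p ≤ a) → ∀ {u v} → u ≢ v → deg H u < a → deg H v < a →
  n + 2 * a ≤ deg G u + deg G v + 3 →
  ∃ λ p → ∃ λ q → p ≢ q × deg H p < a × deg H q < a × Grown G H p q
augment {n} {a} {G} {H} H⊆G d≤a {u} {v} u≢v u<a v<a dense
  with any? (λ t → (gap G H u t ≟ᵇ true) ×-dec (deg H t ℕ.<? a))
     | any? (λ t → (gap G H v t ≟ᵇ true) ×-dec (deg H t ℕ.<? a))
     | any? (λ x → any? (λ y → (adj H x y ≟ᵇ true) ×-dec
         ((gap G H u x ≟ᵇ true) ×-dec (gap G H v y ≟ᵇ true))))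
... | yes (t , g , t<a) | _ | _ = u , t , gap-≢ G H g , u<a , t<a , growByEdge H⊆G g
... | no _ | yes (t , g , t<a) | _ = v , t , gap-≢ G H g , v<a , t<a , growByEdge H⊆G g
... | no _ | no _ | yes (x , y , xy , ux , vy) =
  u , v , u≢v , u<a , v<a , growBySwitch H⊆G u≢v xy ux vy
... | no ¬u | no ¬v | no ¬s = contradiction sparse (ℕ.<⇒≱ notSparse)
  where
  X = sum (χ ∘ gap G H u)
  Y = sum (χ ∘ gap G H v)

  sparse : X + Y + 2 ≤ n
  sparse = ℕ.≤-trans (ℕ.≤-reflexive (ℕ.+-suc (X + Y) 1))
    (stuck⇒sparse {G = G} {H} u≢v d≤a u<a v<a
      (λ t g → ℕ.≮⇒≥ (λ t<a → ¬u (t , g , t<a)))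
      (λ t g → ℕ.≮⇒≥ (λ t<a → ¬v (t , g , t<a)))
      (λ x y xy ux vy → ¬s (x , y , xy , ux , vy)))

  notSparse : n < X + Y + 2
  notSparse = ≤-cancel (2 * a + (deg H u + deg H v) + 1)
    (ℕ.+-mono-≤ dense (ℕ.+-mono-≤ u<a v<a))
    (solve 4 (λ n a d e → n :+ con 2 :* a :+ (con 1 :+ d :+ (con 1 :+ e))
                       := con 2 :* a :+ (d :+ e) :+ con 1 :+ (con 1 :+ n))
      refl n a (deg H u) (deg H v))
    (trans
      (cong₂ (λ p q → p + q + 3 + (a + a)) (sym (deg-gap {G = G} {H} H⊆G u)) (sym (deg-gap {G = G} {H} H⊆G v)))
      (solve 5 (λ a d e x y → (x :+ d) :+ (y :+ e) :+ con 3 :+ (a :+ a)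
                           := con 2 :* a :+ (d :+ e) :+ con 1 :+ (x :+ y :+ con 2))
        refl a (deg H u) (deg H v) X Y))
    where open +-*-Solver

-- Partial factors and their enlargement

-- The field `saturated` is an invariant of all later steps: it keeps w out of every pair of
-- deficient vertices, and the density hypothesis speaks only of vertices other than w.
record PartialFactor {n} (G : Graph n) (a : ℕ) (w : Fin n) : Set where
  constructor partialFactor
  field
    graph     : Graph n
    subgraph  : IsSpanningSubgraph graph G
    bounded   : ∀ p → deg graph p ≤ a
    saturated : deg graph w ≡ a

-- Twice the number of edges.
size : ∀ {n} → Graph n → ℕ
size H = sum (deg H)

χ-positive : ∀ {m} b → m < χ b → b ≡ true
χ-positive true _ = refl

δ<χ⇒≢ : ∀ {n} {w y : Fin n} b → δ w y < χ b → w ≢ y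
δ<χ⇒≢ {w = w} b w<b refl = contradiction (ℕ.≤-trans w<b (χ≤1 b))
  (ℕ.<⇒≱ (s≤s (ℕ.≤-reflexive (sym (δ-refl w)))))

enlarge : ∀ {n} {G : Graph n} {a w} (P : PartialFactor G a w) → let H = PartialFactor.graph P in
  ∀ {u v} → u ≢ v → deg H u < a → deg H v < a → Grown G H u v →
  ∃ λ (Q : PartialFactor G a w) → size (PartialFactor.graph Q) ≡ size H + 2
enlarge {G = G} {a} {w} (partialFactor H H⊆G d≤a w≡a) {u} {v} u≢v u<a v<a
  (grown H′ H′⊆G d′≡) =
  partialFactor H′ H′⊆G bounded saturated , enlarged
  where
  full≢deficient : ∀ {p} → deg H p < a → p ≢ w
  full≢deficient p<a refl = contradiction w≡a (ℕ.<⇒≢ p<a)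

  bounded : ∀ p → deg H′ p ≤ a
  bounded p rewrite d′≡ p with u ≟ p | v ≟ p
  ... | yes refl | yes refl = contradiction refl u≢v
  ... | yes refl | no _     rewrite ℕ.+-comm (deg H u) 1 = u<a
  ... | no _     | yes refl rewrite ℕ.+-comm (deg H v) 1 = v<a
  ... | no _     | no _     rewrite ℕ.+-identityʳ (deg H p) = d≤a p

  saturated : deg H′ w ≡ a
  saturated = begin
    deg H′ w
      ≡⟨ d′≡ w ⟩
    deg H w + (δ u w + δ v w)
      ≡⟨ cong₂ (λ p q → deg H w + (p + q)) (δ-≢ (full≢deficient u<a)) (δ-≢ (full≢deficient v<a)) ⟩
    deg H w + 0
      ≡⟨ ℕ.+-identityʳ _ ⟩
    deg H w
      ≡⟨ w≡a ⟩
    a ∎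
    where open ≡-Reasoning

  enlarged : size H′ ≡ size H + 2
  enlarged = begin
    size H′
      ≡⟨ sum-cong-≗ d′≡ ⟩
    sum (λ p → deg H p + (δ u p + δ v p))
      ≡⟨ ∑-distrib-+ (deg H) (λ p → δ u p + δ v p) ⟩
    size H + sum (λ p → δ u p + δ v p)
      ≡⟨ cong (size H +_) (∑-distrib-+ (δ u) (δ v)) ⟩
    size H + (sum (δ u) + sum (δ v))
      ≡⟨ cong₂ (λ p q → size H + (p + q)) (sum-δ₁ u) (sum-δ₁ v) ⟩
    size H + 2 ∎
    where open ≡-Reasoning

-- If u alone is deficient, exchanging an edge xy for ux moves one unit of its
-- deficiency to y.
exchange : ∀ {n} {G : Graph n} {a w} (P : PartialFactor G a w) → let H = PartialFactor.graph P in
  ∀ {u x y} → deg H u + 2 ≤ a → (∀ p → u ≢ p → deg H p ≡ a) →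
  gap G H u x ≡ true → adj H x y ≡ true → w ≢ y →
  ∃ λ (Q : PartialFactor G a w) → let H′ = PartialFactor.graph Q in
    size H′ ≡ size H × u ≢ y × deg H′ u < a × deg H′ y < a
exchange {n} {G} {a} {w} (partialFactor H H⊆G d≤a w≡a) {u} {x} {y} u+2≤a full ux xy w≢y =
  partialFactor H′ H′⊆G bounded saturated , sameSize , u≢y , u<a′ , y<a′
  where
  u<a : deg H u < a
  u<a = ℕ.<-≤-trans (ℕ.m<m+n (deg H u) (s≤s z≤n)) u+2≤a

  u≢x : u ≢ x
  u≢x = gap-≢ G H ux

  u≢y : u ≢ y
  u≢y refl with () ← trans (sym (gap-H G H ux)) (trans (symm H u x) xy)

  u≢w : u ≢ w
  u≢w refl = contradiction w≡a (ℕ.<⇒≢ u<a)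

  H₁ = removeEdge H x y
  H′ = addEdge H₁ u x u≢x

  ux∉H₁ : adj H₁ u x ≡ false
  ux∉H₁ rewrite gap-H G H ux = refl

  H′⊆G : IsSpanningSubgraph H′ G
  H′⊆G = addEdge-⊆ {G = G} {H₁} u≢x (removeEdge-⊆ {G = G} {H} x y H⊆G) (gap-G G H ux)

  degrees : ∀ p → deg H′ p + δ y p ≡ deg H p + δ u p
  degrees p = begin
    deg H′ p + δ y p
      ≡⟨ cong (_+ δ y p) (deg-addEdge H₁ u≢x ux∉H₁ p) ⟩
    deg H₁ p + (δ u p + δ x p) + δ y p
      ≡⟨ solve 4 (λ d u x y → d :+ (u :+ x) :+ y := d :+ (x :+ y) :+ u)
           refl (deg H₁ p) (δ u p) (δ x p) (δ y p) ⟩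
    deg H₁ p + (δ x p + δ y p) + δ u p
      ≡⟨ cong (_+ δ u p) (deg-removeEdge H xy p) ⟩
    deg H p + δ u p ∎
    where
    open ≡-Reasoning
    open +-*-Solver

  deg-u : deg H′ u ≡ deg H u + 1
  deg-u = trans (sym (ℕ.+-identityʳ _)) (subst₂ (λ p q → deg H′ u + p ≡ deg H u + q)
    (δ-≢ (u≢y ∘ sym)) (δ-refl u) (degrees u))

  deg-y : deg H′ y + 1 ≡ deg H y
  deg-y = trans (subst₂ (λ p q → deg H′ y + p ≡ deg H y + q)
    (δ-refl y) (δ-≢ u≢y) (degrees y)) (ℕ.+-identityʳ _)

  u<a′ : deg H′ u < a
  u<a′ = subst (_≤ a) (trans (ℕ.+-suc (deg H u) 1) (cong suc (sym deg-u))) u+2≤a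

  y<a′ : deg H′ y < a
  y<a′ = ℕ.≤-reflexive (trans (ℕ.+-comm 1 (deg H′ y)) (trans deg-y (full y u≢y)))

  bounded-by : ∀ {p} → Dec (u ≡ p) → deg H′ p ≤ a
  bounded-by (yes refl)   = ℕ.<⇒≤ u<a′
  bounded-by {p} (no u≢p) = begin
    deg H′ p          ≤⟨ ℕ.m≤m+n _ (δ y p) ⟩
    deg H′ p + δ y p  ≡⟨ degrees p ⟩
    deg H p + δ u p   ≡⟨ cong (deg H p +_) (δ-≢ u≢p) ⟩
    deg H p + 0       ≡⟨ ℕ.+-identityʳ _ ⟩
    deg H p           ≤⟨ d≤a p ⟩
    a                 ∎
    where open ℕ.≤-Reasoning

  bounded : ∀ p → deg H′ p ≤ a
  bounded p = bounded-by (u ≟ p)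

  saturated : deg H′ w ≡ a
  saturated = trans (ℕ.+-cancelʳ-≡ 0 _ _ (subst₂ (λ p q → deg H′ w + p ≡ deg H w + q)
    (δ-≢ (w≢y ∘ sym)) (δ-≢ u≢w) (degrees w))) w≡a

  sameSize : size H′ ≡ size H
  sameSize = ℕ.+-cancelʳ-≡ 1 _ _ (begin
    size H′ + 1                      ≡⟨ cong (size H′ +_) (sum-δ₁ y) ⟨
    size H′ + sum (δ y)              ≡⟨ ∑-distrib-+ (deg H′) (δ y) ⟨
    sum (λ p → deg H′ p + δ y p)     ≡⟨ sum-cong-≗ degrees ⟩
    sum (λ p → deg H p + δ u p)      ≡⟨ ∑-distrib-+ (deg H) (δ u) ⟩
    size H + sum (δ u)               ≡⟨ cong (size H +_) (sum-δ₁ u) ⟩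
    size H + 1                       ∎)
    where open ≡-Reasoning

gap-exists : ∀ {n} {G H : Graph n} → IsSpanningSubgraph H G →
  ∀ {u} → deg H u < deg G u → ∃ λ x → gap G H u x ≡ true
gap-exists {n} {G} {H} H⊆G {u} Hu<Gu
  with x , 0<ux ← sum-<⇒∃< (λ _ → 0) (χ ∘ gap G H u)
         (subst (_< sum (χ ∘ gap G H u)) (sym (sum-0 n))
           (ℕ.+-cancelʳ-< (deg H u) 0 _ (ℕ.<-≤-trans Hu<Gu
             (ℕ.≤-reflexive (sym (deg-gap {G = G} {H} H⊆G u))))))
  = x , χ-positive _ 0<ux

spread : ∀ {n} {G : Graph n} {a w} (P : PartialFactor G a w) → let H = PartialFactor.graph P in
  ∀ {u} → a ≤ deg G u → deg H u + 2 ≤ a → (∀ p → u ≢ p → deg H p ≡ a) →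
  ∃ λ (Q : PartialFactor G a w) → let H′ = PartialFactor.graph Q in
    size H′ ≡ size H × ∃ λ y → u ≢ y × deg H′ u < a × deg H′ y < a
spread {n} {G} {a} {w} P@(partialFactor H H⊆G d≤a w≡a) {u} a≤Gu u+2≤a full
  with x , ux ← gap-exists {G = G} {H} H⊆G
         (ℕ.<-≤-trans (ℕ.m<m+n (deg H u) (s≤s z≤n)) (ℕ.≤-trans u+2≤a a≤Gu))
  -- As u is the only deficient vertex, x has a ≥ 2 neighbours in H, so one of them differs from w.
  -- Comparing the indicator of w with the row of x finds it; w itself must not lose an edge.
  with y , w<xy ← sum-<⇒∃< (δ w) (χ ∘ adj H x)
         (subst₂ _<_ (sym (sum-δ₁ w)) (sym (full x (gap-≢ G H ux)))
           (ℕ.≤-trans (ℕ.m≤n+m 2 (deg H u)) u+2≤a))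
  with Q , same , u≢y , u<a′ , y<a′ ← exchange P u+2≤a full ux
         (χ-positive _ (ℕ.≤-<-trans z≤n w<xy)) (δ<χ⇒≢ (adj H x y) w<xy)
  = Q , same , y , u≢y , u<a′ , y<a′

IsDenseAwayFrom : ∀ {n} → Graph n → ℕ → Fin n → Set
IsDenseAwayFrom {n} G a w =
  ∀ {u v} → u ≢ v → u ≢ w → v ≢ w → n + 2 * a ≤ deg G u + deg G v + 3

-- The whole deficiency a n - `size H` = 2 (k + 1) sits at u, so it is at least 2. The evenness of a
-- n serves to rule out a lone deficiency of 1.
lone-deficit : ∀ {n a k} {H : Graph n} {u} → (∀ p → u ≢ p → deg H p ≡ a) →
  size H + 2 * suc k ≡ a * n → deg H u + 2 ≤ a
lone-deficit {n} {a} {k} {H} {u} full eq = deficit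
  where
  open +-*-Solver

  pointwise : ∀ p → deg H p + δ u p * a ≡ a + δ u p * deg H u
  pointwise p with u ≟ p
  ... | yes refl = trans (cong (deg H u +_) (ℕ.+-identityʳ a))
    (trans (ℕ.+-comm (deg H u) a) (cong (a +_) (sym (ℕ.+-identityʳ (deg H u)))))
  ... | no u≢p   = cong (_+ 0) (full p u≢p)

  total : size H + a ≡ a * n + deg H u
  total = begin
    size H + a
      ≡⟨ cong (size H +_) (sum-δ u (λ _ → a)) ⟨
    size H + sum (λ p → δ u p * a)
      ≡⟨ ∑-distrib-+ (deg H) (λ p → δ u p * a) ⟨
    sum (λ p → deg H p + δ u p * a)
      ≡⟨ sum-cong-≗ pointwise ⟩
    sum (λ p → a + δ u p * deg H u)
      ≡⟨ ∑-distrib-+ {n} (λ _ → a) (λ p → δ u p * deg H u) ⟩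
    sum {n} (λ _ → a) + sum (λ p → δ u p * deg H u)
      ≡⟨ cong₂ _+_ (sum-const n a) (sum-δ u (λ _ → deg H u)) ⟩
    a * n + deg H u ∎
    where open ≡-Reasoning

  deficit : deg H u + 2 ≤ a
  deficit = ≤-cancel (size H) {size H + (deg H u + 2)} (begin
    size H + (deg H u + 2)
      ≤⟨ ℕ.m≤m+n _ (2 * k) ⟩
    size H + (deg H u + 2) + 2 * k
      ≡⟨ solve 3 (λ s d k → s :+ (d :+ con 2) :+ con 2 :* k
                         := s :+ con 2 :* (con 1 :+ k) :+ d) refl (size H) (deg H u) k ⟩
    size H + 2 * suc k + deg H u
      ≡⟨ cong (_+ deg H u) eq ⟩
    a * n + deg H u
      ≡⟨ total ⟨
    size H + a ∎) refl refl
    where open ℕ.≤-Reasoning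

two-more : ∀ s k → s + 2 + 2 * k ≡ s + 2 * suc k
two-more = solve 2 (λ s k → s :+ con 2 :+ con 2 :* k := s :+ con 2 :* (con 1 :+ k)) refl
  where open +-*-Solver

-- Completing a partial factor

module _ {n} {G : Graph n} {a w} (a≤d : ∀ p → a ≤ deg G p) (dense : IsDenseAwayFrom G a w) where

  extend : (P : PartialFactor G a w) → let H = PartialFactor.graph P in
    ∀ {u v} → u ≢ v → deg H u < a → deg H v < a →
    ∃ λ (Q : PartialFactor G a w) → size (PartialFactor.graph Q) ≡ size H + 2
  extend P@(partialFactor H H⊆G d≤a w≡a) u≢v u<a v<a
    with p , q , p≢q , p<a , q<a , g ← augment {G = G} {H} H⊆G d≤a u≢v u<a v<a
           (dense u≢v (λ { refl → ℕ.<⇒≢ u<a w≡a }) (λ { refl → ℕ.<⇒≢ v<a w≡a }))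
    = enlarge P p≢q p<a q<a g

  growOnce : ∀ {k} (P : PartialFactor G a w) → size (PartialFactor.graph P) + 2 * suc k ≡ a * n →
    ∃ λ (Q : PartialFactor G a w) → size (PartialFactor.graph Q) ≡ size (PartialFactor.graph P) + 2
  growOnce {k} P@(partialFactor H H⊆G d≤a w≡a) eq = fromDeficient deficient
    where
    deficient : ∃ λ u → deg H u < a
    deficient = sum-<⇒∃< (deg H) (λ _ → a) (ℕ.<-≤-trans (ℕ.m<m+n (size H) (s≤s z≤n))
      (ℕ.≤-reflexive (trans eq (sym (sum-const n a)))))

    module _ {u} (u<a : deg H u < a) where

      alone : ¬ (∃ λ v → u ≢ v × deg H v < a) → ∀ p → u ≢ p → deg H p ≡ a
      alone others p u≢p = ℕ.≤-antisym (d≤a p) (ℕ.≮⇒≥ (λ p<a → others (p , u≢p , p<a)))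

      fromSpread : (∃ λ (P′ : PartialFactor G a w) → let H′ = PartialFactor.graph P′ in
          size H′ ≡ size H × ∃ λ y → u ≢ y × deg H′ u < a × deg H′ y < a) →
        ∃ λ (Q : PartialFactor G a w) → size (PartialFactor.graph Q) ≡ size H + 2
      fromSpread (P′ , same , y , u≢y , u<a′ , y<a′) =
        map₂ (λ eq′ → trans eq′ (cong (_+ 2) same)) (extend P′ u≢y u<a′ y<a′)

      byCases : Dec (∃ λ v → u ≢ v × deg H v < a) →
        ∃ λ (Q : PartialFactor G a w) → size (PartialFactor.graph Q) ≡ size H + 2
      byCases (yes (v , u≢v , v<a)) = extend P u≢v u<a v<a
      byCases (no others) = fromSpread (spread P (a≤d u)
        (lone-deficit {k = k} {H} (alone others) eq) (alone others))

    fromDeficient : (∃ λ u → deg H u < a) →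
      ∃ λ (Q : PartialFactor G a w) → size (PartialFactor.graph Q) ≡ size H + 2
    fromDeficient (u , u<a) = byCases u<a (any? (λ v → ¬? (u ≟ v) ×-dec (deg H v ℕ.<? a)))

  -- Induction on the number k of missing edges; every round supplies exactly one.
  completeFrom : ∀ k (P : PartialFactor G a w) → size (PartialFactor.graph P) + 2 * k ≡ a * n →
    ∃ λ (Q : PartialFactor G a w) → size (PartialFactor.graph Q) ≡ a * n
  completeFrom zero    P eq = P , trans (sym (ℕ.+-identityʳ _)) eq
  completeFrom (suc k) P eq = continue (growOnce {k} P eq)
    where
    continue : (∃ λ (Q : PartialFactor G a w) → size (PartialFactor.graph Q) ≡ size (PartialFactor.graph P) + 2) →
      ∃ λ (Q : PartialFactor G a w) → size (PartialFactor.graph Q) ≡ a * n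
    continue (Q , eq′) = completeFrom k Q
      (trans (cong (_+ 2 * k) eq′) (trans (two-more (size (PartialFactor.graph P)) k) eq))

  complete⇒factor : (P : PartialFactor G a w) → size (PartialFactor.graph P) ≡ a * n → HasFactor a a G
  complete⇒factor (partialFactor H H⊆G d≤a _) eq =
    H , H⊆G , λ v → subst (λ d → a ≤ d × d ≤ a) (sym (trans (degree≡deg H v) (full v))) (ℕ.≤-refl , ℕ.≤-refl)
    where
    full : ∀ v → deg H v ≡ a
    full v with deg H v ℕ.<? a
    ... | no v≮a  = ℕ.≤-antisym (d≤a v) (ℕ.≮⇒≥ v≮a)
    ... | yes v<a = contradiction (trans eq (sym (sum-const n a)))
      (ℕ.<⇒≢ (sum-strict v d≤a v<a))
      where
      sum-strict : ∀ {n} {f : Fin n → ℕ} v → (∀ i → f i ≤ a) → f v < a → sum f < sum {n} (λ _ → a)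
      sum-strict zero    f≤a f<a = ℕ.+-mono-<-≤ f<a (sum-mono (f≤a ∘ suc))
      sum-strict (suc v) f≤a f<a = ℕ.+-mono-≤-< (f≤a zero) (sum-strict v (f≤a ∘ suc) f<a)

-- The initial star

choose : ∀ {n} (p : Fin n → Bool) k → k ≤ sum (χ ∘ p) →
  ∃ λ (s : Fin n → Bool) → (∀ i → s i ≡ true → p i ≡ true) × sum (χ ∘ s) ≡ k
choose {n} p zero _ = (λ _ → false) , (λ _ ()) , sum-0 n
choose {suc n} p (suc k) k≤p with p zero in eq
... | true with s , s⊆p , s≡k ← choose (p ∘ suc) k (ℕ.≤-pred k≤p)
  = (λ { zero → true ; (suc i) → s i }) , (λ { zero _ → eq ; (suc i) → s⊆p i }) , cong suc s≡k
... | false with s , s⊆p , s≡k ← choose (p ∘ suc) (suc k) k≤p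
  = (λ { zero → false ; (suc i) → s i }) , (λ { (suc i) → s⊆p i }) , s≡k

star : ∀ {n} {G : Graph n} {a w} → 1 ≤ a → a ≤ deg G w →
  ∃ λ (P : PartialFactor G a w) → size (PartialFactor.graph P) ≡ 2 * a
star {n} {G} {a} {w} 1≤a a≤w with S , S⊆N , S≡a ← choose (adj G w) a a≤w =
  partialFactor H H⊆G bounded saturated , size≡
  where
  edge : Fin n → Fin n → Bool
  edge p q = does (w ≟ p) ∧ S q ∨ does (w ≟ q) ∧ S p

  w∉S : S w ≡ false
  w∉S with S w in eq
  ... | false = refl
  ... | true with () ← trans (sym (irrefl G w)) (S⊆N w eq)

  edge-irrefl : ∀ p → edge p p ≡ false
  edge-irrefl p with w ≟ p
  ... | yes refl rewrite w∉S = refl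
  ... | no _     = refl

  H : Graph n
  H = record
    { adj    = edge
    ; symm   = λ p q → ∨-comm (does (w ≟ p) ∧ S q) (does (w ≟ q) ∧ S p)
    ; irrefl = edge-irrefl
    }

  H⊆G : IsSpanningSubgraph H G
  H⊆G p q pq with w ≟ p | w ≟ q
  ... | yes refl | yes refl rewrite w∉S = contradiction pq λ ()
  ... | yes refl | no _     = S⊆N q (trans (sym (∨-identityʳ (S q))) pq)
  ... | no _     | yes refl = trans (symm G p w) (S⊆N p pq)

  χ-edge : ∀ p q → χ (edge p q) ≡ δ w p * χ (S q) + δ w q * χ (S p)
  χ-edge p q with w ≟ p | w ≟ q
  ... | yes refl | yes refl rewrite w∉S = refl
  ... | yes refl | no _     rewrite ∨-identityʳ (S q) | ℕ.+-identityʳ (χ (S q)) = sym (ℕ.+-identityʳ _)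
  ... | no _     | yes refl = sym (ℕ.+-identityʳ _)
  ... | no _     | no _     = refl

  degrees : ∀ p → deg H p ≡ δ w p * a + χ (S p)
  degrees p = begin
    sum (χ ∘ edge p)
      ≡⟨ sum-cong-≗ (χ-edge p) ⟩
    sum (λ q → δ w p * χ (S q) + δ w q * χ (S p))
      ≡⟨ ∑-distrib-+ (λ q → δ w p * χ (S q)) (λ q → δ w q * χ (S p)) ⟩
    sum (λ q → δ w p * χ (S q)) + sum (λ q → δ w q * χ (S p))
      ≡⟨ cong₂ _+_ (trans (sym (*-distribˡ-sum (δ w p) (χ ∘ S))) (cong (δ w p *_) S≡a))
           (sum-δ w (λ _ → χ (S p))) ⟩
    δ w p * a + χ (S p) ∎
    where open ≡-Reasoning

  bounded : ∀ p → deg H p ≤ a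
  bounded p rewrite degrees p with w ≟ p
  ... | yes refl rewrite w∉S = ℕ.≤-reflexive (trans (ℕ.+-identityʳ (a + 0)) (ℕ.+-identityʳ a))
  ... | no _     = ℕ.≤-trans (χ≤1 (S p)) 1≤a

  saturated : deg H w ≡ a
  saturated rewrite degrees w | δ-refl w | w∉S = trans (ℕ.+-identityʳ (a + 0)) (ℕ.+-identityʳ a)

  size≡ : size H ≡ 2 * a
  size≡ = begin
    sum (deg H)
      ≡⟨ sum-cong-≗ degrees ⟩
    sum (λ p → δ w p * a + χ (S p))
      ≡⟨ ∑-distrib-+ (λ p → δ w p * a) (χ ∘ S) ⟩
    sum (λ p → δ w p * a) + sum (χ ∘ S)
      ≡⟨ cong₂ _+_ (sum-δ w (λ _ → a)) (trans S≡a (sym (ℕ.+-identityʳ a))) ⟩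
    2 * a ∎
    where open ≡-Reasoning

even-rest : ∀ {a n q} → a ≤ q → a * n ≡ q * 2 → 2 * a + 2 * (q ∸ a) ≡ a * n
even-rest {a} {n} {q} a≤q an≡q2 = begin
  2 * a + 2 * (q ∸ a)  ≡⟨ ℕ.*-distribˡ-+ 2 a (q ∸ a) ⟨
  2 * (a + (q ∸ a))    ≡⟨ cong (2 *_) (ℕ.m+[n∸m]≡n a≤q) ⟩
  2 * q                ≡⟨ ℕ.*-comm 2 q ⟩
  q * 2                ≡⟨ an≡q2 ⟨
  a * n                ∎
  where open ≡-Reasoning

dense⇒factor : ∀ {n a} {G : Graph n} {w} → 1 ≤ a → 2 ≤ n → 2 ∣ a * n →
  (∀ p → a ≤ deg G p) → IsDenseAwayFrom G a w → HasFactor a a G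
dense⇒factor {n} {a} {G} {w} 1≤a 2≤n (divides q an≡q2) a≤d dense
  with P , size≡ ← star {G = G} {a} {w} 1≤a (a≤d w)
  -- An a-factor has q = a n / 2 edges, and the star already supplies a of them. From 2 ≤ n follows
  -- a ≤ q, so `q ∸ a` is the true difference.
  with Q , complete ← completeFrom {G = G} a≤d dense (q ∸ a) P
         (trans (cong (_+ 2 * (q ∸ a)) size≡)
           (even-rest {a} {n} {q} (ℕ.*-cancelʳ-≤ a q 2
             (ℕ.≤-trans (ℕ.*-monoʳ-≤ a 2≤n) (ℕ.≤-reflexive an≡q2))) an≡q2))
  = complete⇒factor {G = G} a≤d dense Q complete

-- Sums of rationals

module Σℚ = SemiringSum (CommutativeRing.semiring ℚ.+-*-commutativeRing)
module ×ℚ = SemiringMult (CommutativeRing.semiring ℚ.+-*-commutativeRing)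

-- As an iterated sum of `1ℚ`, `ι (suc n)` unfolds to `1ℚ ℚ.+ ι n`; the solver calls below rely on
-- this when they write `con 1ℚ :+ k`.
ι : ℕ → ℚ
ι n = n ×ℚ.× 1ℚ

ι-+ : ∀ m n → ι (m + n) ≡ ι m ℚ.+ ι n
ι-+ = ×ℚ.×-homo-+ 1ℚ

ι-* : ∀ m n → ι (m * n) ≡ ι m ℚ.* ι n
ι-* = ×ℚ.×1-homo-*

0≤1ℚ : 0ℚ ℚ.≤ 1ℚ
0≤1ℚ = ℚ.nonNegative⁻¹ 1ℚ

0≤ι : ∀ n → 0ℚ ℚ.≤ ι n
0≤ι zero    = ℚ.≤-refl
0≤ι (suc n) = ℚ.+-mono-≤ 0≤1ℚ (0≤ι n)

ι-mono : ∀ {m n} → m ≤ n → ι m ℚ.≤ ι n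
ι-mono {n = n} z≤n = 0≤ι n
ι-mono (s≤s m≤n)   = ℚ.+-monoʳ-≤ 1ℚ (ι-mono m≤n)

1≤ι : ∀ {n} → 1 ≤ n → 1ℚ ℚ.≤ ι n
1≤ι = ι-mono

0<1ℚ : 0ℚ ℚ.< 1ℚ
0<1ℚ = ℚ.positive⁻¹ 1ℚ

ι-sum : ∀ {n} (f : Fin n → ℕ) → ι (sum f) ≡ Σℚ.sum (ι ∘ f)
ι-sum {zero}  f = refl
ι-sum {suc n} f = trans (ι-+ (f zero) (sum (f ∘ suc))) (cong (ι (f zero) ℚ.+_) (ι-sum (f ∘ suc)))

0≤-* : ∀ {p q} → 0ℚ ℚ.≤ p → 0ℚ ℚ.≤ q → 0ℚ ℚ.≤ p ℚ.* q
0≤-* {p} {q} 0≤p 0≤q = ℚ.nonNegative⁻¹ _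
  {{ℚ.nonNeg*nonNeg⇒nonNeg p {{ℚ.nonNegative 0≤p}} q {{ℚ.nonNegative 0≤q}}}}

*-monoˡ : ∀ {r p q} → 0ℚ ℚ.≤ r → p ℚ.≤ q → r ℚ.* p ℚ.≤ r ℚ.* q
*-monoˡ {r} 0≤r = ℚ.*-monoˡ-≤-nonNeg r {{ℚ.nonNegative 0≤r}}

*-monoʳ : ∀ {r p q} → 0ℚ ℚ.≤ r → p ℚ.≤ q → p ℚ.* r ℚ.≤ q ℚ.* r
*-monoʳ {r} 0≤r = ℚ.*-monoʳ-≤-nonNeg r {{ℚ.nonNegative 0≤r}}

≤-by-difference : ∀ {p q} d → 0ℚ ℚ.≤ d → q ≡ p ℚ.+ d → p ℚ.≤ q
≤-by-difference {p} d 0≤d refl =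
  ℚ.≤-trans (ℚ.≤-reflexive (sym (ℚ.+-identityʳ p))) (ℚ.+-monoʳ-≤ p 0≤d)

difference-nonneg : ∀ {p q} → p ℚ.≤ q → 0ℚ ℚ.≤ q ℚ.- p
difference-nonneg {p} {q} p≤q =
  ℚ.≤-trans (ℚ.≤-reflexive (sym (ℚ.+-inverseʳ p))) (ℚ.+-monoˡ-≤ (ℚ.- p) p≤q)

+-cancelʳ-≤ᵠ : ∀ r {p q} → p ℚ.+ r ℚ.≤ q ℚ.+ r → p ℚ.≤ q
+-cancelʳ-≤ᵠ r {p} {q} pr≤qr = subst₂ ℚ._≤_ (undo p) (undo q) (ℚ.+-monoˡ-≤ (ℚ.- r) pr≤qr)
  where
  open ℚ.+-*-Solver
  undo : ∀ s → s ℚ.+ r ℚ.+ ℚ.- r ≡ s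
  undo s = solve 2 (λ s r → s :+ r :+ :- r := s) refl s r

p≤∣p∣ : ∀ p → p ℚ.≤ ∣ p ∣
p≤∣p∣ p with ℚ.≤-total 0ℚ p
... | inj₁ 0≤p = ℚ.≤-reflexive (sym (ℚ.0≤p⇒∣p∣≡p 0≤p))
... | inj₂ p≤0 = ℚ.≤-trans p≤0 (ℚ.0≤∣p∣ p)

sumℚ-mono : ∀ {n} {f g : Fin n → ℚ} → (∀ i → f i ℚ.≤ g i) → Σℚ.sum f ℚ.≤ Σℚ.sum g
sumℚ-mono {zero}  f≤g = ℚ.≤-refl
sumℚ-mono {suc n} f≤g = ℚ.+-mono-≤ (f≤g zero) (sumℚ-mono (f≤g ∘ suc))

sumℚ-nonneg : ∀ {n} {f : Fin n → ℚ} → (∀ i → 0ℚ ℚ.≤ f i) → 0ℚ ℚ.≤ Σℚ.sum f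
sumℚ-nonneg {zero}  0≤f = ℚ.≤-refl
sumℚ-nonneg {suc n} 0≤f = ℚ.+-mono-≤ (0≤f zero) (sumℚ-nonneg (0≤f ∘ suc))

≤-sumℚ : ∀ {n} {f : Fin n → ℚ} → (∀ i → 0ℚ ℚ.≤ f i) → ∀ i → f i ℚ.≤ Σℚ.sum f
≤-sumℚ {f = f} 0≤f zero    = ≤-by-difference _ (sumℚ-nonneg (0≤f ∘ suc)) refl
≤-sumℚ {f = f} 0≤f (suc i) = ℚ.≤-trans (≤-sumℚ (0≤f ∘ suc) i)
  (≤-by-difference _ (0≤f zero) (ℚ.+-comm (f zero) _))

∣sum∣≤sum∣∣ : ∀ {n} (f : Fin n → ℚ) → ∣ Σℚ.sum f ∣ ℚ.≤ Σℚ.sum (∣_∣ ∘ f)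
∣sum∣≤sum∣∣ {zero}  f = ℚ.≤-refl
∣sum∣≤sum∣∣ {suc n} f = ℚ.≤-trans (ℚ.∣p+q∣≤∣p∣+∣q∣ (f zero) _)
  (ℚ.+-monoʳ-≤ ∣ f zero ∣ (∣sum∣≤sum∣∣ (f ∘ suc)))

-- Collatz–Wielandt bound

infix 8 _⊙_

_⊙_ : ∀ {n} → Graph n → (Fin n → ℚ) → Fin n → ℚ
(G ⊙ z) i = Σℚ.sum (λ j → ι (χ (adj G i j)) ℚ.* z j)

-- Arithmetic on `ℝ` is termwise, so each stage of a real matrix product is a rational matrix
-- product.
seq-dot : ∀ {n} (a x : Fin n → ℝ) (p q : Fin n → ℚ) N →
  (∀ j → seq (a j) N ≡ p j) → (∀ j → seq (x j) N ≡ q j) →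
  seq (ℝ.sum (λ j → a j ℝ.* x j)) N ≡ Σℚ.sum (λ j → p j ℚ.* q j)
seq-dot {zero}  a x p q N a≡p x≡q = refl
seq-dot {suc n} a x p q N a≡p x≡q = cong₂ ℚ._+_ (cong₂ ℚ._*_ (a≡p zero) (x≡q zero))
  (seq-dot (a ∘ suc) (x ∘ suc) (p ∘ suc) (q ∘ suc) N (a≡p ∘ suc) (x≡q ∘ suc))

seq-entry : ∀ {n} (G : Graph n) N i j → seq (adjacencyMatrix G i j) N ≡ ι (χ (adj G i j))
seq-entry G N i j with adj G i j
... | true  = refl
... | false = refl

seq-⊙ : ∀ {n} (G : Graph n) (x : Fin n → ℝ) (y : Fin n → ℚ) N → (∀ j → seq (x j) N ≡ y j) →
  ∀ i → seq ((adjacencyMatrix G · x) i) N ≡ (G ⊙ y) i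
seq-⊙ G x y N x≡y i =
  seq-dot (adjacencyMatrix G i) x (λ j → ι (χ (adj G i j))) y N (seq-entry G N i) x≡y

⊙-swap : ∀ {n} (G : Graph n) (y z : Fin n → ℚ) →
  Σℚ.sum (λ i → z i ℚ.* (G ⊙ y) i) ≡ Σℚ.sum (λ i → (G ⊙ z) i ℚ.* y i)
⊙-swap G y z = begin
  Σℚ.sum (λ i → z i ℚ.* (G ⊙ y) i)
    ≡⟨ Σℚ.sum-cong-≗ (λ i → Σℚ.*-distribˡ-sum (z i) (λ j → A i j ℚ.* y j)) ⟩
  Σℚ.sum (λ i → Σℚ.sum (λ j → z i ℚ.* (A i j ℚ.* y j)))
    ≡⟨ Σℚ.∑-comm (λ i j → z i ℚ.* (A i j ℚ.* y j)) ⟩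
  Σℚ.sum (λ j → Σℚ.sum (λ i → z i ℚ.* (A i j ℚ.* y j)))
    ≡⟨ Σℚ.sum-cong-≗ (λ j → Σℚ.sum-cong-≗ (λ i → swap i j)) ⟩
  Σℚ.sum (λ j → Σℚ.sum (λ i → A j i ℚ.* z i ℚ.* y j))
    ≡⟨ Σℚ.sum-cong-≗ (λ j → Σℚ.*-distribʳ-sum (y j) (λ i → A j i ℚ.* z i)) ⟨
  Σℚ.sum (λ j → (G ⊙ z) j ℚ.* y j) ∎
  where
  open ≡-Reasoning
  A = λ i j → ι (χ (adj G i j))
  swap : ∀ i j → z i ℚ.* (A i j ℚ.* y j) ≡ A j i ℚ.* z i ℚ.* y j
  swap i j rewrite symm G i j = solve 3 (λ z a y → z :* (a :* y) := a :* z :* y) refl (z i) (A j i) (y j)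
    where open ℚ.+-*-Solver

module _ {n} (G : Graph n) {z : Fin n → ℚ} {t : ℚ}
  (0≤z : ∀ i → 0ℚ ℚ.≤ z i) (Az≤tz : ∀ i → (G ⊙ z) i ℚ.≤ t ℚ.* z i) where

  -- Each stage of a real eigenvector is only an approximate one, with some error η. With y = |x|,
  -- the triangle inequality gives r y ≤ A y + η. Pairing with z and moving A across by symmetry
  -- gives r ⟨z,y⟩ ≤ ⟨A z,y⟩ + η Σz ≤ t ⟨z,y⟩ + η Σz, and t + ε ≤ r leaves ε ⟨z,y⟩ ≤ η Σz. One
  -- summand of the left side is the claim.
  nearEigenvector-bound : ∀ {r ε η} (x : Fin n → ℚ) → 0ℚ ℚ.≤ ε → t ℚ.+ ε ℚ.≤ r →
    (∀ i → ∣ (G ⊙ x) i ℚ.- r ℚ.* x i ∣ ℚ.≤ η) →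
    ∀ i → ε ℚ.* (z i ℚ.* ∣ x i ∣) ℚ.≤ η ℚ.* Σℚ.sum z
  nearEigenvector-bound {r} {ε} {η} x 0≤ε t+ε≤r near i = begin
    ε ℚ.* zy i                    ≤⟨ ≤-sumℚ (λ j → 0≤-* 0≤ε (0≤zy j)) i ⟩
    Σℚ.sum (λ j → ε ℚ.* zy j)     ≤⟨ +-cancelʳ-≤ᵠ (Σℚ.sum (λ j → t ℚ.* zy j)) summed ⟩
    η ℚ.* Σℚ.sum z                ∎
    where
    open ℚ.≤-Reasoning
    y : Fin n → ℚ
    y j = ∣ x j ∣

    zy : Fin n → ℚ
    zy j = z j ℚ.* y j

    0≤zy : ∀ j → 0ℚ ℚ.≤ zy j
    0≤zy j = 0≤-* (0≤z j) (ℚ.0≤∣p∣ (x j))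

    ∣Gx∣≤Gy : ∀ j → ∣ (G ⊙ x) j ∣ ℚ.≤ (G ⊙ y) j
    ∣Gx∣≤Gy j = ℚ.≤-trans (∣sum∣≤sum∣∣ (λ k → ι (χ (adj G j k)) ℚ.* x k))
      (ℚ.≤-reflexive (Σℚ.sum-cong-≗ (λ k → trans (ℚ.∣p*q∣≡∣p∣*∣q∣ (ι (χ (adj G j k))) (x k))
        (cong (ℚ._* y k) (ℚ.0≤p⇒∣p∣≡p (0≤ι (χ (adj G j k))))))))

    ry≤ : ∀ j → r ℚ.* y j ℚ.≤ (G ⊙ y) j ℚ.+ η
    ry≤ j = begin
      r ℚ.* y j
        ≤⟨ *-monoʳ (ℚ.0≤∣p∣ (x j)) (p≤∣p∣ r) ⟩
      ∣ r ∣ ℚ.* y j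
        ≡⟨ ℚ.∣p*q∣≡∣p∣*∣q∣ r (x j) ⟨
      ∣ r ℚ.* x j ∣
        ≡⟨ cong ∣_∣ (solve 2 (λ g e → e := g :- (g :- e)) refl ((G ⊙ x) j) (r ℚ.* x j)) ⟩
      ∣ (G ⊙ x) j ℚ.- ((G ⊙ x) j ℚ.- r ℚ.* x j) ∣
        ≤⟨ ℚ.∣p-q∣≤∣p∣+∣q∣ ((G ⊙ x) j) ((G ⊙ x) j ℚ.- r ℚ.* x j) ⟩
      ∣ (G ⊙ x) j ∣ ℚ.+ ∣ (G ⊙ x) j ℚ.- r ℚ.* x j ∣
        ≤⟨ ℚ.+-mono-≤ (∣Gx∣≤Gy j) (near j) ⟩
      (G ⊙ y) j ℚ.+ η ∎
      where open ℚ.+-*-Solver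

    weighted : ∀ j → ε ℚ.* zy j ℚ.+ t ℚ.* zy j ℚ.≤ z j ℚ.* (G ⊙ y) j ℚ.+ z j ℚ.* η
    weighted j = begin
      ε ℚ.* zy j ℚ.+ t ℚ.* zy j
        ≡⟨ solve 3 (λ e t s → e :* s :+ t :* s := (t :+ e) :* s) refl ε t (zy j) ⟩
      (t ℚ.+ ε) ℚ.* zy j
        ≤⟨ *-monoʳ (0≤zy j) t+ε≤r ⟩
      r ℚ.* (z j ℚ.* y j)
        ≡⟨ solve 3 (λ r z y → r :* (z :* y) := z :* (r :* y)) refl r (z j) (y j) ⟩
      z j ℚ.* (r ℚ.* y j)
        ≤⟨ *-monoˡ (0≤z j) (ry≤ j) ⟩
      z j ℚ.* ((G ⊙ y) j ℚ.+ η)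
        ≡⟨ ℚ.*-distribˡ-+ (z j) ((G ⊙ y) j) η ⟩
      z j ℚ.* (G ⊙ y) j ℚ.+ z j ℚ.* η ∎
      where open ℚ.+-*-Solver

    summed : Σℚ.sum (λ j → ε ℚ.* zy j) ℚ.+ Σℚ.sum (λ j → t ℚ.* zy j)
      ℚ.≤ η ℚ.* Σℚ.sum z ℚ.+ Σℚ.sum (λ j → t ℚ.* zy j)
    summed = begin
      Σℚ.sum (λ j → ε ℚ.* zy j) ℚ.+ Σℚ.sum (λ j → t ℚ.* zy j)
        ≡⟨ Σℚ.∑-distrib-+ (λ j → ε ℚ.* zy j) (λ j → t ℚ.* zy j) ⟨
      Σℚ.sum (λ j → ε ℚ.* zy j ℚ.+ t ℚ.* zy j)
        ≤⟨ sumℚ-mono weighted ⟩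
      Σℚ.sum (λ j → z j ℚ.* (G ⊙ y) j ℚ.+ z j ℚ.* η)
        ≡⟨ Σℚ.∑-distrib-+ (λ j → z j ℚ.* (G ⊙ y) j) (λ j → z j ℚ.* η) ⟩
      Σℚ.sum (λ j → z j ℚ.* (G ⊙ y) j) ℚ.+ Σℚ.sum (λ j → z j ℚ.* η)
        ≡⟨ cong₂ ℚ._+_ (⊙-swap G y z) (sym (Σℚ.*-distribʳ-sum η z)) ⟩
      Σℚ.sum (λ j → (G ⊙ z) j ℚ.* y j) ℚ.+ Σℚ.sum z ℚ.* η
        ≤⟨ ℚ.+-monoˡ-≤ (Σℚ.sum z ℚ.* η) (sumℚ-mono (λ j → ℚ.≤-trans
             (*-monoʳ (ℚ.0≤∣p∣ (x j)) (Az≤tz j)) (ℚ.≤-reflexive (ℚ.*-assoc t (z j) (y j))))) ⟩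
      Σℚ.sum (λ j → t ℚ.* zy j) ℚ.+ Σℚ.sum z ℚ.* η
        ≡⟨ solve 3 (λ s c e → s :+ c :* e := e :* c :+ s) refl
             (Σℚ.sum (λ j → t ℚ.* zy j)) (Σℚ.sum z) η ⟩
      η ℚ.* Σℚ.sum z ℚ.+ Σℚ.sum (λ j → t ℚ.* zy j) ∎
      where open ℚ.+-*-Solver

scaledBelow : ∀ {c Z} → 0ℚ ℚ.< c → 0ℚ ℚ.< Z → ∃ λ η → Positive η × η ℚ.* Z ℚ.< c
scaledBelow {c} {Z} 0<c 0<Z = η , posη , (begin-strict
  ½ ℚ.* c ℚ.* r ℚ.* Z    ≡⟨ ℚ.*-assoc (½ ℚ.* c) r Z ⟩
  ½ ℚ.* c ℚ.* (r ℚ.* Z)  ≡⟨ cong (½ ℚ.* c ℚ.*_) (ℚ.*-inverseˡ Z {{Z≢0}}) ⟩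
  ½ ℚ.* c ℚ.* 1ℚ         ≡⟨ ℚ.*-identityʳ (½ ℚ.* c) ⟩
  ½ ℚ.* c                <⟨ ℚ.*-monoˡ-<-pos c {½} {1ℚ} (ℚ.*<* (ℤ.+<+ (s≤s (s≤s z≤n)))) ⟩
  1ℚ ℚ.* c               ≡⟨ ℚ.*-identityˡ c ⟩
  c                      ∎)
  where
  open ℚ.≤-Reasoning
  instance
    c>0 = ℚ.positive 0<c
  Z>0 = ℚ.positive 0<Z
  Z≢0 = ℚ.pos⇒nonZero Z {{Z>0}}
  r = (1/ Z) {{Z≢0}}
  η = ½ ℚ.* c ℚ.* r
  posη = ℚ.pos*pos⇒pos (½ ℚ.* c) {{ℚ.pos*pos⇒pos ½ c}} r {{ℚ.1/pos⇒pos Z {{Z>0}}}}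

collatzWielandt : ∀ {n} (G : Graph n) {ρ} → IsEigenvalue (adjacencyMatrix G) ρ →
  ∀ {z t} → (∀ i → 0ℚ ℚ.< z i) → (∀ i → (G ⊙ z) i ℚ.≤ t ℚ.* z i) → ¬ (fromℚ t ℝ.< ρ)
collatzWielandt {n} G {ρ} (x , x≉0 , Ax≈ρx) {z} {t} 0<z Az≤tz (ε , posε , N₀ , t+ε≤ρ) =
  x≉0 λ i ε′ → let open ℚ.≤-Reasoning in
    -- With η Σz below this `c`, cancelling ε and z i in the bound leaves |x i| < ε′; as ε′ is
    -- arbitrary, x vanishes.
    let c = ε ℚ.* (z i ℚ.* ε′)
        0<c : 0ℚ ℚ.< c
        0<c = ℚ.positive⁻¹ c {{ℚ.pos*pos⇒pos ε {{posε}} (z i ℚ.* ε′)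
          {{ℚ.pos*pos⇒pos (z i) {{ℚ.positive (0<z i)}} ε′}}}}
        η , posη , ηZ<c = scaledBelow 0<c
          (ℚ.<-≤-trans (0<z i) (≤-sumℚ (λ j → ℚ.<⇒≤ (0<z j)) i))
        threshold : Fin n → ℕ
        threshold j = proj₁ (Ax≈ρx j η {{posη}})
    -- The sum of the thresholds stands in for their maximum.
    in N₀ + sum threshold , λ N N≥ →
      let near : ∀ j → ∣ (G ⊙ (λ k → seq (x k) N)) j ℚ.- seq ρ N ℚ.* seq (x j) N ∣ ℚ.≤ η
          near j = subst (λ s → ∣ s ℚ.- seq ρ N ℚ.* seq (x j) N ∣ ℚ.≤ η)
            (seq-⊙ G x (λ k → seq (x k) N) N (λ _ → refl) j)
            (ℚ.<⇒≤ (proj₂ (Ax≈ρx j η {{posη}}) N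
              (ℕ.≤-trans (≤-sum threshold j) (ℕ.m+n≤o⇒n≤o N₀ N≥))))
          bound = nearEigenvector-bound G {t = t} (λ j → ℚ.<⇒≤ (0<z j)) Az≤tz (λ k → seq (x k) N)
            (ℚ.<⇒≤ (ℚ.positive⁻¹ ε {{posε}})) (t+ε≤ρ N (ℕ.m+n≤o⇒m≤o N₀ N≥)) near i
          xi<ε′ : ∣ seq (x i) N ∣ ℚ.< ε′
          xi<ε′ = ℚ.*-cancelˡ-<-nonNeg (z i) {{ℚ.nonNegative (ℚ.<⇒≤ (0<z i))}}
            (ℚ.*-cancelˡ-<-nonNeg ε {{ℚ.pos⇒nonNeg ε {{posε}}}} (ℚ.≤-<-trans bound ηZ<c))
      in subst (λ s → ∣ s ∣ ℚ.< ε′) (sym (ℚ.+-identityʳ (seq (x i) N))) xi<ε′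

-- The complement

complement : ∀ {n} → Graph n → Graph n
complement G = record
  { adj    = λ u v → not (adj G u v) ∧ not (does (u ≟ v))
  ; symm   = λ u v → cong₂ (λ a b → not a ∧ not b) (symm G u v) (≟-symm u v)
  ; irrefl = λ v → trans (cong (λ b → not (adj G v v) ∧ not b) (dec-true (v ≟ v) refl))
      (∧-comm (not (adj G v v)) false)
  }
  where
  ≟-symm : ∀ u v → does (u ≟ v) ≡ does (v ≟ u)
  ≟-symm u v with v ≟ u
  ... | yes v≡u = dec-true (u ≟ v) (sym v≡u)
  ... | no v≢u  = dec-false (u ≟ v) (v≢u ∘ sym)

χ-complement : ∀ {n} (G : Graph n) u v →
  χ (adj G u v) + χ (adj (complement G) u v) + δ u v ≡ 1
χ-complement G u v with u ≟ v
... | yes refl rewrite irrefl G u = refl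
... | no _ with adj G u v
...   | true  = refl
...   | false = refl

deg-complement : ∀ {n} (G : Graph n) v → deg G v + deg (complement G) v + 1 ≡ n
deg-complement {n} G v = begin
  deg G v + deg (complement G) v + 1
    ≡⟨ cong₂ _+_ (∑-distrib-+ (χ ∘ adj G v) (χ ∘ adj (complement G) v)) (sum-δ₁ v) ⟨
  sum (λ u → χ (adj G v u) + χ (adj (complement G) v u)) + sum (δ v)
    ≡⟨ ∑-distrib-+ (λ u → χ (adj G v u) + χ (adj (complement G) v u)) (δ v) ⟨
  sum (λ u → χ (adj G v u) + χ (adj (complement G) v u) + δ v u)
    ≡⟨ sum-cong-≗ (χ-complement G v) ⟩
  sum {n} (λ _ → 1)
    ≡⟨ sum-const n 1 ⟩
  1 * n
    ≡⟨ ℕ.*-identityˡ n ⟩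
  n ∎
  where open ≡-Reasoning

-- Degree sums

sum-adj-column : ∀ {n} (F : Graph n) u → sum (λ x → χ (adj F x u)) ≡ deg F u
sum-adj-column F u = sum-cong-≗ (λ x → cong χ (symm F x u))

sum-three : ∀ {n} (f : Fin n → ℕ) {u v w} → u ≢ v → u ≢ w → v ≢ w → f u + f v + f w ≤ sum f
sum-three {n} f {u} {v} {w} u≢v u≢w v≢w = begin
  f u + f v + f w
    ≡⟨ cong₂ _+_ (cong₂ _+_ (sum-δ u f) (sum-δ v f)) (sum-δ w f) ⟨
  sum (λ x → δ u x * f x) + sum (λ x → δ v x * f x) + sum (λ x → δ w x * f x)
    ≡⟨ cong (_+ sum (λ x → δ w x * f x)) (∑-distrib-+ (λ x → δ u x * f x) (λ x → δ v x * f x)) ⟨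
  sum (λ x → δ u x * f x + δ v x * f x) + sum (λ x → δ w x * f x)
    ≡⟨ ∑-distrib-+ (λ x → δ u x * f x + δ v x * f x) (λ x → δ w x * f x) ⟨
  sum (λ x → δ u x * f x + δ v x * f x + δ w x * f x)
    ≤⟨ sum-mono pointwise ⟩
  sum f ∎
  where
  open ℕ.≤-Reasoning
  pointwise : ∀ x → δ u x * f x + δ v x * f x + δ w x * f x ≤ f x
  pointwise x with u ≟ x | v ≟ x | w ≟ x
  ... | yes refl | yes refl | _        = contradiction refl u≢v
  ... | yes refl | no _     | yes refl = contradiction refl u≢w
  ... | no _     | yes refl | yes refl = contradiction refl v≢w
  ... | yes refl | no _     | no _     = ℕ.≤-reflexive (trans (ℕ.+-identityʳ _) (trans (ℕ.+-identityʳ _) (ℕ.+-identityʳ _)))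
  ... | no _     | yes refl | no _     = ℕ.≤-reflexive (trans (ℕ.+-identityʳ _) (ℕ.+-identityʳ _))
  ... | no _     | no _     | yes refl = ℕ.≤-reflexive (ℕ.+-identityʳ _)
  ... | no _     | no _     | no _     = z≤n

-- At most three edges have both ends in {u, v, w}, and size F is 2 |E(F)|.
three-degrees : ∀ {n} (F : Graph n) {u v w} → u ≢ v → u ≢ w → v ≢ w →
  2 * (deg F u + deg F v + deg F w) ≤ size F + 6
three-degrees {n} F {u} {v} {w} u≢v u≢w v≢w = begin
  2 * (deg F u + deg F v + deg F w)
    ≡⟨ solve 3 (λ a b c → con 2 :* (a :+ b :+ c) := (a :+ b :+ c) :+ (a :+ b :+ c))
          refl (deg F u) (deg F v) (deg F w) ⟩
  (deg F u + deg F v + deg F w) + (deg F u + deg F v + deg F w)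
    ≡⟨ cong₂ _+_
         (sum₃ (λ x → A x u) (λ x → A x v) (λ x → A x w)
           (sum-adj-column F u) (sum-adj-column F v) (sum-adj-column F w))
         (sum₃ (λ x → δ u x * deg F x) (λ x → δ v x * deg F x) (λ x → δ w x * deg F x)
           (sum-δ u (deg F)) (sum-δ v (deg F)) (sum-δ w (deg F))) ⟨
  sum (λ x → A x u + A x v + A x w) + sum (λ x → δ u x * deg F x + δ v x * deg F x + δ w x * deg F x)
    ≡⟨ ∑-distrib-+ (λ x → A x u + A x v + A x w) (λ x → δ u x * deg F x + δ v x * deg F x + δ w x * deg F x) ⟨
  sum (λ x → A x u + A x v + A x w + (δ u x * deg F x + δ v x * deg F x + δ w x * deg F x))
    ≤⟨ sum-mono pointwise ⟩
  sum (λ x → deg F x + (δ u x * 2 + δ v x * 2 + δ w x * 2))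
    ≡⟨ ∑-distrib-+ (deg F) (λ x → δ u x * 2 + δ v x * 2 + δ w x * 2) ⟩
  size F + sum (λ x → δ u x * 2 + δ v x * 2 + δ w x * 2)
    ≡⟨ cong (size F +_) (sum₃ (λ x → δ u x * 2) (λ x → δ v x * 2) (λ x → δ w x * 2)
         (sum-δ u (λ _ → 2)) (sum-δ v (λ _ → 2)) (sum-δ w (λ _ → 2))) ⟩
  size F + 6 ∎
  where
  open ℕ.≤-Reasoning
  open +-*-Solver
  A : Fin n → Fin n → ℕ
  A x y = χ (adj F x y)

  sum₃ : ∀ (f g h : Fin n → ℕ) {a b c} → sum f ≡ a → sum g ≡ b → sum h ≡ c →
    sum (λ x → f x + g x + h x) ≡ a + b + c
  sum₃ f g h refl refl refl = trans (∑-distrib-+ (λ x → f x + g x) h)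
    (cong (_+ sum h) (∑-distrib-+ f g))

  pointwise : ∀ x → A x u + A x v + A x w + (δ u x * deg F x + δ v x * deg F x + δ w x * deg F x)
    ≤ deg F x + (δ u x * 2 + δ v x * 2 + δ w x * 2)
  pointwise x = split x (u ≟ x) (v ≟ x) (w ≟ x)
    where
    split : ∀ x (du : Dec (u ≡ x)) (dv : Dec (v ≡ x)) (dw : Dec (w ≡ x)) →
      A x u + A x v + A x w + (χ (does du) * deg F x + χ (does dv) * deg F x + χ (does dw) * deg F x)
      ≤ deg F x + (χ (does du) * 2 + χ (does dv) * 2 + χ (does dw) * 2)
    split _ (yes refl) (yes refl) _ = contradiction refl u≢v
    split _ (yes refl) (no _) (yes refl) = contradiction refl u≢w
    split _ (no _) (yes refl) (yes refl) = contradiction refl v≢w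
    split _ (yes refl) (no _) (no _) rewrite irrefl F u = ≤-cancel 0
      (ℕ.+-monoˡ-≤ (deg F u) (ℕ.+-mono-≤ (χ≤1 (adj F u v)) (χ≤1 (adj F u w))))
      (solve 3 (λ a b d → a :+ b :+ d := a :+ b :+ (d :+ con 0 :+ con 0 :+ con 0))
            refl (A u v) (A u w) (deg F u))
      (solve 1 (λ d → con 2 :+ d := d :+ con 2) refl (deg F u))
    split _ (no _) (yes refl) (no _) rewrite irrefl F v = ≤-cancel 0
      (ℕ.+-monoˡ-≤ (deg F v) (ℕ.+-mono-≤ (χ≤1 (adj F v u)) (χ≤1 (adj F v w))))
      (solve 3 (λ a b d → a :+ b :+ d := a :+ con 0 :+ b :+ (d :+ con 0 :+ con 0))
            refl (A v u) (A v w) (deg F v))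
      (solve 1 (λ d → con 2 :+ d := d :+ con 2) refl (deg F v))
    split _ (no _) (no _) (yes refl) rewrite irrefl F w = ≤-cancel 0
      (ℕ.+-monoˡ-≤ (deg F w) (ℕ.+-mono-≤ (χ≤1 (adj F w u)) (χ≤1 (adj F w v))))
      (solve 3 (λ a b d → a :+ b :+ d := a :+ b :+ con 0 :+ (d :+ con 0)) refl (A w u) (A w v) (deg F w))
      (solve 1 (λ d → con 2 :+ d := d :+ con 2) refl (deg F w))
    split x (no _) (no _) (no _) = ℕ.+-monoˡ-≤ 0 (sum-three (λ y → A x y) u≢v u≢w v≢w)

-- The edges at w contribute `deg F w` to the degree sum at w and as much again at the neighbours of
-- w.
double-degree : ∀ {n} (F : Graph n) w → deg F w + deg F w ≤ size F
double-degree {n} F w = begin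
  deg F w + deg F w
    ≡⟨ cong₂ _+_ (sum-adj-column F w) (sum-δ w (deg F)) ⟨
  sum (λ x → χ (adj F x w)) + sum (λ x → δ w x * deg F x)
    ≡⟨ ∑-distrib-+ (λ x → χ (adj F x w)) (λ x → δ w x * deg F x) ⟨
  sum (λ x → χ (adj F x w) + δ w x * deg F x)
    ≤⟨ sum-mono (λ x → pointwise x (w ≟ x)) ⟩
  size F ∎
  where
  open ℕ.≤-Reasoning
  pointwise : ∀ x (d : Dec (w ≡ x)) → χ (adj F x w) + χ (does d) * deg F x ≤ deg F x
  pointwise x (yes refl) rewrite irrefl F w = ℕ.≤-reflexive (ℕ.+-identityʳ (deg F w))
  pointwise x (no _) = ℕ.≤-trans (ℕ.≤-reflexive (ℕ.+-identityʳ _)) (≤-sum (λ y → χ (adj F x y)) w)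

argmax : ∀ {n} (f : Fin (suc n) → ℕ) → ∃ λ w → ∀ v → f v ≤ f w
argmax {zero} f = zero , λ { zero → ℕ.≤-refl }
argmax {suc n} f with w , max ← argmax (f ∘ suc) with ℕ.≤-total (f zero) (f (suc w))
... | inj₁ f0≤fw = suc w , λ { zero → f0≤fw ; (suc v) → max v }
... | inj₂ fw≤f0 = zero , λ { zero → ℕ.≤-refl ; (suc v) → ℕ.≤-trans (max v) fw≤f0 }

-- A graph whose complement has few edges

-- The test vector deg + D comes from the bound of Hong, Shu and Fang: with
-- θ = n - 2 it is A 1 + (θ - δ + 1) 1, where δ = n - 1 - D is the minimum degree.
module _ {N D} {G : Graph (2 + N)} (f≤D : ∀ v → deg (complement G) v ≤ D)
  (manyNonEdges : 1 + N + D ≤ size (complement G)) where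

  private
    F = complement G
    A = λ u v → χ (adj G u v)

    d+f : ∀ v → deg G v + deg F v ≡ 1 + N
    d+f v = ℕ.+-cancelʳ-≡ 1 _ _ (trans (deg-complement G v) (ℕ.+-comm 1 (suc N)))

  -- The left side is X + D d, where X + Y = (1 + N) d. Together with d + f = 1 + N this reduces the
  -- claim to d + D ≤ Y + D f. Splitting the degree sum of F over the neighbours of v, its
  -- nonneighbours and v itself gives Y + Z + f = `size F` ≥ 1 + N + D, and Z ≤ f D as D bounds all
  -- degrees of F.
  superharmonic : ∀ v → sum (λ u → A v u * (deg G u + D)) ≤ N * (deg G v + D)
  superharmonic v = ≤-cancel (d + D)
    (ℕ.+-monoʳ-≤ (X + D * d) d+D≤Y+Df)
    (trans (ℕ.+-comm (X + D * d) (d + D)) (cong (d + D +_) (sym split)))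
    (begin
      X + D * d + (Y + D * f)
        ≡⟨ solve 5 (λ x y D d f → x :+ D :* d :+ (y :+ D :* f) := x :+ y :+ D :* (d :+ f))
              refl X Y D d f ⟩
      X + Y + D * (d + f)
        ≡⟨ cong₂ (λ p q → p + D * q) X+Y (d+f v) ⟩
      (1 + N) * d + D * (1 + N)
        ≡⟨ solve 3 (λ n d D → (con 1 :+ n) :* d :+ D :* (con 1 :+ n) := d :+ D :+ n :* (d :+ D))
              refl N d D ⟩
      d + D + N * (d + D) ∎)
    where
    open ≡-Reasoning
    open +-*-Solver
    d = deg G v
    f = deg F v
    X = sum (λ u → A v u * deg G u)
    Y = sum (λ u → A v u * deg F u)
    Z = sum (λ u → χ (adj F v u) * deg F u)

    split : sum (λ u → A v u * (deg G u + D)) ≡ X + D * d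
    split = begin
      sum (λ u → A v u * (deg G u + D))
        ≡⟨ sum-cong-≗ (λ u → ℕ.*-distribˡ-+ (A v u) (deg G u) D) ⟩
      sum (λ u → A v u * deg G u + A v u * D)
        ≡⟨ ∑-distrib-+ (λ u → A v u * deg G u) (λ u → A v u * D) ⟩
      X + sum (λ u → A v u * D)
        ≡⟨ cong (X +_) (*-distribʳ-sum D (A v)) ⟨
      X + d * D
        ≡⟨ cong (X +_) (ℕ.*-comm d D) ⟩
      X + D * d ∎

    X+Y : X + Y ≡ (1 + N) * d
    X+Y = begin
      X + Y
        ≡⟨ ∑-distrib-+ (λ u → A v u * deg G u) (λ u → A v u * deg F u) ⟨
      sum (λ u → A v u * deg G u + A v u * deg F u)
        ≡⟨ sum-cong-≗ (λ u → ℕ.*-distribˡ-+ (A v u) (deg G u) (deg F u)) ⟨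
      sum (λ u → A v u * (deg G u + deg F u))
        ≡⟨ sum-cong-≗ (λ u → cong (A v u *_) (d+f u)) ⟩
      sum (λ u → A v u * (1 + N))
        ≡⟨ *-distribʳ-sum (1 + N) (A v) ⟨
      d * (1 + N)
        ≡⟨ ℕ.*-comm d (1 + N) ⟩
      (1 + N) * d ∎

    Y+Z+f : Y + Z + f ≡ size F
    Y+Z+f = begin
      Y + Z + f
        ≡⟨ cong₂ _+_ (∑-distrib-+ (λ u → A v u * deg F u) (λ u → χ (adj F v u) * deg F u)) (sum-δ v (deg F)) ⟨
      sum (λ u → A v u * deg F u + χ (adj F v u) * deg F u) + sum (λ u → δ v u * deg F u)
        ≡⟨ ∑-distrib-+ (λ u → A v u * deg F u + χ (adj F v u) * deg F u) (λ u → δ v u * deg F u) ⟨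
      sum (λ u → A v u * deg F u + χ (adj F v u) * deg F u + δ v u * deg F u)
        ≡⟨ sum-cong-≗ (λ u → trans
             (solve 4 (λ a b c e → a :* e :+ b :* e :+ c :* e := (a :+ b :+ c) :* e) refl
               (A v u) (χ (adj F v u)) (δ v u) (deg F u))
             (trans (cong (_* deg F u) (χ-complement G v u)) (ℕ.*-identityˡ (deg F u)))) ⟩
      size F ∎

    Z≤fD : Z ≤ f * D
    Z≤fD = ℕ.≤-trans (sum-mono (λ u → ℕ.*-monoʳ-≤ (χ (adj F v u)) (f≤D u)))
      (ℕ.≤-reflexive (sym (*-distribʳ-sum D (χ ∘ adj F v))))

    d+D≤Y+Df : d + D ≤ Y + D * f
    d+D≤Y+Df = ≤-cancel f
      (ℕ.≤-trans manyNonEdges (ℕ.≤-trans (ℕ.≤-reflexive (sym Y+Z+f))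
        (ℕ.+-monoˡ-≤ f (ℕ.+-monoʳ-≤ Y Z≤fD))))
      (trans (cong (_+ D) (sym (d+f v))) (solve 3 (λ d f D → d :+ f :+ D := f :+ (d :+ D)) refl d f D))
      (solve 3 (λ y f D → y :+ f :* D :+ f := f :+ (y :+ D :* f)) refl Y f D)

  spectralRadius-bound : ∀ {ρ} → IsEigenvalue (adjacencyMatrix G) ρ → ¬ (fromℚ (ι N) ℝ.< ρ)
  spectralRadius-bound {ρ} eigen = collatzWielandt G {ρ} eigen {λ u → ι (deg G u + D)} {ι N}
    -- Positivity: deg G u + D is at least deg G u + deg F u = 1 + N.
    (λ u → ℚ.<-≤-trans 0<1ℚ (1≤ι (ℕ.≤-trans (s≤s z≤n)
      (ℕ.≤-trans (ℕ.≤-reflexive (sym (d+f u))) (ℕ.+-monoʳ-≤ (deg G u) (f≤D u))))))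
    λ v → subst₂ ℚ._≤_
      (trans (ι-sum (λ u → A v u * (deg G u + D)))
        (Σℚ.sum-cong-≗ (λ u → ι-* (A v u) (deg G u + D))))
      (ι-* N (deg G v + D)) (ι-mono (superharmonic v))

-- Put s = f₁ + f₂. The bounds on S give 2 s + D ≤ N + 6, and s ≤ 2 D, so eliminating D yields 10 s
-- ≤ 4 N + 24. If the conclusion failed, then s ≥ N + 4 - 2 a, and 4 a ≤ N + 3 would give 10 s ≥ 5 N
-- + 25. Together these force N + 1 ≤ 0.
dense-arithmetic : ∀ {N a D S d₁ d₂ f₁ f₂} → 4 * a ≤ 3 + N →
  d₁ + f₁ + 1 ≡ 2 + N → d₂ + f₂ + 1 ≡ 2 + N → f₁ ≤ D → f₂ ≤ D →
  S ≤ N + D → 2 * (f₁ + f₂ + D) ≤ S + 6 → 2 + N + 2 * a ≤ d₁ + d₂ + 3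
dense-arithmetic {N} {a} {D} {S} {d₁} {d₂} {f₁} {f₂} 4a≤ e₁ e₂ f₁≤D f₂≤D S≤ three
  with 2 + N + 2 * a ℕ.≤? d₁ + d₂ + 3
... | yes p = p
... | no ¬p = contradiction absurd (λ ())
  where
  open +-*-Solver
  open ≡-Reasoning
  neg : 4 + N ≤ f₁ + f₂ + 2 * a
  neg = ≤-cancel (2 + N) (ℕ.+-monoˡ-≤ (f₁ + f₂) (ℕ.≰⇒> ¬p))
    (begin
      suc (d₁ + d₂ + 3) + (f₁ + f₂)
        ≡⟨ solve 4 (λ d₁ d₂ f₁ f₂ → con 1 :+ (d₁ :+ d₂ :+ con 3) :+ (f₁ :+ f₂)
             := (d₁ :+ f₁ :+ con 1) :+ (d₂ :+ f₂ :+ con 1) :+ con 2) refl d₁ d₂ f₁ f₂ ⟩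
      (d₁ + f₁ + 1) + (d₂ + f₂ + 1) + 2
        ≡⟨ cong₂ (λ p q → p + q + 2) e₁ e₂ ⟩
      (2 + N) + (2 + N) + 2
        ≡⟨ solve 1 (λ n → (con 2 :+ n) :+ (con 2 :+ n) :+ con 2
             := (con 2 :+ n) :+ (con 4 :+ n)) refl N ⟩
      (2 + N) + (4 + N) ∎)
    (solve 4 (λ n a f₁ f₂ → con 2 :+ n :+ con 2 :* a :+ (f₁ :+ f₂)
         := con 2 :+ n :+ (f₁ :+ f₂ :+ con 2 :* a)) refl N a f₁ f₂)

  absurd : 1 + N ≤ 0
  absurd = ≤-cancel (10 * (f₁ + f₂) + 20 * a + 8 * D + 9 * N + 39)
    -- The multipliers 10, 4, 2 and 5 are those of the elimination above, scaled to be integral.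
    (ℕ.+-mono-≤ (ℕ.*-monoʳ-≤ 10 neg)
      (ℕ.+-mono-≤ (ℕ.*-monoʳ-≤ 4 (ℕ.≤-trans three (ℕ.+-monoˡ-≤ 6 S≤)))
        (ℕ.+-mono-≤ (ℕ.*-monoʳ-≤ 2 (ℕ.+-mono-≤ f₁≤D f₂≤D)) (ℕ.*-monoʳ-≤ 5 4a≤))))
    (solve 4 (λ n a s D → con 10 :* (con 4 :+ n) :+ (con 4 :* (con 2 :* (s :+ D))
           :+ (con 2 :* s :+ con 5 :* (con 4 :* a)))
         := con 10 :* s :+ con 20 :* a :+ con 8 :* D :+ con 9 :* n :+ con 39 :+ (con 1 :+ n))
      refl N a (f₁ + f₂) D)
    (solve 4 (λ n a s D → con 10 :* (s :+ con 2 :* a) :+ (con 4 :* (n :+ D :+ con 6)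
           :+ (con 2 :* (D :+ D) :+ con 5 :* (con 3 :+ n)))
         := con 10 :* s :+ con 20 :* a :+ con 8 :* D :+ con 9 :* n :+ con 39 :+ con 0)
      refl N a (f₁ + f₂) D)

-- Three-valued weights

-- Eigenvector of K_κ ∇ (K₁ ∪ K_M), where κ = k and M = m: the values core,
-- pendant and clique satisfy the eigenvalue equation for t at the last two
-- kinds of vertices identically, and at the first kind when defect vanishes.
module Weights (k m : ℕ) (t : ℚ) where

  slack core pendant clique total defect : ℚ
  slack   = t ℚ.- ι m ℚ.+ 1ℚ
  core    = t ℚ.* slack
  pendant = ι k ℚ.* slack
  clique  = ι k ℚ.* t
  total   = ι k ℚ.* core ℚ.+ pendant ℚ.+ ι m ℚ.* clique
  defect  = t ℚ.* core ℚ.- (total ℚ.- core)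

  pendant-eq : ι k ℚ.* core ≡ t ℚ.* pendant
  pendant-eq = solve 3 (λ k t s → k :* (t :* s) := t :* (k :* s)) refl (ι k) t slack
    where open ℚ.+-*-Solver

  clique-eq : total ℚ.- pendant ℚ.- clique ≡ t ℚ.* clique
  clique-eq = solve 3 (λ k t m →
      let s = t :- m :+ con 1ℚ in
      k :* (t :* s) :+ k :* s :+ m :* (k :* t) :- k :* s :- k :* t := t :* (k :* t))
    refl (ι k) t (ι m)
    where open ℚ.+-*-Solver

  core-eq : total ℚ.- core ≡ t ℚ.* core ℚ.- defect
  core-eq = solve 2 (λ p q → q := p :- (p :- q)) refl (t ℚ.* core) (total ℚ.- core)
    where open ℚ.+-*-Solver

sumℚ-0 : ∀ n → Σℚ.sum {n} (λ _ → 0ℚ) ≡ 0ℚ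
sumℚ-0 zero    = refl
sumℚ-0 (suc n) = trans (ℚ.+-identityˡ _) (sumℚ-0 n)

sumℚ-const : ∀ n c → Σℚ.sum {n} (λ _ → c) ≡ ι n ℚ.* c
sumℚ-const zero    c = sym (ℚ.*-zeroˡ c)
sumℚ-const (suc n) c = trans (cong (c ℚ.+_) (sumℚ-const n c))
  (solve 2 (λ c n → c :+ n :* c := (con 1ℚ :+ n) :* c) refl c (ι n))
  where open ℚ.+-*-Solver

sumℚ-δ : ∀ {n} (u : Fin n) (f : Fin n → ℚ) → Σℚ.sum (λ v → ι (δ u v) ℚ.* f v) ≡ f u
sumℚ-δ {suc n} zero f = begin
  ι 1 ℚ.* f zero ℚ.+ Σℚ.sum (λ v → ι 0 ℚ.* f (suc v))
    ≡⟨ cong₂ ℚ._+_ (ℚ.*-identityˡ (f zero)) (trans (Σℚ.sum-cong-≗ (λ v → ℚ.*-zeroˡ (f (suc v)))) (sumℚ-0 n)) ⟩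
  f zero ℚ.+ 0ℚ
    ≡⟨ ℚ.+-identityʳ (f zero) ⟩
  f zero ∎
  where open ≡-Reasoning
sumℚ-δ {suc n} (suc u) f = begin
  ι 0 ℚ.* f zero ℚ.+ Σℚ.sum (λ v → ι (δ u v) ℚ.* f (suc v))
    ≡⟨ cong₂ ℚ._+_ (ℚ.*-zeroˡ (f zero)) (sumℚ-δ u (f ∘ suc)) ⟩
  0ℚ ℚ.+ f (suc u)
    ≡⟨ ℚ.+-identityˡ (f (suc u)) ⟩
  f (suc u) ∎
  where open ≡-Reasoning

module PositiveWeights {k m t} (1≤m : 1 ≤ m) (t≥ : ι (k + m) ℚ.≤ t) where

  open Weights (suc k) m t public

  1≤t : 1ℚ ℚ.≤ t
  1≤t = ℚ.≤-trans (1≤ι (ℕ.≤-trans 1≤m (ℕ.m≤n+m m k))) t≥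

  0≤t : 0ℚ ℚ.≤ t
  0≤t = ℚ.≤-trans 0≤1ℚ 1≤t

  -- Here κ = k + 1 and the order is n = k + m + 2, so the hypothesis on t reads t ≥ n - 2. The
  -- resulting slack ≥ κ yields both the positivity of the weights and `clique≤core`.
  k≤slack : ι (suc k) ℚ.≤ slack
  k≤slack = ≤-by-difference (t ℚ.- ι (k + m)) (difference-nonneg t≥) (begin
    t ℚ.- ι m ℚ.+ 1ℚ
      ≡⟨ solve 3 (λ t k m → t :- m :+ con 1ℚ := con 1ℚ :+ k :+ (t :- (k :+ m))) refl t (ι k) (ι m) ⟩
    1ℚ ℚ.+ ι k ℚ.+ (t ℚ.- (ι k ℚ.+ ι m))
      ≡⟨ cong (λ s → 1ℚ ℚ.+ ι k ℚ.+ (t ℚ.- s)) (ι-+ k m) ⟨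
    ι (suc k) ℚ.+ (t ℚ.- ι (k + m)) ∎)
    where
    open ≡-Reasoning
    open ℚ.+-*-Solver

  1≤slack : 1ℚ ℚ.≤ slack
  1≤slack = ℚ.≤-trans (1≤ι {suc k} (s≤s z≤n)) k≤slack

  0<-* : ∀ {p q} → 1ℚ ℚ.≤ p → 1ℚ ℚ.≤ q → 0ℚ ℚ.< p ℚ.* q
  0<-* {p} {q} 1≤p 1≤q = ℚ.positive⁻¹ (p ℚ.* q) {{ℚ.pos*pos⇒pos
    p {{ℚ.positive (ℚ.<-≤-trans 0<1ℚ 1≤p)}} q {{ℚ.positive (ℚ.<-≤-trans 0<1ℚ 1≤q)}}}}

  0<core : 0ℚ ℚ.< core
  0<core = 0<-* 1≤t 1≤slack

  0<pendant : 0ℚ ℚ.< pendant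
  0<pendant = 0<-* (1≤ι {suc k} (s≤s z≤n)) 1≤slack

  0<clique : 0ℚ ℚ.< clique
  0<clique = 0<-* (1≤ι {suc k} (s≤s z≤n)) 1≤t

  clique≤core : clique ℚ.≤ core
  clique≤core = ℚ.≤-trans (*-monoʳ 0≤t k≤slack) (ℚ.≤-reflexive (ℚ.*-comm slack t))

-- A vertex of degree at most κ

module _ {n k m} (G : Graph n) (v : Fin n) {t : ℚ} (n≡ : n ≡ suc (suc k + m)) (1≤m : 1 ≤ m)
  (d≤ : deg G v ≤ suc k) (t≥ : ι (k + m) ℚ.≤ t) where

  open PositiveWeights {k} {m} {t} 1≤m t≥

  weight : Bool → Bool → ℚ
  weight true  _     = pendant
  weight false true  = core
  weight false false = clique

  -- The eigenvector weights of K_κ ∇ (K₁ ∪ K_m) moved to G, with v as the pendant vertex and its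
  -- neighbours as core. Since v has at most κ neighbours, G is a subgraph of such a graph up to
  -- relabelling.
  weights : Fin n → ℚ
  weights u = weight (does (v ≟ u)) (adj G v u)

  weight-positive : ∀ b c → 0ℚ ℚ.< weight b c
  weight-positive true  _     = 0<pendant
  weight-positive false true  = 0<core
  weight-positive false false = 0<clique

  weights≥0 : ∀ u → 0ℚ ℚ.≤ weights u
  weights≥0 u = ℚ.<⇒≤ (weight-positive (does (v ≟ u)) (adj G v u))

  -- With exactly κ neighbours of v this would be an equality. Each neighbour fewer replaces a core
  -- weight by a clique weight, which is no larger.
  total-bound : Σℚ.sum weights ℚ.≤ total
  total-bound = begin
    Σℚ.sum weights
      ≡⟨ Σℚ.sum-cong-≗ expand ⟩
    Σℚ.sum (λ u → clique ℚ.+ S u ℚ.* p ℚ.+ ι (δ v u) ℚ.* q)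
      ≡⟨ Σℚ.∑-distrib-+ (λ u → clique ℚ.+ S u ℚ.* p) (λ u → ι (δ v u) ℚ.* q) ⟩
    Σℚ.sum (λ u → clique ℚ.+ S u ℚ.* p) ℚ.+ Σℚ.sum (λ u → ι (δ v u) ℚ.* q)
      ≡⟨ cong₂ ℚ._+_ (Σℚ.∑-distrib-+ (λ _ → clique) (λ u → S u ℚ.* p)) (sumℚ-δ v (λ _ → q)) ⟩
    Σℚ.sum {n} (λ _ → clique) ℚ.+ Σℚ.sum (λ u → S u ℚ.* p) ℚ.+ q
      ≡⟨ cong₂ (λ x y → x ℚ.+ y ℚ.+ q) (sumℚ-const n clique)
           (trans (sym (Σℚ.*-distribʳ-sum p S)) (cong (ℚ._* p) (sym (ι-sum (χ ∘ adj G v))))) ⟩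
    ι n ℚ.* clique ℚ.+ ι (deg G v) ℚ.* p ℚ.+ q
      ≤⟨ ℚ.+-monoˡ-≤ q (ℚ.+-monoʳ-≤ (ι n ℚ.* clique)
           (*-monoʳ (difference-nonneg clique≤core) (ι-mono d≤))) ⟩
    ι n ℚ.* clique ℚ.+ ι (suc k) ℚ.* p ℚ.+ q
      ≡⟨ cong (λ x → x ℚ.* clique ℚ.+ ι (suc k) ℚ.* p ℚ.+ q)
           (trans (cong ι n≡) (cong (1ℚ ℚ.+_) (ι-+ (suc k) m))) ⟩
    (1ℚ ℚ.+ (ι (suc k) ℚ.+ ι m)) ℚ.* clique ℚ.+ ι (suc k) ℚ.* p ℚ.+ q
      ≡⟨ solve 5 (λ k m a b c → (con 1ℚ :+ (k :+ m)) :* c :+ k :* (a :- c) :+ (b :- c)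
           := k :* a :+ b :+ m :* c) refl (ι (suc k)) (ι m) core pendant clique ⟩
    total ∎
    where
    open ℚ.≤-Reasoning
    open ℚ.+-*-Solver
    S : Fin n → ℚ
    S u = ι (χ (adj G v u))
    p = core ℚ.- clique
    q = pendant ℚ.- clique

    expand : ∀ u → weights u ≡ clique ℚ.+ S u ℚ.* p ℚ.+ ι (δ v u) ℚ.* q
    expand u with v ≟ u
    ... | yes refl rewrite irrefl G v =
      solve 3 (λ a b c → b := c :+ con 0ℚ :* (a :- c) :+ con 1ℚ :* (b :- c)) refl core pendant clique
    ... | no _ with adj G v u
    ...   | true  = solve 3 (λ a b c → a := c :+ con 1ℚ :* (a :- c) :+ con 0ℚ :* (b :- c))
          refl core pendant clique
    ...   | false = solve 3 (λ a b c → c := c :+ con 0ℚ :* (a :- c) :+ con 0ℚ :* (b :- c))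
          refl core pendant clique

  weights-at-v : weights v ≡ pendant
  weights-at-v = cong (λ b → weight b (adj G v v)) (dec-true (v ≟ v) refl)

  weights-off-v : ∀ {x} → v ≢ x → weights x ≡ weight false (adj G v x)
  weights-off-v {x} v≢x = cong (λ b → weight b (adj G v x)) (dec-false (v ≟ x) v≢x)

  subsum-bound : ∀ (c : Fin n → ℕ) → (∀ u → c u ≤ 1) →
    Σℚ.sum (λ u → ι (c u) ℚ.* weights u) ℚ.≤ total
  subsum-bound c c≤1 = ℚ.≤-trans (sumℚ-mono (λ u → ℚ.≤-trans
      (*-monoʳ (weights≥0 u) (ι-mono (c≤1 u))) (ℚ.≤-reflexive (ℚ.*-identityˡ (weights u)))))
    total-bound

  neighbours-bound : ∀ x → (G ⊙ weights) x ℚ.+ weights x ℚ.≤ total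
  neighbours-bound x = ℚ.≤-trans (ℚ.≤-reflexive (begin
      (G ⊙ weights) x ℚ.+ weights x
        ≡⟨ cong ((G ⊙ weights) x ℚ.+_) (sumℚ-δ x weights) ⟨
      (G ⊙ weights) x ℚ.+ Σℚ.sum (λ u → ι (δ x u) ℚ.* weights u)
        ≡⟨ Σℚ.∑-distrib-+ (λ u → ι (χ (adj G x u)) ℚ.* weights u) (λ u → ι (δ x u) ℚ.* weights u) ⟨
      Σℚ.sum (λ u → ι (χ (adj G x u)) ℚ.* weights u ℚ.+ ι (δ x u) ℚ.* weights u)
        ≡⟨ Σℚ.sum-cong-≗ (λ u → trans (sym (ℚ.*-distribʳ-+ (weights u) (ι (χ (adj G x u))) (ι (δ x u))))
             (cong (ℚ._* weights u) (sym (ι-+ (χ (adj G x u)) (δ x u))))) ⟩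
      Σℚ.sum (λ u → ι (χ (adj G x u) + δ x u) ℚ.* weights u) ∎))
    (subsum-bound (λ u → χ (adj G x u) + δ x u) atMostOne)
    where
    open ≡-Reasoning
    atMostOne : ∀ u → χ (adj G x u) + δ x u ≤ 1
    atMostOne u with x ≟ u
    ... | yes refl rewrite irrefl G x = ℕ.≤-refl
    ... | no _     = ℕ.≤-trans (ℕ.≤-reflexive (ℕ.+-identityʳ _)) (χ≤1 (adj G x u))

  nonNeighbour-bound : ∀ {x} → v ≢ x → adj G v x ≡ false →
    (G ⊙ weights) x ℚ.+ weights x ℚ.+ pendant ℚ.≤ total
  nonNeighbour-bound {x} v≢x vx∉G = ℚ.≤-trans (ℚ.≤-reflexive (begin
      (G ⊙ weights) x ℚ.+ weights x ℚ.+ pendant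
        ≡⟨ cong₂ (λ p q → (G ⊙ weights) x ℚ.+ p ℚ.+ q) (sumℚ-δ x weights)
             (trans (sumℚ-δ v weights) weights-at-v) ⟨
      (G ⊙ weights) x ℚ.+ Σℚ.sum (λ u → ι (δ x u) ℚ.* weights u) ℚ.+ Σℚ.sum (λ u → ι (δ v u) ℚ.* weights u)
        ≡⟨ cong (ℚ._+ Σℚ.sum (λ u → ι (δ v u) ℚ.* weights u))
             (Σℚ.∑-distrib-+ (λ u → ι (χ (adj G x u)) ℚ.* weights u) (λ u → ι (δ x u) ℚ.* weights u)) ⟨
      Σℚ.sum (λ u → ι (χ (adj G x u)) ℚ.* weights u ℚ.+ ι (δ x u) ℚ.* weights u)
        ℚ.+ Σℚ.sum (λ u → ι (δ v u) ℚ.* weights u)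
        ≡⟨ Σℚ.∑-distrib-+ (λ u → ι (χ (adj G x u)) ℚ.* weights u ℚ.+ ι (δ x u) ℚ.* weights u)
             (λ u → ι (δ v u) ℚ.* weights u) ⟨
      Σℚ.sum (λ u → ι (χ (adj G x u)) ℚ.* weights u ℚ.+ ι (δ x u) ℚ.* weights u ℚ.+ ι (δ v u) ℚ.* weights u)
        ≡⟨ Σℚ.sum-cong-≗ (λ u → factor (χ (adj G x u)) (δ x u) (δ v u) (weights u)) ⟩
      Σℚ.sum (λ u → ι (χ (adj G x u) + δ x u + δ v u) ℚ.* weights u) ∎))
    (subsum-bound (λ u → χ (adj G x u) + δ x u + δ v u) atMostOne)
    where
    open ≡-Reasoning
    factor : ∀ a b c w → ι a ℚ.* w ℚ.+ ι b ℚ.* w ℚ.+ ι c ℚ.* w ≡ ι (a + b + c) ℚ.* w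
    factor a b c w = begin
      ι a ℚ.* w ℚ.+ ι b ℚ.* w ℚ.+ ι c ℚ.* w
        ≡⟨ solve 4 (λ a b c w → a :* w :+ b :* w :+ c :* w := (a :+ b :+ c) :* w)
              refl (ι a) (ι b) (ι c) w ⟩
      (ι a ℚ.+ ι b ℚ.+ ι c) ℚ.* w
        ≡⟨ cong (ℚ._* w) (trans (ι-+ (a + b) c) (cong (ℚ._+ ι c) (ι-+ a b))) ⟨
      ι (a + b + c) ℚ.* w ∎
      where open ℚ.+-*-Solver

    atMostOne : ∀ u → χ (adj G x u) + δ x u + δ v u ≤ 1
    atMostOne u with x ≟ u | v ≟ u
    ... | yes refl | yes refl = contradiction refl v≢x
    ... | yes refl | no _     rewrite irrefl G x = ℕ.≤-refl
    ... | no _     | yes refl rewrite symm G x v | vx∉G = ℕ.≤-refl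
    ... | no _     | no _     = ℕ.≤-trans (ℕ.≤-reflexive (trans (ℕ.+-identityʳ _) (ℕ.+-identityʳ _))) (χ≤1 (adj G x u))

  pendant-bound : (G ⊙ weights) v ℚ.≤ t ℚ.* pendant
  pendant-bound = begin
    (G ⊙ weights) v
      ≡⟨ Σℚ.sum-cong-≗ atNeighbour ⟩
    Σℚ.sum (λ u → ι (χ (adj G v u)) ℚ.* core)
      ≡⟨ Σℚ.*-distribʳ-sum core (λ u → ι (χ (adj G v u))) ⟨
    Σℚ.sum (λ u → ι (χ (adj G v u))) ℚ.* core
      ≡⟨ cong (ℚ._* core) (ι-sum (χ ∘ adj G v)) ⟨
    ι (deg G v) ℚ.* core
      ≤⟨ *-monoʳ (ℚ.<⇒≤ 0<core) (ι-mono d≤) ⟩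
    ι (suc k) ℚ.* core
      ≡⟨ pendant-eq ⟩
    t ℚ.* pendant ∎
    where
    open ℚ.≤-Reasoning
    atNeighbour : ∀ u → ι (χ (adj G v u)) ℚ.* weights u ≡ ι (χ (adj G v u)) ℚ.* core
    atNeighbour u with v ≟ u
    ... | yes refl rewrite irrefl G v = trans (ℚ.*-zeroˡ pendant) (sym (ℚ.*-zeroˡ core))
    ... | no _ with adj G v u
    ...   | true  = refl
    ...   | false = trans (ℚ.*-zeroˡ clique) (sym (ℚ.*-zeroˡ core))

  -- Each vertex sees at most what its counterpart in K_κ ∇ (K₁ ∪ K_m) sees: v at most κ core
  -- weights, a neighbour of v everything but itself, any other vertex everything but itself and v.
  -- The three eigenvalue equations then bound these sums, the one for the core up to `defect`,
  -- whose sign is favourable.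
  lowDegree-superharmonic : 0ℚ ℚ.≤ defect → ∀ x → (G ⊙ weights) x ℚ.≤ t ℚ.* weights x
  lowDegree-superharmonic 0≤defect x = byCases (v ≟ x) (adj G v x) refl
    where
    byCases : Dec (v ≡ x) → ∀ b → adj G v x ≡ b → (G ⊙ weights) x ℚ.≤ t ℚ.* weights x
    byCases (yes refl) _ _ =
      subst (λ p → (G ⊙ weights) v ℚ.≤ t ℚ.* p) (sym weights-at-v) pendant-bound
    byCases (no v≢x) true vx∈G = begin
      (G ⊙ weights) x
        ≤⟨ +-cancelʳ-≤ᵠ core (begin
             (G ⊙ weights) x ℚ.+ core       ≡⟨ cong ((G ⊙ weights) x ℚ.+_) wx≡ ⟨
             (G ⊙ weights) x ℚ.+ weights x  ≤⟨ neighbours-bound x ⟩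
             total                          ≡⟨ solve 2 (λ p q → p := p :- q :+ q) refl total core ⟩
             total ℚ.- core ℚ.+ core        ∎) ⟩
      total ℚ.- core
        ≡⟨ core-eq ⟩
      t ℚ.* core ℚ.- defect
        ≤⟨ ≤-by-difference defect 0≤defect (solve 2 (λ p q → p := p :- q :+ q)
              refl (t ℚ.* core) defect) ⟩
      t ℚ.* core
        ≡⟨ cong (t ℚ.*_) wx≡ ⟨
      t ℚ.* weights x ∎
      where
      open ℚ.≤-Reasoning
      open ℚ.+-*-Solver
      wx≡ : weights x ≡ core
      wx≡ = trans (weights-off-v v≢x) (cong (weight false) vx∈G)
    byCases (no v≢x) false vx∉G = begin
      (G ⊙ weights) x
        ≤⟨ +-cancelʳ-≤ᵠ (clique ℚ.+ pendant) (begin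
             (G ⊙ weights) x ℚ.+ (clique ℚ.+ pendant)
               ≡⟨ ℚ.+-assoc ((G ⊙ weights) x) clique pendant ⟨
             (G ⊙ weights) x ℚ.+ clique ℚ.+ pendant
               ≡⟨ cong (λ p → (G ⊙ weights) x ℚ.+ p ℚ.+ pendant) wx≡ ⟨
             (G ⊙ weights) x ℚ.+ weights x ℚ.+ pendant
               ≤⟨ nonNeighbour-bound v≢x vx∉G ⟩
             total
               ≡⟨ solve 3 (λ p q r → p := p :- r :- q :+ (q :+ r)) refl total clique pendant ⟩
             total ℚ.- pendant ℚ.- clique ℚ.+ (clique ℚ.+ pendant) ∎) ⟩
      total ℚ.- pendant ℚ.- clique
        ≡⟨ clique-eq ⟩
      t ℚ.* clique
        ≡⟨ cong (t ℚ.*_) wx≡ ⟨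
      t ℚ.* weights x ∎
      where
      open ℚ.≤-Reasoning
      open ℚ.+-*-Solver
      wx≡ : weights x ≡ clique
      wx≡ = trans (weights-off-v v≢x) (cong (weight false) vx∉G)

  lowDegree-bound : ∀ {ρ} → IsEigenvalue (adjacencyMatrix G) ρ → 0ℚ ℚ.≤ defect → ¬ (fromℚ t ℝ.< ρ)
  lowDegree-bound {ρ} eigen 0≤defect = collatzWielandt G {ρ} eigen {weights} {t}
    (λ u → weight-positive (does (v ≟ u)) (adj G v u)) (lowDegree-superharmonic 0≤defect)

-- Rational bisection

toℚᵘ-ι : ∀ n → ℚ.toℚᵘ (ι n) ℚᵘ.≃ ℚᵘ.mkℚᵘ (ℤ.+ n) 0
toℚᵘ-ι zero    = ℚᵘ.*≡* refl
toℚᵘ-ι (suc n) = ℚᵘ.≃-trans (ℚ.toℚᵘ-homo-+ 1ℚ (ι n))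
  (ℚᵘ.≃-trans (ℚᵘ.+-cong (ℚᵘ.≃-refl {ℚ.toℚᵘ 1ℚ}) (toℚᵘ-ι n))
    (ℚᵘ.*≡* (cong (λ i → (ℤ.+ 1 ℤ.+ i) ℤ.* ℤ.+ 1) (ℤ.*-identityʳ (ℤ.+ n)))))

archimedean : ∀ ε → .{{Positive ε}} → ∃ λ n → 1ℚ ℚ.≤ ε ℚ.* ι n
-- The stored `d` is the denominator minus one: ε = (p + 1) / (d + 1), so the multiple by d + 1 is p
-- + 1 ≥ 1.
archimedean ε@(ℚ.mkℚ (ℤ.+ suc p) d c) = suc d , ℚ.toℚᵘ-cancel-≤ (ℚᵘ.≤-respʳ-≃
  (ℚᵘ.≃-sym (ℚᵘ.≃-trans (ℚ.toℚᵘ-homo-* ε (ι (suc d)))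
    (ℚᵘ.*-cong (ℚᵘ.≃-refl {ℚ.toℚᵘ ε}) (toℚᵘ-ι (suc d)))))
  (ℚᵘ.*≤* (ℤ.+≤+ (subst₂ _≤_ (lhs d) (rhs p d) (ℕ.m≤m+n (suc d) (p * suc d))))))
  where
  open +-*-Solver
  lhs : ∀ d → suc d ≡ suc (d * 1 + 0)
  lhs = solve 1 (λ d → con 1 :+ d := con 1 :+ (d :* con 1 :+ con 0)) refl
  rhs : ∀ p d → suc d + p * suc d ≡ suc ((d + p * suc d) * 1)
  rhs = solve 2 (λ p d → con 1 :+ d :+ p :* (con 1 :+ d) := con 1 :+ (d :+ p :* (con 1 :+ d)) :* con 1) refl

width : ℕ → ℚ
width zero    = 1ℚ
width (suc n) = ½ ℚ.* width n

0≤½ : 0ℚ ℚ.≤ ½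
0≤½ = ℚ.nonNegative⁻¹ ½

0≤width : ∀ n → 0ℚ ℚ.≤ width n
0≤width zero    = 0≤1ℚ
0≤width (suc n) = 0≤-* 0≤½ (0≤width n)

width-halves : ∀ n → width n ≡ width (suc n) ℚ.+ width (suc n)
width-halves n = solve 1 (λ w → w := con ½ :* w :+ con ½ :* w) refl (width n)
  where open ℚ.+-*-Solver

-- Halving wins the induction because n + 2 ≤ 2 (n + 1).
width-bound : ∀ n → ι (suc n) ℚ.* width n ℚ.≤ 1ℚ
width-bound zero    = ℚ.≤-refl
width-bound (suc n) = begin
  (1ℚ ℚ.+ ι (suc n)) ℚ.* (½ ℚ.* width n)
    ≤⟨ *-monoʳ (0≤width (suc n)) (ℚ.+-monoˡ-≤ (ι (suc n)) (1≤ι {suc n} (s≤s z≤n))) ⟩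
  (ι (suc n) ℚ.+ ι (suc n)) ℚ.* (½ ℚ.* width n)
    ≡⟨ solve 2 (λ i w → (i :+ i) :* (con ½ :* w) := i :* w) refl (ι (suc n)) (width n) ⟩
  ι (suc n) ℚ.* width n
    ≤⟨ width-bound n ⟩
  1ℚ ∎
  where
  open ℚ.≤-Reasoning
  open ℚ.+-*-Solver

width-antitone : ∀ {m n} → m ≤ n → width n ℚ.≤ width m
width-antitone {m} {n} m≤n = subst (λ l → width l ℚ.≤ width m) (ℕ.m∸n+n≡m m≤n) (drop (n ∸ m))
  where
  drop : ∀ d → width (d + m) ℚ.≤ width m
  drop zero    = ℚ.≤-refl
  drop (suc d) = ℚ.≤-trans
    (≤-by-difference (width (suc d + m)) (0≤width (suc d + m)) (width-halves (d + m)))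
    (drop d)

width→0 : ∀ ε → .{{Positive ε}} → ∃ λ N → ∀ n → N ≤ n → width n ℚ.< ε
width→0 ε with N , 1≤εN ← archimedean ε = N , λ n N≤n →
  ℚ.*-cancelˡ-<-nonNeg (ι (suc n)) {{ℚ.nonNegative (0≤ι (suc n))}} (begin-strict
    ι (suc n) ℚ.* width n  ≤⟨ width-bound n ⟩
    1ℚ                     ≤⟨ 1≤εN ⟩
    ε ℚ.* ι N              ≡⟨ ℚ.*-comm ε (ι N) ⟩
    ι N ℚ.* ε              ≤⟨ *-monoʳ (ℚ.<⇒≤ (ℚ.positive⁻¹ ε)) (ι-mono N≤n) ⟩
    ι n ℚ.* ε              ≡⟨ ℚ.+-identityˡ (ι n ℚ.* ε) ⟨
    0ℚ ℚ.+ ι n ℚ.* ε       <⟨ ℚ.+-monoˡ-< (ι n ℚ.* ε) (ℚ.positive⁻¹ ε) ⟩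
    ε ℚ.+ ι n ℚ.* ε        ≡⟨ solve 2 (λ e i → e :+ i :* e := (con 1ℚ :+ i) :* e) refl ε (ι n) ⟩
    ι (suc n) ℚ.* ε        ∎)
  where
  open ℚ.≤-Reasoning
  open ℚ.+-*-Solver

∣p-q∣≤ : ∀ {p q h} → p ℚ.≤ q ℚ.+ h → q ℚ.≤ p ℚ.+ h → ∣ p ℚ.- q ∣ ℚ.≤ h
∣p-q∣≤ {p} {q} {h} p≤q+h q≤p+h with ℚ.∣p∣≡p∨∣p∣≡-p (p ℚ.- q)
... | inj₁ eq = ℚ.≤-trans (ℚ.≤-reflexive eq) (+-cancelʳ-≤ᵠ q (ℚ.≤-trans
  (ℚ.≤-reflexive (solve 2 (λ p q → p :- q :+ q := p) refl p q))
  (ℚ.≤-trans p≤q+h (ℚ.≤-reflexive (ℚ.+-comm q h)))))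
  where open ℚ.+-*-Solver
... | inj₂ eq = ℚ.≤-trans (ℚ.≤-reflexive eq) (+-cancelʳ-≤ᵠ p (ℚ.≤-trans
  (ℚ.≤-reflexive (solve 2 (λ p q → :- (p :- q) :+ p := q) refl p q))
  (ℚ.≤-trans q≤p+h (ℚ.≤-reflexive (ℚ.+-comm p h)))))
  where open ℚ.+-*-Solver

module Bisection (f : ℚ → ℚ) (u₀ : ℚ) (f-lower : f (u₀ ℚ.- 1ℚ) ℚ.≤ 0ℚ) (f-upper : 0ℚ ℚ.≤ f u₀) where

  -- The outcome of the sign test is an argument, so that the invariants below can be proved by
  -- matching on it.
  refine : (u h : ℚ) → Dec (0ℚ ℚ.≤ f (u ℚ.- h)) → ℚ
  refine u h (yes _) = u ℚ.- h
  refine u h (no _)  = u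

  upper : ℕ → ℚ
  upper zero    = u₀
  upper (suc n) = refine (upper n) (width (suc n)) (0ℚ ℚ.≤? f (upper n ℚ.- width (suc n)))

  lower : ℕ → ℚ
  lower n = upper n ℚ.- width n

  private
    minus-plus : ∀ u h → u ≡ u ℚ.- h ℚ.+ h
    minus-plus = solve 2 (λ u h → u := u :- h :+ h) refl
      where open ℚ.+-*-Solver

    two-halves : ∀ u {h w} → w ≡ h ℚ.+ h → u ℚ.- h ℚ.- h ≡ u ℚ.- w
    two-halves u {h} w≡ = trans
      (solve 2 (λ u h → u :- h :- h := u :- (h :+ h)) refl u h)
      (cong (λ w → u ℚ.- w) (sym w≡))
      where open ℚ.+-*-Solver

    shrink : ∀ u {h} → 0ℚ ℚ.≤ h → u ℚ.- h ℚ.≤ u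
    shrink u {h} 0≤h = ≤-by-difference h 0≤h (minus-plus u h)

    0≤f-refine : ∀ u h d → 0ℚ ℚ.≤ f u → 0ℚ ℚ.≤ f (refine u h d)
    0≤f-refine u h (yes 0≤f) _  = 0≤f
    0≤f-refine u h (no _)   0≤f = 0≤f

    f-refine≤0 : ∀ u {h w} d → w ≡ h ℚ.+ h → f (u ℚ.- w) ℚ.≤ 0ℚ → f (refine u h d ℚ.- h) ℚ.≤ 0ℚ
    f-refine≤0 u (yes _)  w≡ f≤0 = subst (λ p → f p ℚ.≤ 0ℚ) (sym (two-halves u w≡)) f≤0
    f-refine≤0 u (no 0≰f) _  _   = ℚ.<⇒≤ (ℚ.≰⇒> 0≰f)

    refine-≤ : ∀ u {h} d → 0ℚ ℚ.≤ h → refine u h d ℚ.≤ u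
    refine-≤ u (yes _) 0≤h = shrink u 0≤h
    refine-≤ u (no _)  _   = ℚ.≤-refl

    ≤-refine : ∀ u {h w} d → 0ℚ ℚ.≤ h → w ≡ h ℚ.+ h → u ℚ.- w ℚ.≤ refine u h d ℚ.- h
    ≤-refine u     (yes _) _   w≡ = ℚ.≤-reflexive (sym (two-halves u w≡))
    ≤-refine u {h} (no _)  0≤h w≡ = ℚ.≤-trans (ℚ.≤-reflexive (sym (two-halves u w≡)))
      (shrink (u ℚ.- h) 0≤h)

    test : ∀ n → Dec (0ℚ ℚ.≤ f (upper n ℚ.- width (suc n)))
    test n = 0ℚ ℚ.≤? f (upper n ℚ.- width (suc n))

  0≤f-upper : ∀ n → 0ℚ ℚ.≤ f (upper n)
  0≤f-upper zero    = f-upper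
  0≤f-upper (suc n) = 0≤f-refine (upper n) (width (suc n)) (test n) (0≤f-upper n)

  f-lower≤0 : ∀ n → f (lower n) ℚ.≤ 0ℚ
  f-lower≤0 zero    = f-lower
  f-lower≤0 (suc n) = f-refine≤0 (upper n) {width (suc n)} {width n} (test n) (width-halves n) (f-lower≤0 n)

  private
    upper-step : ∀ n → upper (suc n) ℚ.≤ upper n
    upper-step n = refine-≤ (upper n) {width (suc n)} (test n) (0≤width (suc n))

    lower-step : ∀ n → lower n ℚ.≤ lower (suc n)
    lower-step n = ≤-refine (upper n) {width (suc n)} {width n} (test n) (0≤width (suc n)) (width-halves n)

    upper-antitone : ∀ d n → upper (d + n) ℚ.≤ upper n
    upper-antitone zero    n = ℚ.≤-refl
    upper-antitone (suc d) n = ℚ.≤-trans (upper-step (d + n)) (upper-antitone d n)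

    lower-monotone : ∀ d n → lower n ℚ.≤ lower (d + n)
    lower-monotone zero    n = ℚ.≤-refl
    lower-monotone (suc d) n = ℚ.≤-trans (lower-monotone d n) (lower-step (d + n))

  lower≤upper : ∀ n → lower n ℚ.≤ upper n
  lower≤upper n = ≤-by-difference (width n) (0≤width n)
    (minus-plus (upper n) (width n))

  upper≤ : ∀ {N n} → N ≤ n → upper n ℚ.≤ upper N
  upper≤ {N} {n} N≤n = subst (λ l → upper l ℚ.≤ upper N) (ℕ.m∸n+n≡m N≤n) (upper-antitone (n ∸ N) N)

  lower≤ : ∀ {N n} → N ≤ n → lower N ℚ.≤ lower n
  lower≤ {N} {n} N≤n = subst (λ l → lower N ℚ.≤ lower l) (ℕ.m∸n+n≡m N≤n) (lower-monotone (n ∸ N) N)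

  private
    close : ∀ {N m n} → N ≤ m → N ≤ n → upper m ℚ.≤ upper n ℚ.+ width N
    close {N} {m} {n} N≤m N≤n = begin
      upper m                  ≤⟨ upper≤ N≤m ⟩
      upper N                  ≡⟨ minus-plus (upper N) (width N) ⟩
      lower N ℚ.+ width N      ≤⟨ ℚ.+-monoˡ-≤ (width N) (ℚ.≤-trans (lower≤ N≤n) (lower≤upper n)) ⟩
      upper n ℚ.+ width N      ∎
      where open ℚ.≤-Reasoning

  upper-cauchy : IsCauchy upper
  upper-cauchy ε = N , λ m n N≤m N≤n →
    ℚ.≤-<-trans (∣p-q∣≤ {upper m} {upper n} {width N} (close N≤m N≤n) (close N≤n N≤m))
      (proj₂ (width→0 ε) N ℕ.≤-refl)
    where
    N : ℕ
    N = proj₁ (width→0 ε)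

  root : ℝ
  root = mkℝ upper upper-cauchy

-- Order of the reals

cauchy-≤ : ∀ x {η m n} → ∣ seq x m ℚ.- seq x n ∣ ℚ.< η → seq x m ℚ.≤ seq x n ℚ.+ η
cauchy-≤ x {η} {m} {n} close = begin
  seq x m
    ≡⟨ solve 2 (λ p q → p := q :+ (p :- q)) refl (seq x m) (seq x n) ⟩
  seq x n ℚ.+ (seq x m ℚ.- seq x n)
    ≤⟨ ℚ.+-monoʳ-≤ (seq x n) (ℚ.≤-trans (p≤∣p∣ (seq x m ℚ.- seq x n)) (ℚ.<⇒≤ close)) ⟩
  seq x n ℚ.+ η ∎
  where
  open ℚ.≤-Reasoning
  open ℚ.+-*-Solver

half-positive : ∀ ε → Positive ε → Positive (½ ℚ.* ε)
half-positive ε posε = ℚ.pos*pos⇒pos ½ ε {{posε}}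

-- Since x ≤ y is only a negation, it supplies no bound directly. A decidable comparison of
-- rationals at one late stage L decides between proving x < z outright and producing y < x, which
-- the hypothesis refutes.
≤-<-transℝ : ∀ {x y z} → x ℝ.≤ y → y ℝ.< z → x ℝ.< z
≤-<-transℝ {x} {y} {z} x≤y (ε , posε , N , y+ε≤z) =
  compare (seq x L ℚ.≤? seq y L ℚ.+ (η ℚ.+ η ℚ.+ η ℚ.+ η))
  where
  open ℚ.≤-Reasoning
  open ℚ.+-*-Solver
  -- η = ε / 8. The first branch spends 7 η of the gap ε: four for the tolerance of the test, two
  -- for passing between stages of x and y, and one as the new gap.
  η : ℚ
  η = ½ ℚ.* (½ ℚ.* (½ ℚ.* ε))

  posη : Positive η
  posη = half-positive (½ ℚ.* (½ ℚ.* ε)) (half-positive (½ ℚ.* ε) (half-positive ε posε))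

  Nx Ny L : ℕ
  Nx = proj₁ (cauchy x η {{posη}})
  Ny = proj₁ (cauchy y η {{posη}})
  L = N + (Nx + Ny)

  N≤L : N ≤ L
  N≤L = ℕ.m≤m+n N (Nx + Ny)

  Nx≤L : Nx ≤ L
  Nx≤L = ℕ.≤-trans (ℕ.m≤m+n Nx Ny) (ℕ.m≤n+m (Nx + Ny) N)

  Ny≤L : Ny ≤ L
  Ny≤L = ℕ.≤-trans (ℕ.m≤n+m Ny Nx) (ℕ.m≤n+m (Nx + Ny) N)

  near-x : ∀ {m n} → L ≤ m → L ≤ n → seq x m ℚ.≤ seq x n ℚ.+ η
  near-x {m} {n} L≤m L≤n = cauchy-≤ x (proj₂ (cauchy x η {{posη}}) m n
    (ℕ.≤-trans Nx≤L L≤m) (ℕ.≤-trans Nx≤L L≤n))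

  near-y : ∀ {m n} → L ≤ m → L ≤ n → seq y m ℚ.≤ seq y n ℚ.+ η
  near-y {m} {n} L≤m L≤n = cauchy-≤ y (proj₂ (cauchy y η {{posη}}) m n
    (ℕ.≤-trans Ny≤L L≤m) (ℕ.≤-trans Ny≤L L≤n))

  0≤η : 0ℚ ℚ.≤ η
  0≤η = ℚ.<⇒≤ (ℚ.positive⁻¹ η {{posη}})

  compare : Dec (seq x L ℚ.≤ seq y L ℚ.+ (η ℚ.+ η ℚ.+ η ℚ.+ η)) → x ℝ.< z
  compare (yes xL≤) = η , posη , L , λ n L≤n → begin
    seq x n ℚ.+ η
      ≤⟨ ℚ.+-monoˡ-≤ η (ℚ.≤-trans (near-x L≤n ℕ.≤-refl) (ℚ.+-monoˡ-≤ η xL≤)) ⟩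
    seq y L ℚ.+ (η ℚ.+ η ℚ.+ η ℚ.+ η) ℚ.+ η ℚ.+ η
      ≤⟨ ℚ.+-monoˡ-≤ η (ℚ.+-monoˡ-≤ η (ℚ.+-monoˡ-≤ (η ℚ.+ η ℚ.+ η ℚ.+ η) (near-y ℕ.≤-refl L≤n))) ⟩
    seq y n ℚ.+ η ℚ.+ (η ℚ.+ η ℚ.+ η ℚ.+ η) ℚ.+ η ℚ.+ η
      ≤⟨ ≤-by-difference η 0≤η (solve 2 (λ y e →
           let h = con ½ :* (con ½ :* (con ½ :* e)) in
           y :+ e := y :+ h :+ (h :+ h :+ h :+ h) :+ h :+ h :+ h) refl (seq y n) ε) ⟩
    seq y n ℚ.+ ε
      ≤⟨ y+ε≤z n (ℕ.≤-trans N≤L L≤n) ⟩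
    seq z n ∎
  compare (no xL≰) = contradiction (η , posη , L , λ n L≤n → begin
    seq y n ℚ.+ η
      ≤⟨ ℚ.+-monoˡ-≤ η (near-y L≤n ℕ.≤-refl) ⟩
    seq y L ℚ.+ η ℚ.+ η
      ≤⟨ ≤-by-difference η 0≤η refl ⟩
    seq y L ℚ.+ η ℚ.+ η ℚ.+ η
      ≤⟨ +-cancelʳ-≤ᵠ η (begin
           seq y L ℚ.+ η ℚ.+ η ℚ.+ η ℚ.+ η
             ≡⟨ solve 2 (λ y h → y :+ h :+ h :+ h :+ h := y :+ (h :+ h :+ h :+ h)) refl (seq y L) η ⟩
           seq y L ℚ.+ (η ℚ.+ η ℚ.+ η ℚ.+ η)
             ≤⟨ ℚ.<⇒≤ (ℚ.≰⇒> xL≰) ⟩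
           seq x L
             ≤⟨ near-x ℕ.≤-refl L≤n ⟩
           seq x n ℚ.+ η ∎) ⟩
    seq x n ∎) x≤y

-- Trades a real lower bound for a single rational term of its sequence, as the Collatz-Wielandt
-- bound takes a rational t. Half of the gap pays for the distance between stages.
approximation-below : ∀ {x y} → x ℝ.< y → ∃ λ M → fromℚ (seq x M) ℝ.< y
approximation-below {x} {y} (ε , posε , N , x+ε≤y) = M , η , posη , M , below
  where
  open ℚ.≤-Reasoning
  open ℚ.+-*-Solver
  η : ℚ
  η = ½ ℚ.* ε

  posη : Positive η
  posη = half-positive ε posε

  Nx M : ℕ
  Nx = proj₁ (cauchy x η {{posη}})
  M = N + Nx

  below : ∀ n → M ≤ n → seq x M ℚ.+ η ℚ.≤ seq y n
  below n M≤n = begin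
    seq x M ℚ.+ η
      ≤⟨ ℚ.+-monoˡ-≤ η (cauchy-≤ x (proj₂ (cauchy x η {{posη}}) M n
           (ℕ.m≤n+m Nx N) (ℕ.≤-trans (ℕ.m≤n+m Nx N) M≤n))) ⟩
    seq x n ℚ.+ η ℚ.+ η
      ≡⟨ solve 2 (λ x e → x :+ con ½ :* e :+ con ½ :* e := x :+ e) refl (seq x n) ε ⟩
    seq x n ℚ.+ ε
      ≤⟨ x+ε≤y n (ℕ.≤-trans (ℕ.m≤m+n N Nx) M≤n) ⟩
    seq y n ∎

fromℚ-mono-< : ∀ {p q y} → p ℚ.≤ q → fromℚ q ℝ.< y → fromℚ p ℝ.< y
fromℚ-mono-< p≤q (ε , posε , N , q+ε≤y) =
  ε , posε , N , λ n N≤n → ℚ.≤-trans (ℚ.+-monoˡ-≤ ε p≤q) (q+ε≤y n N≤n)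

-- The largest root of the defect

minusOne : ∀ p → p ≡ 1ℚ ℚ.+ p ℚ.- 1ℚ
minusOne = solve 1 (λ p → p := con 1ℚ :+ p :- con 1ℚ) refl
  where open ℚ.+-*-Solver

module Defect (k m : ℕ) where

  -- The characteristic polynomial of the 3 by 3 quotient matrix of K_κ ∇ (K₁ ∪ K_M) over its three
  -- kinds of vertices, for κ = k + 1 and M = m + 1.
  f : ℚ → ℚ
  f t = Weights.defect (suc k) (suc m) t

  -- With n = κ + M + 1 vertices, `u₀` is n - 1, the spectral radius of K_n, and `u₀` - 1 is that of
  -- the subgraph K_κ ∇ K_M, a clique on n - 1 vertices. The root sought lies between them.
  u₀ : ℚ
  u₀ = ι (suc k + suc m)

  private
    u₀≡ : u₀ ≡ ι (suc k) ℚ.+ ι (suc m)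
    u₀≡ = ι-+ (suc k) (suc m)

    f-at-u₀ : f (ι (suc k) ℚ.+ ι (suc m)) ≡
      ι (suc k) ℚ.* ι (suc m) ℚ.+ ι (suc k) ℚ.* ι (suc m) ℚ.+ ι (suc m) ℚ.* ι (suc m) ℚ.+ ι (suc m)
    f-at-u₀ = solve 2 (λ k m →
        let t = k :+ m
            s = t :- m :+ con 1ℚ
            c = t :* s
            total = k :* c :+ k :* s :+ m :* (k :* t)
        in t :* c :- (total :- c) := k :* m :+ k :* m :+ m :* m :+ m)
      refl (ι (suc k)) (ι (suc m))
      where open ℚ.+-*-Solver

    f-at-u₀-1 : f (ι (suc k) ℚ.+ ι (suc m) ℚ.- 1ℚ) ≡ ℚ.- (ι (suc k) ℚ.* ι (suc k))
    f-at-u₀-1 = solve 2 (λ k m →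
        let t = k :+ m :- con 1ℚ
            s = t :- m :+ con 1ℚ
            c = t :* s
            total = k :* c :+ k :* s :+ m :* (k :* t)
        in t :* c :- (total :- c) := :- (k :* k))
      refl (ι (suc k)) (ι (suc m))
      where open ℚ.+-*-Solver

  f-upper : 0ℚ ℚ.≤ f u₀
  f-upper = subst (λ t → 0ℚ ℚ.≤ f t) (sym u₀≡) (subst (0ℚ ℚ.≤_) (sym f-at-u₀)
    (ℚ.+-mono-≤ (ℚ.+-mono-≤ (ℚ.+-mono-≤ 0≤km 0≤km) (0≤-* (0≤ι (suc m)) (0≤ι (suc m)))) (0≤ι (suc m))))
    where
    0≤km : 0ℚ ℚ.≤ ι (suc k) ℚ.* ι (suc m)
    0≤km = 0≤-* (0≤ι (suc k)) (0≤ι (suc m))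

  f-lower : f (u₀ ℚ.- 1ℚ) ℚ.≤ 0ℚ
  f-lower = subst (λ t → f (t ℚ.- 1ℚ) ℚ.≤ 0ℚ) (sym u₀≡) (subst (ℚ._≤ 0ℚ) (sym f-at-u₀-1)
    (ℚ.neg-antimono-≤ (0≤-* (0≤ι (suc k)) (0≤ι (suc k)))))

  open Bisection f u₀ f-lower f-upper public

  -- The cubic f has leading coefficient 1 and nonpositive coefficients of t²
  -- and t, so its slope between l ≥ 0 and t ≥ l is at most l² + lt + t² ≤ 3t².
  f-growth : ∀ t w → 0ℚ ℚ.≤ w → w ℚ.≤ t → f t ℚ.≤ f (t ℚ.- w) ℚ.+ w ℚ.* (ι 3 ℚ.* (t ℚ.* t))
  f-growth t w 0≤w w≤t = ≤-by-difference
    (w ℚ.* (w ℚ.* (l ℚ.+ t) ℚ.+ w ℚ.* t ℚ.+ (ι m ℚ.+ ι k) ℚ.* (l ℚ.+ t) ℚ.+ (ι m ℚ.+ ι (suc k) ℚ.+ ι (suc k))))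
    (0≤-* 0≤w (ℚ.+-mono-≤ (ℚ.+-mono-≤ (ℚ.+-mono-≤ (0≤-* 0≤w 0≤l+t) (0≤-* 0≤w 0≤t))
        (0≤-* (ℚ.+-mono-≤ (0≤ι m) (0≤ι k)) 0≤l+t))
      (ℚ.+-mono-≤ (ℚ.+-mono-≤ (0≤ι m) (0≤ι (suc k))) (0≤ι (suc k)))))
    (solve 4 (λ t w k′ m′ →
        let k = con 1ℚ :+ k′
            m = con 1ℚ :+ m′
            S = λ t → t :- m :+ con 1ℚ
            C = λ t → t :* S t
            T = λ t → k :* C t :+ k :* S t :+ m :* (k :* t)
            F = λ t → t :* C t :- (T t :- C t)
            l = t :- w
        in F l :+ w :* (con (ι 3) :* (t :* t)) :=
           F t :+ w :* (w :* (l :+ t) :+ w :* t :+ (m′ :+ k′) :* (l :+ t) :+ (m′ :+ k :+ k)))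
      refl t w (ι k) (ι m))
    where
    open ℚ.+-*-Solver
    l = t ℚ.- w
    0≤t : 0ℚ ℚ.≤ t
    0≤t = ℚ.≤-trans 0≤w w≤t
    0≤l+t : 0ℚ ℚ.≤ l ℚ.+ t
    0≤l+t = ℚ.+-mono-≤ (difference-nonneg w≤t) 0≤t

  upper≥ : ∀ n → ι (k + suc m) ℚ.≤ upper n
  upper≥ n = ℚ.≤-trans (ℚ.≤-reflexive (minusOne (ι (k + suc m)))) (ℚ.≤-trans (lower≤ {0} {n} z≤n) (lower≤upper n))

  private
    -- The slope bound 3 t² of `f-growth` at the right end `u₀`, valid for all bisection intervals
    -- at once.
    C : ℚ
    C = ι 3 ℚ.* (u₀ ℚ.* u₀)

    0<u₀ : 0ℚ ℚ.< u₀
    0<u₀ = ℚ.<-≤-trans 0<1ℚ (1≤ι {suc k + suc m} (s≤s z≤n))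

    0<C : 0ℚ ℚ.< C
    0<C = ℚ.positive⁻¹ C {{ℚ.pos*pos⇒pos (ι 3) (u₀ ℚ.* u₀)
      {{ℚ.pos*pos⇒pos u₀ {{ℚ.positive 0<u₀}} u₀ {{ℚ.positive 0<u₀}}}}}}

    0≤upper : ∀ n → 0ℚ ℚ.≤ upper n
    0≤upper n = ℚ.≤-trans (0≤ι (k + suc m)) (upper≥ n)

    f-bound : ∀ n → f (upper n) ℚ.≤ width n ℚ.* C
    f-bound n = begin
      f (upper n)
        ≤⟨ f-growth (upper n) (width n) (0≤width n) width≤ ⟩
      f (lower n) ℚ.+ width n ℚ.* (ι 3 ℚ.* (upper n ℚ.* upper n))
        ≤⟨ ℚ.+-mono-≤ (f-lower≤0 n) (*-monoˡ (0≤width n) (*-monoˡ (0≤ι 3) square≤)) ⟩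
      0ℚ ℚ.+ width n ℚ.* C
        ≡⟨ ℚ.+-identityˡ (width n ℚ.* C) ⟩
      width n ℚ.* C ∎
      where
      open ℚ.≤-Reasoning
      square≤ : upper n ℚ.* upper n ℚ.≤ u₀ ℚ.* u₀
      square≤ = ℚ.≤-trans (*-monoʳ (0≤upper n) (upper≤ {0} {n} z≤n))
        (*-monoˡ (ℚ.<⇒≤ 0<u₀) (upper≤ {0} {n} z≤n))
      width≤ : width n ℚ.≤ upper n
      width≤ = ℚ.≤-trans (width-antitone {0} {n} z≤n)
        (ℚ.≤-trans (1≤ι {k + suc m} (ℕ.≤-trans (s≤s z≤n) (ℕ.m≤n+m (suc m) k))) (upper≥ n))

  f-upper→0 : ∀ ε → .{{Positive ε}} → ∃ λ N → ∀ n → N ≤ n → f (upper n) ℚ.< ε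
  f-upper→0 ε = N , λ n N≤n → ℚ.≤-<-trans (f-bound n)
    (ℚ.≤-<-trans (*-monoʳ (ℚ.<⇒≤ 0<C) (ℚ.<⇒≤ (small n N≤n))) ηC<ε)
    where
    scaled : ∃ λ η → Positive η × η ℚ.* C ℚ.< ε
    scaled = scaledBelow (ℚ.positive⁻¹ ε) 0<C
    η : ℚ
    η = proj₁ scaled
    ηC<ε : η ℚ.* C ℚ.< ε
    ηC<ε = proj₂ (proj₂ scaled)
    N : ℕ
    N = proj₁ (width→0 η {{proj₁ (proj₂ scaled)}})
    small : ∀ n → N ≤ n → width n ℚ.< η
    small = proj₂ (width→0 η {{proj₁ (proj₂ scaled)}})

-- Eigenvalues of H⟨ n , a ⟩

sumℚ-splitAt : ∀ a {b} (g : Fin a ⊎ Fin b → ℚ) →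
  Σℚ.sum (λ i → g (splitAt a i)) ≡ Σℚ.sum (λ i → g (inj₁ i)) ℚ.+ Σℚ.sum (λ j → g (inj₂ j))
sumℚ-splitAt zero    g = sym (ℚ.+-identityˡ _)
sumℚ-splitAt (suc a) g = trans (cong (g (inj₁ zero) ℚ.+_) (sumℚ-splitAt a (g ∘ map₁ suc)))
  (sym (ℚ.+-assoc (g (inj₁ zero)) _ _))

sumℚ-const₁ : ∀ n c → Σℚ.sum {n} (λ _ → ι 1 ℚ.* c) ≡ ι n ℚ.* c
sumℚ-const₁ n c = trans (sumℚ-const n (ι 1 ℚ.* c)) (cong (ι n ℚ.*_) (ℚ.*-identityˡ c))

sumℚ-const₀ : ∀ n c → Σℚ.sum {n} (λ _ → ι 0 ℚ.* c) ≡ 0ℚ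
sumℚ-const₀ n c = trans (Σℚ.sum-cong-≗ {n} (λ _ → ℚ.*-zeroˡ c)) (sumℚ-0 n)

-- Adding the missing diagonal term turns every summand into c.
K-row : ∀ a (u : Fin a) c → (K a ⊙ (λ _ → c)) u ≡ ι a ℚ.* c ℚ.- c
K-row a u c = begin
  (K a ⊙ (λ _ → c)) u
    ≡⟨ solve 2 (λ p q → p := p :+ q :- q) refl ((K a ⊙ (λ _ → c)) u) c ⟩
  (K a ⊙ (λ _ → c)) u ℚ.+ c ℚ.- c
    ≡⟨ cong (λ p → (K a ⊙ (λ _ → c)) u ℚ.+ p ℚ.- c) (sumℚ-δ u (λ _ → c)) ⟨
  (K a ⊙ (λ _ → c)) u ℚ.+ Σℚ.sum (λ v → ι (δ u v) ℚ.* c) ℚ.- c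
    ≡⟨ cong (ℚ._- c) (Σℚ.∑-distrib-+ (λ v → ι (χ (adj (K a) u v)) ℚ.* c) (λ v → ι (δ u v) ℚ.* c)) ⟨
  Σℚ.sum (λ v → ι (χ (adj (K a) u v)) ℚ.* c ℚ.+ ι (δ u v) ℚ.* c) ℚ.- c
    ≡⟨ cong (ℚ._- c) (Σℚ.sum-cong-≗ one) ⟩
  Σℚ.sum {a} (λ _ → c) ℚ.- c
    ≡⟨ cong (ℚ._- c) (sumℚ-const a c) ⟩
  ι a ℚ.* c ℚ.- c ∎
  where
  open ≡-Reasoning
  open ℚ.+-*-Solver
  one : ∀ v → ι (χ (adj (K a) u v)) ℚ.* c ℚ.+ ι (δ u v) ℚ.* c ≡ c
  one v with u ≟ v
  ... | yes _ = solve 1 (λ c → con 0ℚ :* c :+ con 1ℚ :* c := c) refl c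
  ... | no _  = solve 1 (λ c → con 1ℚ :* c :+ con 0ℚ :* c := c) refl c

≈-by-approximation : ∀ X μ x (p q r : ℕ → ℚ) →
  (∀ N → seq X N ≡ p N) → (∀ N → p N ≡ q N) → (∀ N → seq x N ≡ r N) →
  (∀ ε → .{{Positive ε}} → ∃ λ N₀ → ∀ N → N₀ ≤ N → ∣ q N ℚ.- seq μ N ℚ.* r N ∣ ℚ.< ε) →
  X ≈ μ ℝ.* x
≈-by-approximation X μ x p q r X≡p p≡q x≡r small ε = proj₁ (small ε) , λ N N₀≤N →
  subst₂ (λ s t → ∣ s ℚ.- seq μ N ℚ.* t ∣ ℚ.< ε) (sym (trans (X≡p N) (p≡q N))) (sym (x≡r N))
    (proj₂ (small ε) N N₀≤N)

approximateEigenvector : ∀ {n} (G : Graph n) (x : Fin n → ℝ) μ (y Ay : ℕ → Fin n → ℚ) →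
  (∀ N j → seq (x j) N ≡ y N j) → (∀ N i → (G ⊙ y N) i ≡ Ay N i) → ¬ (∀ i → x i ≈ 0ℝ) →
  (∀ i ε → .{{Positive ε}} → ∃ λ N₀ → ∀ N → N₀ ≤ N → ∣ Ay N i ℚ.- seq μ N ℚ.* y N i ∣ ℚ.< ε) →
  IsEigenvalue (adjacencyMatrix G) μ
approximateEigenvector G x μ y Ay x≡y Gy≡Ay x≉0 small = x , x≉0 , λ i →
  ≈-by-approximation ((adjacencyMatrix G · x) i) μ (x i)
    (λ N → (G ⊙ y N) i) (λ N → Ay N i) (λ N → y N i)
    (λ N → seq-⊙ G x (y N) N (x≡y N) i) (λ N → Gy≡Ay N i) (λ N → x≡y N i) (small i)

module Extremal (κ m : ℕ) where

  H : Graph (κ + (1 + m))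
  H = K κ ∇ (K 1 ∪ K m)

  Kind : Set
  Kind = Fin κ ⊎ (Fin 1 ⊎ Fin m)

  kind′ : Fin κ ⊎ Fin (1 + m) → Kind
  kind′ (inj₁ i) = inj₁ i
  kind′ (inj₂ j) = inj₂ (splitAt 1 j)

  kind : Fin (κ + (1 + m)) → Kind
  kind i = kind′ (splitAt κ i)

  pick : ∀ {A : Set} → A → A → A → Kind → A
  pick c p q (inj₁ _)        = c
  pick c p q (inj₂ (inj₁ _)) = p
  pick c p q (inj₂ (inj₂ _)) = q

  module _ (c p q : ℚ) where

    private
      T = ι κ ℚ.* c ℚ.+ p ℚ.+ ι m ℚ.* q

      adj′ : Fin κ ⊎ Fin (1 + m) → Fin κ ⊎ Fin (1 + m) → Bool
      adj′ = Juxtapose.adj′ true (K κ) (K 1 ∪ K m)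

      adj″ : Fin 1 ⊎ Fin m → Fin 1 ⊎ Fin m → Bool
      adj″ = Juxtapose.adj′ false (K 1) (K m)

      outer : ∀ s → Σℚ.sum (λ j → ι (χ (adj′ s (splitAt κ j))) ℚ.* pick c p q (kind j)) ≡
        Σℚ.sum (λ i → ι (χ (adj′ s (inj₁ i))) ℚ.* c) ℚ.+
        Σℚ.sum (λ j → ι (χ (adj′ s (inj₂ j))) ℚ.* pick c p q (inj₂ (splitAt 1 j)))
      outer s = sumℚ-splitAt κ (λ r → ι (χ (adj′ s r)) ℚ.* pick c p q (kind′ r))

      inner : ∀ (g : Fin 1 ⊎ Fin m → Bool) →
        Σℚ.sum (λ j → ι (χ (g (splitAt 1 j))) ℚ.* pick c p q (inj₂ (splitAt 1 j))) ≡
        Σℚ.sum (λ i → ι (χ (g (inj₁ i))) ℚ.* p) ℚ.+ Σℚ.sum (λ j → ι (χ (g (inj₂ j))) ℚ.* q)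
      inner g = sumℚ-splitAt 1 (λ r → ι (χ (g r)) ℚ.* pick c p q (inj₂ r))

    rowValue : ∀ s → Σℚ.sum (λ j → ι (χ (adj′ s (splitAt κ j))) ℚ.* pick c p q (kind j)) ≡
      pick (T ℚ.- c) (ι κ ℚ.* c) (T ℚ.- p ℚ.- q) (kind′ s)
    rowValue s@(inj₁ u) = begin
      Σℚ.sum (λ j → ι (χ (adj′ s (splitAt κ j))) ℚ.* pick c p q (kind j))
        ≡⟨ outer s ⟩
      (K κ ⊙ (λ _ → c)) u ℚ.+ Σℚ.sum (λ j → ι 1 ℚ.* pick c p q (inj₂ (splitAt 1 j)))
        ≡⟨ cong₂ ℚ._+_ (K-row κ u c) (trans (inner (λ _ → true))
             (cong₂ ℚ._+_ (sumℚ-const₁ 1 p) (sumℚ-const₁ m q))) ⟩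
      ι κ ℚ.* c ℚ.- c ℚ.+ (ι 1 ℚ.* p ℚ.+ ι m ℚ.* q)
        ≡⟨ solve 4 (λ k c p r → k :- c :+ (con 1ℚ :* p :+ r) := k :+ p :+ r :- c)
              refl (ι κ ℚ.* c) c p (ι m ℚ.* q) ⟩
      T ℚ.- c ∎
      where
      open ≡-Reasoning
      open ℚ.+-*-Solver
    rowValue s@(inj₂ w) = trans (outer s) (trans
        (cong₂ ℚ._+_ (sumℚ-const₁ κ c) (inner (λ r → adj″ (splitAt 1 w) r)))
        (within (splitAt 1 w)))
      where
      within : ∀ r → ι κ ℚ.* c ℚ.+ (Σℚ.sum (λ i → ι (χ (adj″ r (inj₁ i))) ℚ.* p) ℚ.+
          Σℚ.sum (λ j → ι (χ (adj″ r (inj₂ j))) ℚ.* q)) ≡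
        pick (T ℚ.- c) (ι κ ℚ.* c) (T ℚ.- p ℚ.- q) (inj₂ r)
      within (inj₁ u) = begin
        ι κ ℚ.* c ℚ.+ ((K 1 ⊙ (λ _ → p)) u ℚ.+ Σℚ.sum {m} (λ _ → ι 0 ℚ.* q))
          ≡⟨ cong₂ (λ x y → ι κ ℚ.* c ℚ.+ (x ℚ.+ y)) (K-row 1 u p) (sumℚ-const₀ m q) ⟩
        ι κ ℚ.* c ℚ.+ (ι 1 ℚ.* p ℚ.- p ℚ.+ 0ℚ)
          ≡⟨ solve 2 (λ x p → x :+ (con 1ℚ :* p :- p :+ con 0ℚ) := x) refl (ι κ ℚ.* c) p ⟩
        ι κ ℚ.* c ∎
        where
        open ≡-Reasoning
        open ℚ.+-*-Solver
      within (inj₂ v) = begin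
        ι κ ℚ.* c ℚ.+ (Σℚ.sum {1} (λ _ → ι 0 ℚ.* p) ℚ.+ (K m ⊙ (λ _ → q)) v)
          ≡⟨ cong₂ (λ x y → ι κ ℚ.* c ℚ.+ (x ℚ.+ y)) (sumℚ-const₀ 1 p) (K-row m v q) ⟩
        ι κ ℚ.* c ℚ.+ (0ℚ ℚ.+ (ι m ℚ.* q ℚ.- q))
          ≡⟨ solve 4 (λ x p y q → x :+ (con 0ℚ :+ (y :- q)) := x :+ p :+ y :- p :- q)
                refl (ι κ ℚ.* c) p (ι m ℚ.* q) q ⟩
        T ℚ.- p ℚ.- q ∎
        where
        open ≡-Reasoning
        open ℚ.+-*-Solver

    H-row : ∀ i → (H ⊙ (λ j → pick c p q (kind j))) i ≡ pick (T ℚ.- c) (ι κ ℚ.* c) (T ℚ.- p ℚ.- q) (kind i)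
    H-row i = rowValue (splitAt κ i)

  module _ (c p q μ : ℝ) where

    private
      T : ℕ → ℚ
      T n = ι κ ℚ.* seq c n ℚ.+ seq p n ℚ.+ ι m ℚ.* seq q n

      x : Fin (κ + (1 + m)) → ℝ
      x i = pick c p q (kind i)

      xₙ : ℕ → Kind → ℚ
      xₙ n = pick (seq c n) (seq p n) (seq q n)

      Axₙ : ℕ → Kind → ℚ
      Axₙ n = pick (T n ℚ.- seq c n) (ι κ ℚ.* seq c n) (T n ℚ.- seq p n ℚ.- seq q n)

      seq-pick : ∀ n s → seq (pick c p q s) n ≡ xₙ n s
      seq-pick n (inj₁ _)        = refl
      seq-pick n (inj₂ (inj₁ _)) = refl
      seq-pick n (inj₂ (inj₂ _)) = refl

    -- At a bisected μ the pendant and clique equations hold exactly at every stage, and only the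
    -- core equation has an error. The arguments of type `Fin κ` and `Fin m` restrict the demands to
    -- kinds of vertices that occur, so that κ = 0 is covered.
    eigenvalue : (Fin κ → ∀ ε → .{{Positive ε}} →
        ∃ λ N → ∀ n → N ≤ n → ∣ T n ℚ.- seq c n ℚ.- seq μ n ℚ.* seq c n ∣ ℚ.< ε) →
      (∀ n → ι κ ℚ.* seq c n ≡ seq μ n ℚ.* seq p n) →
      (∀ n → T n ℚ.- seq p n ℚ.- seq q n ≡ seq μ n ℚ.* seq q n) →
      ¬ (p ≈ 0ℝ × (Fin m → q ≈ 0ℝ)) →
      IsEigenvalue (adjacencyMatrix H) μ
    eigenvalue core-≈ pendant-≡ clique-≡ nonzero =
      approximateEigenvector H x μ (λ n j → xₙ n (kind j)) (λ n i → Axₙ n (kind i))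
        (λ n j → seq-pick n (kind j)) (λ n → H-row (seq c n) (seq p n) (seq q n))
        x≉0 (λ i → error (kind i))
      where
      exact : ∀ {y z} ε → .{{Positive ε}} → y ≡ z → ∣ y ℚ.- z ∣ ℚ.< ε
      exact {y} ε refl = subst (λ d → ∣ d ∣ ℚ.< ε) (sym (ℚ.+-inverseʳ y)) (ℚ.positive⁻¹ ε)

      error : ∀ s ε → .{{Positive ε}} →
        ∃ λ N → ∀ n → N ≤ n → ∣ Axₙ n s ℚ.- seq μ n ℚ.* xₙ n s ∣ ℚ.< ε
      error (inj₁ u)        ε = core-≈ u ε
      error (inj₂ (inj₁ _)) ε = 0 , λ n _ → exact ε (pendant-≡ n)
      error (inj₂ (inj₂ _)) ε = 0 , λ n _ → exact ε (clique-≡ n)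

      x≉0 : ¬ (∀ i → x i ≈ 0ℝ)
      x≉0 x≈0 = nonzero (at zero , λ y → at (suc y))
        where
        at : ∀ w → pick c p q (kind′ (inj₂ w)) ≈ 0ℝ
        at w = subst (λ s → pick c p q (kind′ s) ≈ 0ℝ) (splitAt-↑ʳ κ (1 + m) w) (x≈0 (κ ↑ʳ w))

≥1⇒≉0 : ∀ x → (∀ n → 1ℚ ℚ.≤ seq x n) → ¬ (x ≈ 0ℝ)
≥1⇒≉0 x 1≤x x≈0 = contradiction
  (ℚ.≤-<-trans (ℚ.≤-trans (1≤x N) (ℚ.≤-trans (p≤∣p∣ (seq x N))
    (ℚ.≤-reflexive (cong ∣_∣ (sym (ℚ.+-identityʳ (seq x N))))))) (proj₂ (x≈0 1ℚ) N ℕ.≤-refl))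
  (ℚ.<-irrefl refl)
  where
  N : ℕ
  N = proj₁ (x≈0 1ℚ)

-- For κ = 0 the pendant and clique values of `Weights` vanish. The indicator of the clique is an
-- eigenvector instead, and its eigenvalue is an integer, so no bisection is involved.
extremal-eigenvalue₁ : ∀ m → IsEigenvalue (adjacencyMatrix (Extremal.H zero (suc m))) (fromℚ (ι (suc m) ℚ.- 1ℚ))
extremal-eigenvalue₁ m = Extremal.eigenvalue zero (suc m) 0ℝ 0ℝ 1ℝ (fromℚ (ι (suc m) ℚ.- 1ℚ))
  (λ ())
  (λ n → solve 1 (λ m → con 0ℚ :* con 0ℚ := (m :- con 1ℚ) :* con 0ℚ) refl (ι (suc m)))
  (λ n → solve 1 (λ m → con 0ℚ :* con 0ℚ :+ con 0ℚ :+ m :* con 1ℚ :- con 0ℚ :- con 1ℚ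
    := (m :- con 1ℚ) :* con 1ℚ) refl (ι (suc m)))
  (λ (_ , q≈0) → ≥1⇒≉0 1ℝ (λ _ → ℚ.≤-refl) (q≈0 zero))
  where open ℚ.+-*-Solver

-- Since ρ(H) is the largest eigenvalue, this gives `root` ≤ ρ(H). The core equation fails at stage
-- n by exactly f (upper n), which tends to 0.
extremal-eigenvalue : ∀ k m →
  IsEigenvalue (adjacencyMatrix (Extremal.H (suc k) (suc m))) (Defect.root k m)
extremal-eigenvalue k m = Extremal.eigenvalue (suc k) (suc m) core pendant clique root
  (λ _ ε → proj₁ (f-upper→0 ε) , λ n N≤n →
    ℚ.≤-<-trans (ℚ.≤-reflexive (defect-abs n)) (proj₂ (f-upper→0 ε) n N≤n))
  (λ n → Weights.pendant-eq (suc k) (suc m) (upper n))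
  (λ n → Weights.clique-eq (suc k) (suc m) (upper n))
  (λ (p≈0 , _) → ≥1⇒≉0 pendant 1≤pendant p≈0)
  where
  open Defect k m
  slack core pendant clique : ℝ
  slack   = root ℝ.+ fromℚ (ℚ.- ι (suc m)) ℝ.+ 1ℝ
  core    = root ℝ.* slack
  pendant = fromℚ (ι (suc k)) ℝ.* slack
  clique  = fromℚ (ι (suc k)) ℝ.* root

  swap : ∀ p q → p ℚ.- q ≡ ℚ.- (q ℚ.- p)
  swap = solve 2 (λ p q → p :- q := :- (q :- p)) refl
    where open ℚ.+-*-Solver

  defect-abs : ∀ n → let open Weights (suc k) (suc m) (upper n) renaming (core to coreₙ) in
    ∣ total ℚ.- coreₙ ℚ.- upper n ℚ.* coreₙ ∣ ≡ defect
  defect-abs n = begin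
    ∣ total ℚ.- coreₙ ℚ.- upper n ℚ.* coreₙ ∣      ≡⟨ cong ∣_∣ (swap (total ℚ.- coreₙ) (upper n ℚ.* coreₙ)) ⟩
    ∣ ℚ.- defect ∣                                 ≡⟨ ℚ.∣-p∣≡∣p∣ defect ⟩
    ∣ defect ∣                                     ≡⟨ ℚ.0≤p⇒∣p∣≡p (0≤f-upper n) ⟩
    defect                                         ∎
    where
    open ≡-Reasoning
    open Weights (suc k) (suc m) (upper n) renaming (core to coreₙ)

  1≤pendant : ∀ n → 1ℚ ℚ.≤ seq pendant n
  1≤pendant n = ℚ.≤-trans (ℚ.≤-trans 1≤slack (ℚ.≤-reflexive (sym (ℚ.*-identityˡ _))))
    (*-monoʳ (ℚ.≤-trans 0≤1ℚ 1≤slack) (1≤ι {suc k} (s≤s z≤n)))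
    where open PositiveWeights {k} {suc m} {upper n} (s≤s z≤n) (upper≥ n) using (1≤slack)

-- From the spectral bounds to the factor

fewNonEdges : ∀ {N D} {G : Graph (2 + N)} → (∀ v → deg (complement G) v ≤ D) →
  ∀ {ρ} → IsEigenvalue (adjacencyMatrix G) ρ → fromℚ (ι N) ℝ.< ρ → size (complement G) ≤ N + D
fewNonEdges {N} {D} {G} f≤D {ρ} eigen N<ρ = ℕ.≮⇒≥ λ many →
  spectralRadius-bound {N} {D} {G} f≤D many {ρ} eigen N<ρ

-- A largest degree D of F satisfies 2 D ≤ `size F` ≤ N + D, hence D ≤ N = n - 2, so no vertex of G
-- is isolated.
positiveDegrees : ∀ {N} (G : Graph (2 + N)) {ρ} → IsEigenvalue (adjacencyMatrix G) ρ →
  fromℚ (ι N) ℝ.< ρ → ∀ v → 1 ≤ deg G v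
positiveDegrees {N} G {ρ} eigen N<ρ v = fromMax (argmax (deg F))
  where
  F = complement G
  fromMax : (∃ λ w → ∀ u → deg F u ≤ deg F w) → 1 ≤ deg G v
  fromMax (w , f≤D) = ≤-cancel (deg F v + 1)
    (ℕ.+-monoˡ-≤ 2 (ℕ.≤-trans (f≤D v) D≤N))
    (sym (ℕ.+-assoc (deg F v) 1 1))
    (trans (ℕ.+-comm N 2) (trans (sym (deg-complement G v)) (rearrange (deg G v) (deg F v))))
    where
    open +-*-Solver
    D≤N : deg F w ≤ N
    D≤N = ℕ.+-cancelʳ-≤ (deg F w) _ _ (ℕ.≤-trans (double-degree F w)
      (fewNonEdges {G = G} f≤D {ρ} eigen N<ρ))
    rearrange : ∀ d f → d + f + 1 ≡ f + 1 + d
    rearrange = solve 2 (λ d f → d :+ f :+ con 1 := f :+ con 1 :+ d) refl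

largeRadius⇒factor : ∀ {N a} (G : Graph (2 + N)) {ρ} → IsEigenvalue (adjacencyMatrix G) ρ →
  fromℚ (ι N) ℝ.< ρ → 1 ≤ a → 4 * a ≤ 3 + N → 2 ∣ a * (2 + N) →
  (∀ v → a ≤ deg G v) → HasFactor a a G
largeRadius⇒factor {N} {a} G {ρ} eigen N<ρ 1≤a 4a≤ even a≤d = fromMax (argmax (deg F))
  where
  F = complement G
  fromMax : (∃ λ w → ∀ u → deg F u ≤ deg F w) → HasFactor a a G
  fromMax (w , f≤D) = dense⇒factor {G = G} {w} 1≤a (s≤s (s≤s z≤n)) even a≤d
    λ {u} {v} u≢v u≢w v≢w → dense-arithmetic
      {N} {a} {deg F w} {size F} {deg G u} {deg G v} {deg F u} {deg F v} 4a≤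
      (deg-complement G u) (deg-complement G v) (f≤D u) (f≤D v)
      (fewNonEdges {G = G} f≤D {ρ} eigen N<ρ) (three-degrees F u≢v u≢w v≢w)

factor₁ : ∀ {N} (G : Graph (2 + N)) (ρG ρH : ℝ) → IsSpectralRadius G ρG →
  IsSpectralRadius (Extremal.H zero (suc N)) ρH → ρG > ρH →
  4 * 1 ≤ 3 + N → 2 ∣ 1 * (2 + N) → HasFactor 1 1 G
factor₁ {N} G ρG ρH (eigenG , _) (_ , largest) ρH<ρG 4≤ even =
  largeRadius⇒factor G {ρG} eigenG N<ρG ℕ.≤-refl 4≤ even (positiveDegrees G {ρG} eigenG N<ρG)
  where
  N<ρG : fromℚ (ι N) ℝ.< ρG
  N<ρG = fromℚ-mono-< {y = ρG} (ℚ.≤-reflexive (minusOne (ι N)))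
    (≤-<-transℝ {fromℚ (ι (suc N) ℚ.- 1ℚ)} {ρH} {ρG}
      (largest (fromℚ (ι (suc N) ℚ.- 1ℚ)) (extremal-eigenvalue₁ N)) ρH<ρG)

factor₂ : ∀ {k m} (G : Graph (2 + (k + suc m))) (ρG ρH : ℝ) → IsSpectralRadius G ρG →
  IsSpectralRadius (Extremal.H (suc k) (suc m)) ρH → ρG > ρH →
  4 * suc (suc k) ≤ 3 + (k + suc m) → 2 ∣ suc (suc k) * (2 + (k + suc m)) →
  HasFactor (suc (suc k)) (suc (suc k)) G
factor₂ {k} {m} G ρG ρH (eigenG , _) (_ , largest) ρH<ρG 4a≤ even =
  fromApproximation (approximation-below {root} {ρG}
    (≤-<-transℝ {root} {ρH} {ρG} (largest root (extremal-eigenvalue k m)) ρH<ρG))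
  where
  open Defect k m
  a = suc (suc k)

  -- The one rational t = `upper M` < ρ(G) serves twice: t ≥ n - 2 feeds the bound on nonedges, and
  -- f t ≥ 0 excludes a vertex of degree at most k + 1 = a - 1.
  fromApproximation : (∃ λ M → fromℚ (upper M) ℝ.< ρG) → HasFactor a a G
  fromApproximation (M , t<ρG) = largeRadius⇒factor G {ρG} eigenG
    (fromℚ-mono-< {y = ρG} (upper≥ M) t<ρG) (s≤s z≤n) 4a≤ even
    λ v → ℕ.≮⇒≥ λ d<a → lowDegree-bound {k = k} {m = suc m} G v {upper M} refl (s≤s z≤n)
      (ℕ.≤-pred d<a) (upper≥ M) {ρG} eigenG (0≤f-upper M) t<ρG

relax : ∀ {n a b} {G : Graph n} → a ≤ b → HasFactor a a G → HasFactor a b G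
relax a≤b (F , F⊆G , degrees) =
  F , F⊆G , λ v → proj₁ (degrees v) , ℕ.≤-trans (proj₂ (degrees v)) a≤b

order-bound : ∀ {a b n} → b ≥ a → n ≥ 3 * a + b ∸ 1 → 4 * a ≤ suc n
order-bound {a} {b} {n} b≥a n≥ = begin
  4 * a        ≡⟨ solve 1 (λ a → con 4 :* a := con 3 :* a :+ a) refl a ⟩
  3 * a + a    ≤⟨ ℕ.+-monoʳ-≤ (3 * a) b≥a ⟩
  3 * a + b    ≤⟨ ℕ.≤-trans (ℕ.m≤n+m∸n (3 * a + b) 1) (s≤s n≥) ⟩
  suc n        ∎
  where
  open ℕ.≤-Reasoning
  open +-*-Solver

-- The orders a ∸ 1 and n ∸ a of the cliques are replaced by variables here, so
-- that the cases below can match on them.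
regular-factor : ∀ κ m {a n} → a ≡ suc κ → n ≡ suc κ + m → 4 * a ≤ suc n → 2 ∣ a * n →
  (G : Graph n) (ρG ρH : ℝ) → IsSpectralRadius G ρG → IsSpectralRadius (Extremal.H κ m) ρH →
  ρG > ρH → HasFactor a a G
regular-factor zero zero refl refl (s≤s (s≤s ())) _ _ _ _ _ _ _
regular-factor zero (suc m) refl refl 4a≤ even G ρG ρH isG isH ρH<ρG =
  factor₁ G ρG ρH isG isH ρH<ρG 4a≤ even
regular-factor (suc k) zero refl refl 4a≤ _ _ _ _ _ _ _ = contradiction impossible λ ()
  where
  open +-*-Solver
  impossible : 5 + 3 * k ≤ 0
  impossible = ≤-cancel (3 + k) 4a≤
    (solve 1 (λ k → con 4 :* (con 2 :+ k) := con 3 :+ k :+ (con 5 :+ con 3 :* k)) refl k) refl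
regular-factor (suc k) (suc m) refl refl 4a≤ even G ρG ρH isG isH ρH<ρG =
  factor₂ {k} {m} G ρG ρH isG isH ρH<ρG 4a≤ even

extremal≡ : ∀ n a → H⟨ n , a ⟩ ≡ Extremal.H (a ∸ 1) (n ∸ a)
extremal≡ n a = refl

theorem1p3 : (a b n : ℕ) → b ≥ a → a ≥ 1 → n ≥ 3 * a + b ∸ 1 → 2 ∣ a * n →
    (G : Graph n) (ρG ρH : ℝ) →
    IsSpectralRadius G ρG → IsSpectralRadius H⟨ n , a ⟩ ρH →
    ρG > ρH → HasFactor a b G
theorem1p3 a b n b≥a a≥1 n≥ even G ρG ρH isG isH ρH<ρG = relax {G = G} b≥a
  (regular-factor (a ∸ 1) (n ∸ a) a≡ n≡ 4a≤ even G ρG ρH isG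
    (subst (λ F → IsSpectralRadius F ρH) (extremal≡ n a) isH) ρH<ρG)
  where
  4a≤ : 4 * a ≤ suc n
  4a≤ = order-bound b≥a n≥

  a≡ : a ≡ suc (a ∸ 1)
  a≡ = sym (ℕ.m+[n∸m]≡n a≥1)

  a≤n : a ≤ n
  a≤n = ℕ.≤-pred (ℕ.≤-trans (ℕ.+-monoˡ-≤ a (ℕ.≤-trans a≥1 (ℕ.m≤m+n a (a + (a + 0)))))
    (ℕ.≤-trans (ℕ.≤-reflexive (ℕ.+-comm (3 * a) a)) 4a≤))

  n≡ : n ≡ suc (a ∸ 1) + (n ∸ a)
  n≡ = trans (sym (ℕ.m+[n∸m]≡n a≤n)) (cong (_+ (n ∸ a)) a≡)
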